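{- Let $P$ be a level Eulerian poset with underlying digraph on the vertex set $V$, and let $x,y\in V$. Then the $\mathbf{a}\mathbf{b}$-series $\Psi_{x,y}$ of $P$ is a rational generating function in the non-commutative variables $\mathbf{c}=\mathbf{a}+\mathbf{b}$ and $\mathbf{d}=\mathbf{a}\mathbf{b}+\mathbf{b}\mathbf{a}$; that is, there is a rational non-commutative formal power series $\Phi$ in two variables such that $\Psi_{x,y}=\Phi(\mathbf{a}+\mathbf{b},\,\mathbf{a}\mathbf{b}+\mathbf{b}\mathbf{a})$.
   Context: Level poset: let $M$ be a $0/1$ square matrix with rows and columns indexed by a finite nonempty set $V$. The level poset of $M$ is the poset on $V\times\mathbb{Z}$ with $(u,i)<(v,j)$ if and only if $i<j$ and $(M^{j-i})_{u,v}>0$; the second coordinate is its rank function. A finite graded poset (with minimum, maximum and rank function $\rho$) is Eulerian if every interval $[x,y]$ in it of rank at least $1$ satisfies $\sum_{x\le z\le y}(-1)^{\rho(z)}=0$. A level poset is level Eulerian if every one of its intervals is Eulerian. $\mathbf{a}\mathbf{b}$-index: for a finite graded poset $Q$ of rank $m+1$ with minimum $\hat0$, maximum $\hat1$ and rank function $\rho$, and a chain $c=\{\hat0=x_0<x_1<\cdots<x_{k+1}=\hat1\}$, put $$\operatorname{wt}(c)=(\mathbf{a}-\mathbf{b})^{\rho(x_0,x_1)-1}\cdot\mathbf{b}\cdot(\mathbf{a}-\mathbf{b})^{\rho(x_1,x_2)-1}\cdot\mathbf{b}\cdots\mathbf{b}\cdot(\mathbf{a}-\mathbf{b})^{\rho(x_k,x_{k+1})-1},$$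 where $\rho(x,y)=\rho(y)-\rho(x)$ and $\mathbf{a},\mathbf{b}$ are non-commuting variables of degree one. Then $\Psi(Q)=\sum_c\operatorname{wt}(c)$, summed over all chains $c$ containing $\hat0$ and $\hat1$; it is homogeneous of degree $m$. $\mathbf{a}\mathbf{b}$-series: $\Psi_{x,y}=\sum_{m\ge0}\Psi([(x,0),(y,m+1)])\in\mathbb{R}\langle\langle\mathbf{a},\mathbf{b}\rangle\rangle$, where $\Psi([(x,0),(y,m+1)])$ is taken to be $0$ if $(x,0)\not\le(y,m+1)$. A non-commutative formal power series is rational if it belongs to the smallest set of series containing all non-commutative polynomials and closed under sums, products, and inverses of series with nonzero constant term. -}

module Defs where

open import Level using (0ℓ)
open import Algebra.Bundles using (CommutativeRing)
import Algebra.Properties.Semiring.Sum as Sum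
open import Data.Bool.Base using (if_then_else_)
open import Data.Fin.Base using (Fin; zero; suc)
open import Data.Fin.Patterns using (0F; 1F)
import Data.Fin.Properties as Fin
open import Data.Integer.Base as ℤ using (ℤ; +_; 0ℤ; -1ℤ)
import Data.Integer.Properties as ℤ
import Data.Integer.Solver as ℤ
open import Data.List.Base
  using (List; []; _∷_; _∷ʳ_; map; foldr; filter; concatMap; length;
         upTo; allFin; cartesianProductWith)
open import Data.List.Membership.Propositional using (_∈_)
open import Data.List.Relation.Unary.Linked using (Linked; linked?)
open import Data.Nat.Base as ℕ using (ℕ; zero; suc)
import Data.Nat.Properties as ℕ
open import Data.Product.Base using (∃; _×_; _,_; proj₂; map₁)
open import Data.Product.Properties using (≡-dec)
open import Data.Rational.Base as ℚ using (ℚ; 0ℚ; 1ℚ; ½)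
import Data.Rational.Properties as ℚ
import Data.Rational.Solver as ℚ
open import Data.Sum.Base using (_⊎_)
open import Data.Vec.Base using (Vec; lookup)
open import Function.Base using (_∘_)
open import Relation.Binary.Bundles using (DecStrictPartialOrder)
import Relation.Binary.Construct.StrictToNonStrict as NonStrict
open import Relation.Binary.Core using (Rel)
open import Relation.Binary.Definitions using (Decidable)
open import Relation.Binary.PropositionalEquality
  using (_≡_; refl; sym; trans; cong; cong₂; subst; isEquivalence; resp₂)
open import Relation.Nullary using (¬_; yes; no; does; _×-dec_)

------------------------------------------------------------------------
-- The real numbers: Cauchy sequences of rationals up to null sequences

module Real where

  open import Data.Rational.Base using (_+_; _*_; -_; _-_; ∣_∣; _<_; _≤_)

  IsCauchy : (ℕ → ℚ) → Set
  IsCauchy s = ∀ ε → 0ℚ < ε →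
    ∃ λ N → ∀ m n → N ℕ.≤ m → N ℕ.≤ n → ∣ s m - s n ∣ < ε

  record ℝ : Set where
    constructor _,ᶜ_
    field
      seq    : ℕ → ℚ
      cauchy : IsCauchy seq

  open ℝ public

  infix 4 _≈ᴿ_

  record _≈ᴿ_ (x y : ℝ) : Set where
    constructor null
    field
      difference : ∀ ε → 0ℚ < ε →
        ∃ λ N → ∀ n → N ℕ.≤ n → ∣ seq x n - seq y n ∣ < ε

  open _≈ᴿ_ public

  private
    open ℚ.+-*-Solver

    half : ∀ ε → 0ℚ < ε → 0ℚ < ½ * ε
    half ε 0<ε = subst (_< ½ * ε) (ℚ.*-zeroʳ ½) (ℚ.*-monoʳ-<-pos ½ 0<ε)

    halves : ∀ ε → ½ * ε + ½ * ε ≡ ε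
    halves = solve 1 (λ e → con ½ :* e :+ con ½ :* e := e) refl

    ∣p-q∣≡∣q-p∣ : ∀ p q → ∣ p - q ∣ ≡ ∣ q - p ∣
    ∣p-q∣≡∣q-p∣ p q = trans (sym (ℚ.∣-p∣≡∣p∣ (p - q)))
      (cong ∣_∣ (solve 2 (λ p q → :- (p :- q) := q :- p) refl p q))

    ≡⇒close : ∀ {p q ε} → 0ℚ < ε → p ≡ q → ∣ p - q ∣ < ε
    ≡⇒close {p} {ε = ε} 0<ε refl =
      subst (_< ε) (sym (cong ∣_∣ (ℚ.+-inverseʳ p))) 0<ε

    split : ∀ {p ε} q r → p ≡ q + r → ∣ q ∣ < ½ * ε → ∣ r ∣ < ½ * ε → ∣ p ∣ < ε
    split {ε = ε} q r refl q< r< = subst (∣ q + r ∣ <_) (halves ε)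
      (ℚ.≤-<-trans (ℚ.∣p+q∣≤∣p∣+∣q∣ q r) (ℚ.+-mono-< q< r<))

    split-+ : ∀ p q r s {ε} → ∣ p - r ∣ < ½ * ε → ∣ q - s ∣ < ½ * ε →
              ∣ (p + q) - (r + s) ∣ < ε
    split-+ p q r s = split (p - r) (q - s)
      (solve 4 (λ p q r s → (p :+ q) :- (r :+ s) := (p :- r) :+ (q :- s))
        refl p q r s)

    ∣-p+q∣ : ∀ p q → ∣ - p - - q ∣ ≡ ∣ p - q ∣
    ∣-p+q∣ p q = trans
      (cong ∣_∣ (solve 2 (λ p q → :- p :- :- q := :- (p :- q)) refl p q))
      (ℚ.∣-p∣≡∣p∣ (p - q))

    Bounded : (ℕ → ℚ) → Set
    Bounded s = ∃ λ B → 0ℚ < B × ∃ λ N → ∀ n → N ℕ.≤ n → ∣ s n ∣ ≤ B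

    bounded : ∀ x → Bounded (seq x)
    bounded (s ,ᶜ c) with c 1ℚ (ℚ.positive⁻¹ 1ℚ)
    ... | N , close = B , 0<B , N , bound
      where
      B : ℚ
      B = ∣ s N ∣ + 1ℚ

      0<B : 0ℚ < B
      0<B = ℚ.+-mono-≤-< (ℚ.0≤∣p∣ (s N)) (ℚ.positive⁻¹ 1ℚ)

      bound : ∀ n → N ℕ.≤ n → ∣ s n ∣ ≤ B
      bound n N≤n = subst (λ p → ∣ p ∣ ≤ B)
        (solve 2 (λ p q → p :+ (q :- p) := q) refl (s N) (s n))
        (ℚ.≤-trans (ℚ.∣p+q∣≤∣p∣+∣q∣ (s N) (s n - s N))
          (ℚ.+-monoʳ-≤ ∣ s N ∣ (ℚ.<⇒≤ (close n N N≤n ℕ.≤-refl))))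

    divide : ∀ B → 0ℚ < B → ∀ ε → 0ℚ < ε →
             ∃ λ δ → 0ℚ < δ × (∀ p q → ∣ p ∣ ≤ B → ∣ q ∣ < δ → ∣ p * q ∣ < ε)
    divide B 0<B ε 0<ε = δ , 0<δ , small
      where
      instance
        B⁺ : ℚ.Positive B
        B⁺ = ℚ.positive 0<B

        B≢0 : ℚ.NonZero B
        B≢0 = ℚ.pos⇒nonZero B

        B⁻¹⁺ : ℚ.Positive (ℚ.1/ B)
        B⁻¹⁺ = ℚ.1/pos⇒pos B

      δ : ℚ
      δ = ℚ.1/ B * ε

      0<δ : 0ℚ < δ
      0<δ = subst (_< δ) (ℚ.*-zeroʳ (ℚ.1/ B)) (ℚ.*-monoʳ-<-pos (ℚ.1/ B) 0<ε)

      B*δ : B * δ ≡ ε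
      B*δ = trans (sym (ℚ.*-assoc B (ℚ.1/ B) ε))
        (trans (cong (_* ε) (ℚ.*-inverseʳ B)) (ℚ.*-identityˡ ε))

      small : ∀ p q → ∣ p ∣ ≤ B → ∣ q ∣ < δ → ∣ p * q ∣ < ε
      small p q p≤ q< = subst (_< ε) (sym (ℚ.∣p*q∣≡∣p∣*∣q∣ p q))
        (ℚ.≤-<-trans
          (ℚ.*-monoʳ-≤-nonNeg ∣ q ∣ {{ℚ.∣-∣-nonNeg q}} p≤)
          (subst (B * ∣ q ∣ <_) B*δ (ℚ.*-monoʳ-<-pos B q<)))

    split-* : ∀ p q r s {ε} → ∣ p * (q - s) ∣ < ½ * ε → ∣ s * (p - r) ∣ < ½ * ε →
              ∣ p * q - r * s ∣ < ε
    split-* p q r s = split (p * (q - s)) (s * (p - r))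
      (solve 4 (λ p q r s → p :* q :- r :* s := p :* (q :- s) :+ s :* (p :- r))
        refl p q r s)

    ⊔₁ : ∀ {k} l {n} → k ℕ.⊔ l ℕ.≤ n → k ℕ.≤ n
    ⊔₁ l = ℕ.m⊔n≤o⇒m≤o _ l

    ⊔₂ : ∀ k {l n} → k ℕ.⊔ l ℕ.≤ n → l ℕ.≤ n
    ⊔₂ k = ℕ.m⊔n≤o⇒n≤o k _

  fromℚ : ℚ → ℝ
  fromℚ p = (λ _ → p) ,ᶜ λ ε 0<ε → 0 , λ _ _ _ _ → ≡⇒close {p} 0<ε refl

  infixl 6 _+ᴿ_
  infixl 7 _*ᴿ_

  _+ᴿ_ : ℝ → ℝ → ℝ
  (s ,ᶜ c) +ᴿ (t ,ᶜ d) = (λ n → s n + t n) ,ᶜ λ ε 0<ε →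
    let K , close  = c (½ * ε) (half ε 0<ε)
        L , close′ = d (½ * ε) (half ε 0<ε)
    in K ℕ.⊔ L , λ m n N≤m N≤n → split-+ (s m) (t m) (s n) (t n)
         (close m n (⊔₁ L N≤m) (⊔₁ L N≤n)) (close′ m n (⊔₂ K N≤m) (⊔₂ K N≤n))

  -ᴿ_ : ℝ → ℝ
  -ᴿ (s ,ᶜ c) = (λ n → - s n) ,ᶜ λ ε 0<ε →
    let N , close = c ε 0<ε
    in N , λ m n N≤m N≤n →
         subst (_< ε) (sym (∣-p+q∣ (s m) (s n))) (close m n N≤m N≤n)

  _*ᴿ_ : ℝ → ℝ → ℝ
  x@(s ,ᶜ c) *ᴿ y@(t ,ᶜ d) = (λ n → s n * t n) ,ᶜ λ ε 0<ε →
    let B , 0<B , K₁ , s≤B  = bounded x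
        C , 0<C , L₁ , t≤C  = bounded y
        δ , 0<δ , small  = divide B 0<B (½ * ε) (half ε 0<ε)
        η , 0<η , small′ = divide C 0<C (½ * ε) (half ε 0<ε)
        K₂ , close  = d δ 0<δ
        L₂ , close′ = c η 0<η
        K = K₁ ℕ.⊔ K₂
        L = L₁ ℕ.⊔ L₂
    in K ℕ.⊔ L , λ m n N≤m N≤n → split-* (s m) (t m) (s n) (t n)
         (small (s m) (t m - t n) (s≤B m (⊔₁ K₂ (⊔₁ L N≤m)))
           (close m n (⊔₂ K₁ (⊔₁ L N≤m)) (⊔₂ K₁ (⊔₁ L N≤n))))
         (small′ (t n) (s m - s n) (t≤C n (⊔₁ L₂ (⊔₂ K N≤n)))
           (close′ m n (⊔₂ L₁ (⊔₂ K N≤m)) (⊔₂ L₁ (⊔₂ K N≤n))))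

  private
    pointwise : ∀ {x y} → (∀ n → seq x n ≡ seq y n) → x ≈ᴿ y
    pointwise eq = null λ ε 0<ε → 0 , λ n _ → ≡⇒close 0<ε (eq n)

    ≈-sym : ∀ {x y} → x ≈ᴿ y → y ≈ᴿ x
    ≈-sym {x} {y} (null x≈y) = null λ ε 0<ε →
      let N , close = x≈y ε 0<ε
      in N , λ n N≤n →
           subst (_< ε) (∣p-q∣≡∣q-p∣ (seq x n) (seq y n)) (close n N≤n)

    ≈-trans : ∀ {x y z} → x ≈ᴿ y → y ≈ᴿ z → x ≈ᴿ z
    ≈-trans {x} {y} {z} (null x≈y) (null y≈z) = null λ ε 0<ε →
      let K , close  = x≈y (½ * ε) (half ε 0<ε)
          L , close′ = y≈z (½ * ε) (half ε 0<ε)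
      in K ℕ.⊔ L , λ n N≤n →
           split (seq x n - seq y n) (seq y n - seq z n)
             (solve 3 (λ p q r → p :- r := (p :- q) :+ (q :- r)) refl
               (seq x n) (seq y n) (seq z n))
             (close n (⊔₁ L N≤n)) (close′ n (⊔₂ K N≤n))

    +-cong : ∀ {x y u v} → x ≈ᴿ y → u ≈ᴿ v → x +ᴿ u ≈ᴿ y +ᴿ v
    +-cong {x} {y} {u} {v} (null x≈y) (null u≈v) = null λ ε 0<ε →
      let K , close  = x≈y (½ * ε) (half ε 0<ε)
          L , close′ = u≈v (½ * ε) (half ε 0<ε)
      in K ℕ.⊔ L , λ n N≤n → split-+ (seq x n) (seq u n) (seq y n) (seq v n)
           (close n (⊔₁ L N≤n)) (close′ n (⊔₂ K N≤n))

    -‿cong : ∀ {x y} → x ≈ᴿ y → -ᴿ x ≈ᴿ -ᴿ y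
    -‿cong {x} {y} (null x≈y) = null λ ε 0<ε →
      let N , close = x≈y ε 0<ε
      in N , λ n N≤n →
           subst (_< ε) (sym (∣-p+q∣ (seq x n) (seq y n))) (close n N≤n)

    *-cong : ∀ {x y u v} → x ≈ᴿ y → u ≈ᴿ v → x *ᴿ u ≈ᴿ y *ᴿ v
    *-cong {x} {y} {u} {v} (null x≈y) (null u≈v) = null λ ε 0<ε →
      let B , 0<B , K₁ , x≤B  = bounded x
          C , 0<C , L₁ , v≤C  = bounded v
          δ , 0<δ , small  = divide B 0<B (½ * ε) (half ε 0<ε)
          η , 0<η , small′ = divide C 0<C (½ * ε) (half ε 0<ε)
          K₂ , close  = u≈v δ 0<δ
          L₂ , close′ = x≈y η 0<η
          K = K₁ ℕ.⊔ K₂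
          L = L₁ ℕ.⊔ L₂
      in K ℕ.⊔ L , λ n N≤n → split-* (seq x n) (seq u n) (seq y n) (seq v n)
           (small (seq x n) (seq u n - seq v n) (x≤B n (⊔₁ K₂ (⊔₁ L N≤n)))
             (close n (⊔₂ K₁ (⊔₁ L N≤n))))
           (small′ (seq v n) (seq x n - seq y n) (v≤C n (⊔₁ L₂ (⊔₂ K N≤n)))
             (close′ n (⊔₂ L₁ (⊔₂ K N≤n))))

  ℝ-commutativeRing : CommutativeRing 0ℓ 0ℓ
  ℝ-commutativeRing = record
    { Carrier = ℝ
    ; _≈_ = _≈ᴿ_
    ; _+_ = _+ᴿ_
    ; _*_ = _*ᴿ_
    ; -_  = -ᴿ_
    ; 0#  = fromℚ 0ℚ
    ; 1#  = fromℚ 1ℚ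
    ; isCommutativeRing = record
      { isRing = record
        { +-isAbelianGroup = record
          { isGroup = record
            { isMonoid = record
              { isSemigroup = record
                { isMagma = record
                  { isEquivalence = record
                    { refl  = pointwise (λ _ → refl)
                    ; sym   = ≈-sym
                    ; trans = ≈-trans
                    }
                  ; ∙-cong = +-cong
                  }
                ; assoc = λ x y z → pointwise λ n →
                    ℚ.+-assoc (seq x n) (seq y n) (seq z n)
                }
              ; identity = (λ x → pointwise λ n → ℚ.+-identityˡ (seq x n))
                         , (λ x → pointwise λ n → ℚ.+-identityʳ (seq x n))
              }
            ; inverse = (λ x → pointwise λ n → ℚ.+-inverseˡ (seq x n))
                      , (λ x → pointwise λ n → ℚ.+-inverseʳ (seq x n))
            ; ⁻¹-cong = -‿cong
            }
          ; comm = λ x y → pointwise λ n → ℚ.+-comm (seq x n) (seq y n)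
          }
        ; *-cong = *-cong
        ; *-assoc = λ x y z → pointwise λ n →
            ℚ.*-assoc (seq x n) (seq y n) (seq z n)
        ; *-identity = (λ x → pointwise λ n → ℚ.*-identityˡ (seq x n))
                     , (λ x → pointwise λ n → ℚ.*-identityʳ (seq x n))
        ; distrib = (λ x y z → pointwise λ n →
                      ℚ.*-distribˡ-+ (seq x n) (seq y n) (seq z n))
                  , (λ x y z → pointwise λ n →
                      ℚ.*-distribʳ-+ (seq x n) (seq y n) (seq z n))
        }
      ; *-comm = λ x y → pointwise λ n → ℚ.*-comm (seq x n) (seq y n)
      }
    }

------------------------------------------------------------------------
-- Lists over a finite set, presented by a list of its elements

tuples : ∀ {A : Set} → List A → ℕ → List (List A)
tuples xs zero    = [] ∷ []
tuples xs (suc n) = cartesianProductWith _∷_ xs (tuples xs n)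

tuples≤ : ∀ {A : Set} → List A → ℕ → List (List A)
tuples≤ xs n = concatMap (tuples xs) (upTo (suc n))

------------------------------------------------------------------------
-- Non-commutative formal power series

Word : ℕ → Set
Word k = List (Fin k)

splits : ∀ {k} → Word k → List (Word k × Word k)
splits []      = ([] , []) ∷ []
splits (i ∷ w) = ([] , i ∷ w) ∷ map (map₁ (i ∷_)) (splits w)

module PowerSeries {c ℓ} (R : CommutativeRing c ℓ) where

  open CommutativeRing R

  -- A series in k variables, given by the coefficient of each word.
  Series : ℕ → Set c
  Series k = Word k → Carrier

  ∑ : ∀ {A : Set} → List A → (A → Carrier) → Carrier
  ∑ xs f = foldr _+_ 0# (map f xs)

  infix  4 _≈ˢ_
  infixl 6 _+ˢ_ _-ˢ_
  infixl 7 _*ˢ_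
  infixr 8 _^ˢ_

  _≈ˢ_ : ∀ {k} → Series k → Series k → Set ℓ
  f ≈ˢ g = ∀ w → f w ≈ g w

  0ˢ : ∀ {k} → Series k
  0ˢ _ = 0#

  1ˢ : ∀ {k} → Series k
  1ˢ []      = 1#
  1ˢ (_ ∷ _) = 0#

  var : ∀ {k} → Fin k → Series k
  var i []          = 0#
  var i (j ∷ [])    = if does (i Fin.≟ j) then 1# else 0#
  var i (_ ∷ _ ∷ _) = 0#

  _+ˢ_ : ∀ {k} → Series k → Series k → Series k
  (f +ˢ g) w = f w + g w

  _-ˢ_ : ∀ {k} → Series k → Series k → Series k
  (f -ˢ g) w = f w - g w

  _*ˢ_ : ∀ {k} → Series k → Series k → Series k
  (f *ˢ g) w = ∑ (splits w) λ (u , v) → f u * g v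

  _^ˢ_ : ∀ {k} → Series k → ℕ → Series k
  f ^ˢ zero  = 1ˢ
  f ^ˢ suc n = f *ˢ f ^ˢ n

  ∑ˢ : ∀ {k} {A : Set} → List A → (A → Series k) → Series k
  ∑ˢ xs f w = ∑ xs λ x → f x w

  -- The infinite sum f 0 + f 1 + f 2 + ⋯ for f m homogeneous of degree m:
  -- only the term of degree length w contributes to the coefficient of w.
  ∑∞ : ∀ {k} → (ℕ → Series k) → Series k
  ∑∞ f w = f (length w) w

  monomial : ∀ {k l} → Vec (Series l) k → Word k → Series l
  monomial σ []      = 1ˢ
  monomial σ (i ∷ v) = lookup σ i *ˢ monomial σ v

  -- The substitution Φ(σ₀, …, σₖ₋₁) = Σᵥ Φᵥ σᵥ, for σᵢ with zero constant term:
  -- then σᵥ has no terms of degree less than length v, so words v longer than w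
  -- do not contribute to the coefficient of w.
  _⟪_⟫ : ∀ {k l} → Series k → Vec (Series l) k → Series l
  _⟪_⟫ {k} Φ σ w = ∑ (tuples≤ (allFin k) (length w)) λ v → Φ v * monomial σ v w

  -- There are finitely many variables, so finite support is bounded degree.
  IsPolynomial : ∀ {k} → Series k → Set ℓ
  IsPolynomial f = ∃ λ d → ∀ w → d ℕ.< length w → f w ≈ 0#

  data Rational {k} : Series k → Set (c Level.⊔ ℓ) where
    resp       : ∀ {f g} → f ≈ˢ g → Rational f → Rational g
    polynomial : ∀ {f} → IsPolynomial f → Rational f
    plus       : ∀ {f g} → Rational f → Rational g → Rational (f +ˢ g)
    times      : ∀ {f g} → Rational f → Rational g → Rational (f *ˢ g)
    inverse    : ∀ {f g} → Rational f → ¬ (f [] ≈ 0#) →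
                 f *ˢ g ≈ˢ 1ˢ → g *ˢ f ≈ˢ 1ˢ → Rational g

open Real public using (ℝ; ℝ-commutativeRing)
open PowerSeries ℝ-commutativeRing public

𝐚 𝐛 𝐜 𝐝 : Series 2
𝐚 = var 0F
𝐛 = var 1F
𝐜 = 𝐚 +ˢ 𝐛
𝐝 = 𝐚 *ˢ 𝐛 +ˢ 𝐛 *ˢ 𝐚

------------------------------------------------------------------------
-- Finite graded posets
--
-- They occur as finite subposets Q of an ambient poset, with the order and the
-- rank function ρ induced from it; Q is a list of the elements, each occurring
-- once.  Shifting ρ by a constant affects neither definition below.

module Graded (P : DecStrictPartialOrder 0ℓ 0ℓ 0ℓ)
              (ρ : DecStrictPartialOrder.Carrier P → ℤ) where

  open DecStrictPartialOrder P using (Carrier; _≈_; _<_; _≟_; _<?_)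
  open NonStrict _≈_ _<_ public using (_≤_)

  _≤?_ : Decidable _≤_
  _≤?_ = NonStrict.decidable _≈_ _<_ _≟_ _<?_

  between : Carrier → Carrier → List Carrier → List Carrier
  between x y = filter (λ z → (x ≤? z) ×-dec (z ≤? y))

  alternatingSum : List Carrier → ℤ
  alternatingSum zs = foldr ℤ._+_ 0ℤ (map (λ z → -1ℤ ℤ.^ ℤ.∣ ρ z ∣) zs)

  Eulerian : List Carrier → Set
  Eulerian Q = ∀ {x y} → x ∈ Q → y ∈ Q → x < y →
               alternatingSum (between x y Q) ≡ 0ℤ

  -- The lists x₁, …, xₖ such that x < x₁ < ⋯ < xₖ < y is a chain in Q.  The xᵢ
  -- are distinct, so k ≤ length Q.
  chains : List Carrier → Carrier → Carrier → List (List Carrier)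
  chains Q x y =
    filter (λ c → linked? _<?_ (x ∷ c ∷ʳ y)) (tuples≤ Q (length Q))

  -- ρ y - ρ x, used only for x < y, where it is positive.
  ρ[_,_] : Carrier → Carrier → ℕ
  ρ[ x , y ] = ℤ.∣ ρ y ℤ.- ρ x ∣

  wt : Carrier → List Carrier → Carrier → Series 2
  wt x []      y = (𝐚 -ˢ 𝐛) ^ˢ (ρ[ x , y ] ℕ.∸ 1)
  wt x (z ∷ c) y = (𝐚 -ˢ 𝐛) ^ˢ (ρ[ x , z ] ℕ.∸ 1) *ˢ 𝐛 *ˢ wt z c y

  -- The ab-index of Q, whose minimum is x and whose maximum is y.
  Ψ : List Carrier → Carrier → Carrier → Series 2
  Ψ Q x y = ∑ˢ (chains Q x y) λ c → wt x c y

------------------------------------------------------------------------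
-- Level posets

open Sum ℕ.+-*-semiring using (sum)

Matrix : ℕ → Set
Matrix n = Fin n → Fin n → ℕ

ZeroOne : ∀ {n} → Matrix n → Set
ZeroOne M = ∀ u v → M u v ≡ 0 ⊎ M u v ≡ 1

infixr 8 _^ᴹ_

_^ᴹ_ : ∀ {n} → Matrix n → ℕ → Matrix n
(M ^ᴹ zero)  u v = if does (u Fin.≟ v) then 1 else 0
(M ^ᴹ suc r) u v = sum λ t → M u t ℕ.* (M ^ᴹ r) t v

private

  sum⁺ : ∀ {n} (f : Fin n → ℕ) t → 0 ℕ.< f t → 0 ℕ.< sum f
  sum⁺ f zero    0<f = ℕ.<-≤-trans 0<f (ℕ.m≤m+n _ _)
  sum⁺ f (suc t) 0<f = ℕ.<-≤-trans (sum⁺ (f ∘ suc) t 0<f) (ℕ.m≤n+m _ (f zero))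

  sum⁺⁻¹ : ∀ {n} (f : Fin n → ℕ) → 0 ℕ.< sum f → ∃ λ t → 0 ℕ.< f t
  sum⁺⁻¹ {suc n} f 0<Σ with f zero in eq
  ... | zero  = let t , 0<f = sum⁺⁻¹ (f ∘ suc) 0<Σ in suc t , 0<f
  ... | suc _ = zero , subst (0 ℕ.<_) (sym eq) ℕ.z<s

  *⁺ : ∀ {m n} → 0 ℕ.< m → 0 ℕ.< n → 0 ℕ.< m ℕ.* n
  *⁺ {suc m} {suc n} _ _ = ℕ.z<s

  *⁺⁻¹ : ∀ m {n} → 0 ℕ.< m ℕ.* n → 0 ℕ.< m × 0 ℕ.< n
  *⁺⁻¹ (suc m) {zero}  0<mn with () ← subst (0 ℕ.<_) (ℕ.*-zeroʳ m) 0<mn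
  *⁺⁻¹ (suc m) {suc n} _    = ℕ.z<s , ℕ.z<s

  ^ᴹ⁺ : ∀ {n} (M : Matrix n) r s {u v w} → 0 ℕ.< (M ^ᴹ r) u v →
        0 ℕ.< (M ^ᴹ s) v w → 0 ℕ.< (M ^ᴹ (r ℕ.+ s)) u w
  ^ᴹ⁺ M zero    s {u} {v} 0<p 0<q with u Fin.≟ v
  ... | yes refl = 0<q
  ^ᴹ⁺ M (suc r) s {u} 0<p 0<q =
    let t , 0<Mp = sum⁺⁻¹ _ 0<p
        0<M , 0<p′ = *⁺⁻¹ (M u t) 0<Mp
    in sum⁺ _ t (*⁺ 0<M (^ᴹ⁺ M r s 0<p′ 0<q))

  ∣k-i∣ : ∀ {i j k} → i ℤ.< j → j ℤ.< k →
          ℤ.∣ j ℤ.- i ∣ ℕ.+ ℤ.∣ k ℤ.- j ∣ ≡ ℤ.∣ k ℤ.- i ∣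
  ∣k-i∣ {i} {j} {k} i<j j<k = cong ℤ.∣_∣ (trans
    (cong₂ ℤ._+_ (distance i<j) (distance j<k))
    (solve 3 (λ i j k → (j :- i) :+ (k :- j) := k :- i) refl i j k))
    where
    open ℤ.+-*-Solver

    distance : ∀ {i j} → i ℤ.< j → + ℤ.∣ j ℤ.- i ∣ ≡ j ℤ.- i
    distance i<j = ℤ.0≤i⇒+∣i∣≡i (ℤ.i≤j⇒0≤j-i (ℤ.<⇒≤ i<j))

module LevelPoset {n} (M : Matrix n) where

  Element : Set
  Element = Fin n × ℤ

  -- i < j makes ∣ j - i ∣ the exponent j - i.
  _≺_ : Rel Element 0ℓ
  (u , i) ≺ (v , j) = i ℤ.< j × 0 ℕ.< (M ^ᴹ ℤ.∣ j ℤ.- i ∣) u v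

  levelPoset : DecStrictPartialOrder 0ℓ 0ℓ 0ℓ
  levelPoset = record
    { Carrier = Element
    ; _≈_ = _≡_
    ; _<_ = _≺_
    ; isDecStrictPartialOrder = record
      { isStrictPartialOrder = record
        { isEquivalence = isEquivalence
        ; irrefl = λ { refl (i<i , _) → ℤ.<-irrefl refl i<i }
        ; trans = λ { {u , i} {v , j} {w , k} (i<j , p) (j<k , q) →
            ℤ.<-trans i<j j<k ,
            subst (λ r → 0 ℕ.< (M ^ᴹ r) u w) (∣k-i∣ i<j j<k)
              (^ᴹ⁺ M ℤ.∣ j ℤ.- i ∣ ℤ.∣ k ℤ.- j ∣ p q) }
        ; <-resp-≈ = resp₂ _≺_
        }
      ; _≟_ = ≡-dec Fin._≟_ ℤ._≟_
      ; _<?_ = λ (u , i) (v , j) →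
          (i ℤ.<? j) ×-dec (0 ℕ.<? (M ^ᴹ ℤ.∣ j ℤ.- i ∣) u v)
      }
    }

  open Graded levelPoset proj₂ public

  -- Every element of [p, q] has a level i + k with 0 ≤ k ≤ ∣ j - i ∣.
  interval : Element → Element → List Element
  interval p@(_ , i) q@(_ , j) = between p q
    (cartesianProductWith (λ k w → w , i ℤ.+ + k)
      (upTo (suc ℤ.∣ j ℤ.- i ∣)) (allFin n))

  LevelEulerian : Set
  LevelEulerian = ∀ p q → p ≤ q → Eulerian (interval p q)

  Ψ[_,_] : Fin n → Fin n → Series 2
  Ψ[ x , y ] = ∑∞ term
    where
    term : ℕ → Series 2
    term m =
      let p = x , 0ℤ
          q = y , + suc m
      in if does (p ≤? q) then Ψ (interval p q) p q else 0ˢ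

{-# OPTIONS --safe #-}

-- Let Q_r be M^r reduced to whether its entries vanish, t = a - b, K(t) = Σ_r Q_{r+1} t^r
-- and Q(t) = 1 + t K(t).  Splitting a chain at its first element shows that the matrix Ψ of
-- ab-series is the solution of Ψ = K + K b Ψ.  Write K(t) = E(t²) + t O(t²).  The Eulerian
-- condition is Q(-t) Q(t) = 1, so that (1 + Q(-t)) K = 2E, where Q(-t) = 1 + t² O - t E;
-- since 2b = c - t, it follows that (2 + t² O) Ψ = 2E + E c Ψ.  Here t² = c² - 2d, so this
-- is a linear system over the series in c and d.  Its coefficients are rational because Q_r
-- is computed by a finite automaton, and its solution is rational by Gaussian elimination;
-- it determines Ψ because 1 + Q(-t) is cancellable.

module Submission where

open import Algebra.Bundles using (CommutativeRing; Ring; Semiring)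
import Algebra.Definitions.RawSemiring as RawSemiring
import Algebra.Properties.Ring as RingProperties
import Algebra.Properties.Semiring.Sum as Sum
open import Data.Bool.Base using (Bool; true; false; if_then_else_; _∧_)
open import Data.Fin.Base using (Fin; zero; suc; toℕ; finToFun; funToFin)
open import Data.Fin.Patterns using (0F; 1F)
import Data.Fin.Properties as Fin
open import Data.Integer.Base using (ℤ)
import Data.Integer.Properties as ℤ
open import Data.List.Base
  using (List; []; _∷_; _∷ʳ_; _++_; map; foldr; filter; concatMap; length; upTo; allFin; cartesianProductWith)
open import Data.List.Membership.Propositional using (_∈_)
open import Data.List.Membership.Propositional.Properties
  using (∈-length; ∈-filter⁺; ∈-map⁺; ∈-cartesianProductWith⁺; ∈-upTo⁺; ∈-upTo⁻; ∈-allFin)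
open import Data.List.Properties
  using (map-∘; map-applyUpTo; map-tabulate; filter-++; length-++; length-applyUpTo)
open import Data.List.Relation.Unary.Any using (here; there)
open import Data.List.Relation.Unary.Linked using (Linked; [-]; _∷_; linked?)
open import Data.Nat.Base as ℕ using (ℕ; zero; suc; s≤s; z≤n; NonZero)
import Data.Nat.Properties as ℕ
open import Data.Product.Base using (∃; _×_; _,_; proj₁; proj₂)
open import Data.Rational.Base as ℚ using (1ℚ; ½)
import Data.Rational.Properties as ℚ
open import Data.Sum.Base using (inj₁; inj₂)
open import Data.Vec.Base using (Vec; []; _∷_; lookup)
open import Defs
  using (Word; splits; tuples; tuples≤; Matrix; _^ᴹ_; module PowerSeries; module Graded; module LevelPoset)
open import Function.Base using (_∘_; id)
open import Function.Bundles using (_⇔_; mk⇔; module Equivalence)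
open import Level using (0ℓ)
open import Relation.Binary.Bundles using (DecStrictPartialOrder)
open import Relation.Binary.PropositionalEquality as ≡ using (_≡_)
import Relation.Binary.Reasoning.Setoid as SetoidReasoning
open import Relation.Nullary using (¬_; Dec; yes; no; does; contradiction; _×-dec_)
open import Relation.Nullary.Decidable using (dec-false; does-⇔)
open import Relation.Unary using (Decidable)

-- Finite sums and the ring of formal power series

-- The obstacle is that `t` is not a series in c and d; only `t²` is. Multiplying `K` by `1 + Q(-t)`
-- leaves the even series `2E`, and the odd part `-t E` of `Q(-t)` absorbs the `t` that `2b = c - t`
-- brings in, so odd powers of `t` disappear from the system. The equation `Q(-t) Q(t) = 1` holds
-- all alternating sums at once: for m > 0 the coefficient of `t^m` at (x, y) is the sum of (-1)^r
-- over the elements of rank r between (x, 0) and (y, m).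
--
-- The derivation is run backwards. Rationality is asserted of `Φ`, not of its value at c and d, so
-- the system is solved over two free variables `C` and `D`, with `C² - 2D` in the place of `t²`.
-- The value of this solution at c and d is shown to satisfy `X = K + K b X`, and a series matrix
-- with that property has the sums over chains as its coefficients. No matrix is inverted:
-- `1 + Q(-t)` is 2 plus a matrix without constant terms, so comparing coefficients degree by degree
-- and halving cancels it.

module Kronecker {c ℓ} (S : Semiring c ℓ) where

  open Semiring S hiding (zero)
  open Sum S

  δ : ∀ {n} → Fin n → Fin n → Carrier
  δ i j = if does (i Fin.≟ j) then 1# else 0#

  private
    sum-zero : ∀ {n} (f : Fin n → Carrier) → (∀ i → f i ≈ 0#) → sum f ≈ 0#
    sum-zero {n} f f≈0 = trans (sum-cong-≋ f≈0) (sum-replicate-zero n)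

  sum-δˡ : ∀ {n} i (f : Fin n → Carrier) → sum (λ j → δ i j * f j) ≈ f i
  sum-δˡ zero    f = trans (+-cong (*-identityˡ _) (sum-zero (λ j → 0# * f (suc j)) λ _ → zeroˡ _)) (+-identityʳ _)
  sum-δˡ (suc i) f = trans (+-cong (zeroˡ _) (sum-δˡ i (f ∘ suc))) (+-identityˡ _)

  sum-δʳ : ∀ {n} i (f : Fin n → Carrier) → sum (λ j → f j * δ j i) ≈ f i
  sum-δʳ zero    f = trans (+-cong (*-identityʳ _) (sum-zero (λ j → f (suc j) * 0#) λ _ → zeroʳ _)) (+-identityʳ _)
  sum-δʳ (suc i) f = trans (+-cong (zeroʳ _) (sum-δʳ i (f ∘ suc))) (+-identityˡ _)

module Series {c ℓ} (R : CommutativeRing c ℓ) where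

  open CommutativeRing R hiding (zero)
  open PowerSeries R
  open import Relation.Binary.Reasoning.Setoid setoid
  open import Algebra.Solver.CommutativeMonoid +-commutativeMonoid
    using (solve; _⊕_; _⊜_)

  private variable
    A B : Set
    k l : ℕ

  +-interchange : ∀ x y z w → (x + y) + (z + w) ≈ (x + z) + (y + w)
  +-interchange = solve 4 (λ x y z w → (x ⊕ y) ⊕ (z ⊕ w) ⊜ (x ⊕ z) ⊕ (y ⊕ w)) refl

  ∑-cong : ∀ (xs : List A) {f g} → (∀ x → f x ≈ g x) → ∑ xs f ≈ ∑ xs g
  ∑-cong []       eq = refl
  ∑-cong (x ∷ xs) eq = +-cong (eq x) (∑-cong xs eq)

  ∑-map : ∀ (h : A → B) xs f → ∑ (map h xs) f ≡ ∑ xs (f ∘ h)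
  ∑-map h xs f = ≡.cong (foldr _+_ 0#) (≡.sym (map-∘ xs))

  ∑-++ : ∀ (xs ys : List A) f → ∑ (xs ++ ys) f ≈ ∑ xs f + ∑ ys f
  ∑-++ []       ys f = sym (+-identityˡ _)
  ∑-++ (x ∷ xs) ys f = trans (+-congˡ (∑-++ xs ys f)) (sym (+-assoc _ _ _))

  ∑-zero : ∀ (xs : List A) {f} → (∀ x → f x ≈ 0#) → ∑ xs f ≈ 0#
  ∑-zero []       eq = refl
  ∑-zero (x ∷ xs) eq = trans (+-cong (eq x) (∑-zero xs eq)) (+-identityˡ 0#)

  ∑-+ : ∀ (xs : List A) f g → ∑ xs (λ x → f x + g x) ≈ ∑ xs f + ∑ xs g
  ∑-+ []       f g = sym (+-identityˡ 0#)
  ∑-+ (x ∷ xs) f g = trans (+-congˡ (∑-+ xs f g)) (+-interchange _ _ _ _)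

  ∑-*ˡ : ∀ (xs : List A) z f → ∑ xs (λ x → z * f x) ≈ z * ∑ xs f
  ∑-*ˡ []       z f = sym (zeroʳ z)
  ∑-*ˡ (x ∷ xs) z f = trans (+-congˡ (∑-*ˡ xs z f)) (sym (distribˡ _ _ _))

  ∑-concatMap : ∀ (h : A → List B) xs f →
                ∑ (concatMap h xs) f ≈ ∑ xs (λ x → ∑ (h x) f)
  ∑-concatMap h []       f = refl
  ∑-concatMap h (x ∷ xs) f =
    trans (∑-++ (h x) (concatMap h xs) f) (+-congˡ (∑-concatMap h xs f))

  ∑-product : ∀ {C : Set} (h : A → B → C) xs ys f →
              ∑ (cartesianProductWith h xs ys) f ≈ ∑ xs λ x → ∑ ys λ y → f (h x y)
  ∑-product h []       ys f = refl
  ∑-product h (x ∷ xs) ys f = trans (∑-++ (map (h x) ys) _ f)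
    (+-cong (reflexive (∑-map (h x) ys f)) (∑-product h xs ys f))

  ∑-swap : ∀ (xs : List A) (ys : List B) (f : A → B → Carrier) →
           ∑ xs (λ x → ∑ ys (f x)) ≈ ∑ ys (λ y → ∑ xs (λ x → f x y))
  ∑-swap []       ys f = sym (∑-zero ys (λ _ → refl))
  ∑-swap (x ∷ xs) ys f = trans (+-congˡ (∑-swap xs ys f)) (sym (∑-+ ys (f x) _))

  ∑-upTo-suc : ∀ n f → ∑ (upTo (suc n)) f ≡ f 0 + ∑ (upTo n) (f ∘ suc)
  ∑-upTo-suc n f = ≡.cong (f 0 +_) (≡.trans
    (≡.cong (λ xs → ∑ xs f) (≡.sym (map-applyUpTo id suc n)))
    (∑-map suc (upTo n) f))

  ∑-tuples≤-zero : ∀ (xs : List A) f → ∑ (tuples≤ xs 0) f ≈ f []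
  ∑-tuples≤-zero xs f = +-identityʳ (f [])

  -- Splitting off the first entry. The same recursion serves the words in a substitution and the
  -- chains in an interval, since both are enumerated by `tuples≤`.
  ∑-tuples≤-suc : ∀ (xs : List A) n f →
    ∑ (tuples≤ xs (suc n)) f ≈ f [] + ∑ xs λ x → ∑ (tuples≤ xs n) λ v → f (x ∷ v)
  ∑-tuples≤-suc xs n f = begin
    ∑ (tuples≤ xs (suc n)) f
      ≈⟨ ∑-concatMap (tuples xs) (upTo (suc (suc n))) f ⟩
    ∑ (upTo (suc (suc n))) (λ r → ∑ (tuples xs r) f)
      ≡⟨ ∑-upTo-suc (suc n) _ ⟩
    (f [] + 0#) + ∑ (upTo (suc n)) (λ r → ∑ (tuples xs (suc r)) f)
      ≈⟨ +-cong (+-identityʳ _) (∑-cong (upTo (suc n)) λ r → ∑-product _∷_ xs _ f) ⟩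
    f [] + ∑ (upTo (suc n)) (λ r → ∑ xs λ x → ∑ (tuples xs r) λ v → f (x ∷ v))
      ≈⟨ +-congˡ (∑-swap (upTo (suc n)) xs _) ⟩
    f [] + ∑ xs (λ x → ∑ (upTo (suc n)) λ r → ∑ (tuples xs r) λ v → f (x ∷ v))
      ≈⟨ +-congˡ (∑-cong xs λ x → ∑-concatMap (tuples xs) (upTo (suc n)) _) ⟨
    f [] + ∑ xs (λ x → ∑ (tuples≤ xs n) λ v → f (x ∷ v)) ∎

  infixr 8 _·_

  _·_ : Carrier → Series k → Series k
  (x · f) w = x * f w

  const : Carrier → Series k
  const x = x · 1ˢ

  -- The left quotient (Brzozowski derivative) by a letter. A series is determined by its constant
  -- term and its left quotients, which is what inductions on words exploit.
  ∂ : Fin k → Series k → Series k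
  ∂ i f w = f (i ∷ w)

  -- The left part of a split of `i ∷ w` is either empty or begins with `i`: a Leibniz rule for left
  -- quotients.
  *ˢ-∷ : ∀ (f g : Series k) i w →
         (f *ˢ g) (i ∷ w) ≡ f [] * g (i ∷ w) + (∂ i f *ˢ g) w
  *ˢ-∷ f g i w = ≡.cong (f [] * g (i ∷ w) +_) (∑-map _ (splits w) _)

  *ˢ-[] : ∀ (f g : Series k) → (f *ˢ g) [] ≈ f [] * g []
  *ˢ-[] f g = +-identityʳ _

  ≈ˢ-refl : {f : Series k} → f ≈ˢ f
  ≈ˢ-refl w = refl

  ≈ˢ-sym : {f g : Series k} → f ≈ˢ g → g ≈ˢ f
  ≈ˢ-sym f≈g w = sym (f≈g w)

  ≈ˢ-trans : {f g h : Series k} → f ≈ˢ g → g ≈ˢ h → f ≈ˢ h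
  ≈ˢ-trans f≈g g≈h w = trans (f≈g w) (g≈h w)

  *ˢ-cong : {f f′ g g′ : Series k} → f ≈ˢ f′ → g ≈ˢ g′ → f *ˢ g ≈ˢ f′ *ˢ g′
  *ˢ-cong f≈ g≈ w = ∑-cong (splits w) λ (u , v) → *-cong (f≈ u) (g≈ v)

  *ˢ-zeroˡ : ∀ (f : Series k) → 0ˢ *ˢ f ≈ˢ 0ˢ
  *ˢ-zeroˡ f w = ∑-zero (splits w) λ _ → zeroˡ _

  *ˢ-distribˡ : ∀ (f g h : Series k) → f *ˢ (g +ˢ h) ≈ˢ f *ˢ g +ˢ f *ˢ h
  *ˢ-distribˡ f g h w = trans (∑-cong (splits w) λ _ → distribˡ _ _ _)
    (∑-+ (splits w) _ _)

  *ˢ-distribʳ : ∀ (f g h : Series k) → (g +ˢ h) *ˢ f ≈ˢ g *ˢ f +ˢ h *ˢ f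
  *ˢ-distribʳ f g h w = trans (∑-cong (splits w) λ _ → distribʳ _ _ _)
    (∑-+ (splits w) _ _)

  ·-*ˢ : ∀ x (f g : Series k) → (x · f) *ˢ g ≈ˢ x · (f *ˢ g)
  ·-*ˢ x f g w = trans (∑-cong (splits w) λ _ → *-assoc _ _ _)
    (∑-*ˡ (splits w) x _)

  *ˢ-· : ∀ x (f g : Series k) → f *ˢ (x · g) ≈ˢ x · (f *ˢ g)
  *ˢ-· x f g w = trans
    (∑-cong (splits w) λ _ → trans (sym (*-assoc _ _ _))
      (trans (*-congʳ (*-comm _ _)) (*-assoc _ _ _)))
    (∑-*ˡ (splits w) x _)

  ∑-*ˢ : ∀ (xs : List A) (f : Series k) (g : A → Carrier) (h : A → Series k) w →
         ∑ xs (λ x → g x * (f *ˢ h x) w) ≈ (f *ˢ (λ w → ∑ xs (λ x → g x * h x w))) w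
  ∑-*ˢ []       f g h w = sym (∑-zero (splits w) (λ _ → zeroʳ _))
  ∑-*ˢ (x ∷ xs) f g h w = trans (+-cong (sym (*ˢ-· (g x) f (h x) w)) (∑-*ˢ xs f g h w))
    (sym (*ˢ-distribˡ f (g x · h x) _ w))

  ∂-* : ∀ i (f g : Series k) → ∂ i (f *ˢ g) ≈ˢ f [] · ∂ i g +ˢ ∂ i f *ˢ g
  ∂-* i f g w = reflexive (*ˢ-∷ f g i w)

  *ˢ-identityˡ : ∀ (f : Series k) → 1ˢ *ˢ f ≈ˢ f
  *ˢ-identityˡ f []      = trans (*ˢ-[] 1ˢ f) (*-identityˡ _)
  *ˢ-identityˡ f (i ∷ w) = begin
    (1ˢ *ˢ f) (i ∷ w)               ≡⟨ *ˢ-∷ 1ˢ f i w ⟩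
    1# * f (i ∷ w) + (0ˢ *ˢ f) w    ≈⟨ +-cong (*-identityˡ _) (*ˢ-zeroˡ f w) ⟩
    f (i ∷ w) + 0#                  ≈⟨ +-identityʳ _ ⟩
    f (i ∷ w)                       ∎

  *ˢ-identityʳ : ∀ (f : Series k) → f *ˢ 1ˢ ≈ˢ f
  *ˢ-identityʳ f []      = trans (*ˢ-[] f 1ˢ) (*-identityʳ _)
  *ˢ-identityʳ f (i ∷ w) = begin
    (f *ˢ 1ˢ) (i ∷ w)               ≡⟨ *ˢ-∷ f 1ˢ i w ⟩
    f [] * 0# + (∂ i f *ˢ 1ˢ) w     ≈⟨ +-cong (zeroʳ _) (*ˢ-identityʳ (∂ i f) w) ⟩
    0# + f (i ∷ w)                  ≈⟨ +-identityˡ _ ⟩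
    f (i ∷ w)                       ∎

  *ˢ-assoc : ∀ (f g h : Series k) → (f *ˢ g) *ˢ h ≈ˢ f *ˢ (g *ˢ h)
  *ˢ-assoc f g h []      = begin
    ((f *ˢ g) *ˢ h) []     ≈⟨ *ˢ-[] (f *ˢ g) h ⟩
    (f *ˢ g) [] * h []     ≈⟨ *-congʳ (*ˢ-[] f g) ⟩
    (f [] * g []) * h []   ≈⟨ *-assoc _ _ _ ⟩
    f [] * (g [] * h [])   ≈⟨ *-congˡ (*ˢ-[] g h) ⟨
    f [] * (g *ˢ h) []     ≈⟨ *ˢ-[] f (g *ˢ h) ⟨
    (f *ˢ (g *ˢ h)) []     ∎
  *ˢ-assoc f g h (i ∷ w) = begin
    ((f *ˢ g) *ˢ h) (i ∷ w)
      ≡⟨ *ˢ-∷ (f *ˢ g) h i w ⟩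
    (f *ˢ g) [] * h (i ∷ w) + (∂ i (f *ˢ g) *ˢ h) w
      ≈⟨ +-cong (trans (*-congʳ (*ˢ-[] f g)) (*-assoc _ _ _)) (begin
        (∂ i (f *ˢ g) *ˢ h) w
          ≈⟨ *ˢ-cong (∂-* i f g) (≈ˢ-refl {f = h}) w ⟩
        ((f [] · ∂ i g +ˢ ∂ i f *ˢ g) *ˢ h) w
          ≈⟨ *ˢ-distribʳ h (f [] · ∂ i g) (∂ i f *ˢ g) w ⟩
        ((f [] · ∂ i g) *ˢ h) w + ((∂ i f *ˢ g) *ˢ h) w
          ≈⟨ +-cong (·-*ˢ (f []) (∂ i g) h w) (*ˢ-assoc (∂ i f) g h w) ⟩
        f [] * (∂ i g *ˢ h) w + (∂ i f *ˢ (g *ˢ h)) w ∎) ⟩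
    f [] * (g [] * h (i ∷ w)) + (f [] * (∂ i g *ˢ h) w + (∂ i f *ˢ (g *ˢ h)) w)
      ≈⟨ +-assoc _ _ _ ⟨
    f [] * (g [] * h (i ∷ w)) + f [] * (∂ i g *ˢ h) w + (∂ i f *ˢ (g *ˢ h)) w
      ≈⟨ +-congʳ (trans (sym (distribˡ _ _ _)) (*-congˡ (reflexive (≡.sym (*ˢ-∷ g h i w))))) ⟩
    f [] * (g *ˢ h) (i ∷ w) + (∂ i f *ˢ (g *ˢ h)) w
      ≡⟨ *ˢ-∷ f (g *ˢ h) i w ⟨
    (f *ˢ (g *ˢ h)) (i ∷ w) ∎

  const-comm : ∀ x (f : Series k) → const x *ˢ f ≈ˢ f *ˢ const x
  const-comm x f w = trans (·-*ˢ x 1ˢ f w) (trans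
    (*-congˡ (trans (*ˢ-identityˡ f w) (sym (*ˢ-identityʳ f w)))) (sym (*ˢ-· x f 1ˢ w)))

  seriesRing : ℕ → Ring c ℓ
  seriesRing k = record
    { Carrier = Series k
    ; _≈_ = _≈ˢ_
    ; _+_ = _+ˢ_
    ; _*_ = _*ˢ_
    ; -_ = λ f w → - f w
    ; 0# = 0ˢ
    ; 1# = 1ˢ
    ; isRing = record
      { +-isAbelianGroup = record
        { isGroup = record
          { isMonoid = record
            { isSemigroup = record
              { isMagma = record
                { isEquivalence = record
                  { refl = λ {f} → ≈ˢ-refl {f = f}
                  ; sym = λ {f g} → ≈ˢ-sym {f = f} {g}
                  ; trans = λ {f g h} → ≈ˢ-trans {f = f} {g} {h} }
                ; ∙-cong = λ f≈ g≈ w → +-cong (f≈ w) (g≈ w) }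
              ; assoc = λ f g h w → +-assoc (f w) (g w) (h w) }
            ; identity = (λ f w → +-identityˡ (f w)) , (λ f w → +-identityʳ (f w)) }
          ; inverse = (λ f w → -‿inverseˡ (f w)) , (λ f w → -‿inverseʳ (f w))
          ; ⁻¹-cong = λ f≈ w → -‿cong (f≈ w) }
        ; comm = λ f g w → +-comm (f w) (g w) }
      ; *-cong = λ {f f′ g g′} → *ˢ-cong {f = f} {f′} {g} {g′}
      ; *-assoc = *ˢ-assoc
      ; *-identity = *ˢ-identityˡ , *ˢ-identityʳ
      ; distrib = *ˢ-distribˡ , *ˢ-distribʳ } }

-- Limits and substitution

module Limits {c ℓ} (R : CommutativeRing c ℓ) where

  open CommutativeRing R hiding (zero)
  open PowerSeries R
  open Series R
  open RingProperties ring using (-0#≈0#)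
  open import Relation.Binary.Reasoning.Setoid setoid

  private variable
    k : ℕ

  infix 4 _≈[_]_

  -- Congruence modulo terms of degree at least `n`. Equalities of infinite series are proved by
  -- induction on this precision.
  _≈[_]_ : Series k → ℕ → Series k → Set ℓ
  f ≈[ n ] g = ∀ w → length w ℕ.< n → f w ≈ g w

  ≈[]⇒≈ : {f g : Series k} → (∀ n → f ≈[ n ] g) → f ≈ˢ g
  ≈[]⇒≈ f≈g w = f≈g (suc (length w)) w ℕ.≤-refl

  Proper : Series k → Set ℓ
  Proper f = f [] ≈ 0#

  Proper-* : (f g : Series k) → Proper f → Proper (f *ˢ g)
  Proper-* f g f₀ = trans (*ˢ-[] f g) (trans (*-congʳ f₀) (zeroˡ _))

  Proper-+ : (f g : Series k) → Proper f → Proper g → Proper (f +ˢ g)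
  Proper-+ f g f₀ g₀ = trans (+-cong f₀ g₀) (+-identityˡ 0#)

  Proper-minus : (f g : Series k) → Proper f → Proper g → Proper (f -ˢ g)
  Proper-minus f g f₀ g₀ = trans (+-cong f₀ (trans (-‿cong g₀) -0#≈0#)) (+-identityˡ 0#)

  *-congˡ[] : ∀ n (f g h : Series k) → g ≈[ n ] h → f *ˢ g ≈[ n ] f *ˢ h
  *-congˡ[] n       f g h g≈h []      0<n = begin
    (f *ˢ g) []   ≈⟨ *ˢ-[] f g ⟩
    f [] * g []   ≈⟨ *-congˡ (g≈h [] 0<n) ⟩
    f [] * h []   ≈⟨ *ˢ-[] f h ⟨
    (f *ˢ h) []   ∎
  *-congˡ[] n       f g h g≈h (i ∷ w) iw<n = begin
    (f *ˢ g) (i ∷ w)                  ≡⟨ *ˢ-∷ f g i w ⟩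
    f [] * g (i ∷ w) + (∂ i f *ˢ g) w ≈⟨ +-cong (*-congˡ (g≈h (i ∷ w) iw<n))
                                          (*-congˡ[] n (∂ i f) g h g≈h w (ℕ.<-trans (ℕ.n<1+n _) iw<n)) ⟩
    f [] * h (i ∷ w) + (∂ i f *ˢ h) w ≡⟨ *ˢ-∷ f h i w ⟨
    (f *ˢ h) (i ∷ w)                  ∎

  -- Without a constant term in `f`, the right factor is only read at proper suffixes, so one degree
  -- of precision is gained. This contraction underlies the uniqueness arguments below.
  contract : ∀ n (f g h : Series k) → Proper f → g ≈[ n ] h → f *ˢ g ≈[ suc n ] f *ˢ h
  contract n f g h f₀ g≈h []      _          = trans (Proper-* f g f₀) (sym (Proper-* f h f₀))
  contract n f g h f₀ g≈h (i ∷ w) (s≤s w<n) = begin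
    (f *ˢ g) (i ∷ w)                  ≡⟨ *ˢ-∷ f g i w ⟩
    f [] * g (i ∷ w) + (∂ i f *ˢ g) w ≈⟨ +-cong (vanish g) (*-congˡ[] n (∂ i f) g h g≈h w w<n) ⟩
    0# + (∂ i f *ˢ h) w               ≈⟨ +-congʳ (vanish h) ⟨
    f [] * h (i ∷ w) + (∂ i f *ˢ h) w ≡⟨ *ˢ-∷ f h i w ⟨
    (f *ˢ h) (i ∷ w)                  ∎
    where
    vanish : ∀ g → f [] * g (i ∷ w) ≈ 0#
    vanish g = trans (*-congʳ f₀) (zeroˡ _)

  -- `∑∞` reads the coefficient of `w` off the term of index `length w`. For a sequence whose
  -- coefficients become constant in this way, the result is the limit rather than a sum.
  limit-stable : (F : ℕ → Series k) → (∀ n → F n ≈[ suc n ] F (suc n)) →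
                 ∀ n → ∑∞ F ≈[ suc n ] F n
  -- Induction on `≤‴` raises the lower bound, which moves the index of `F` from `length w` up to
  -- `n` one step at a time.
  limit-stable F stable n w (s≤s w≤n) with ℕ.≤⇒≤‴ w≤n
  ... | w≤‴n = go w≤‴n ℕ.≤-refl
    where
    go : ∀ {m} → m ℕ.≤‴ n → length w ℕ.≤ m → F m w ≈ F n w
    go ℕ.≤‴-refl       w≤m = refl
    go (ℕ.≤‴-step m<n) w≤m = trans (stable _ w (s≤s w≤m)) (go m<n (ℕ.m≤n⇒m≤1+n w≤m))

  module Star (f : Series k) (f₀ : Proper f) where

    approx : ℕ → Series k
    approx zero    = 1ˢ
    approx (suc n) = 1ˢ +ˢ f *ˢ approx n

    -- The Kleene star `1 + f + f² + ⋯`, as the limit of its partial sums; it is the inverse of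
    -- `1 - f`.
    star : Series k
    star = ∑∞ approx

    private
      stable : ∀ n → approx n ≈[ suc n ] approx (suc n)
      stable zero    []      _ = sym (trans (+-congˡ (Proper-* f 1ˢ f₀)) (+-identityʳ _))
      stable zero    (i ∷ w) (s≤s ())
      stable (suc n) w       w<  = +-congˡ (contract (suc n) f (approx n) (approx (suc n)) f₀ (stable n) w w<)

    star-unfold : star ≈ˢ 1ˢ +ˢ f *ˢ star
    star-unfold w = trans (stable (length w) w ℕ.≤-refl)
      (+-congˡ (sym (*-congˡ[] (suc (length w)) f star (approx (length w))
        (limit-stable approx stable (length w)) w ℕ.≤-refl)))

module Substitution {c ℓ} (R : CommutativeRing c ℓ) where

  open CommutativeRing R hiding (zero)
  open PowerSeries R
  open Series R
  open Limits R
  open import Relation.Binary.Reasoning.Setoid setoid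
  open Sum semiring using (sum)
  open Kronecker semiring

  private variable
    k l : ℕ

  ∑-allFin : ∀ {n} (f : Fin n → Carrier) → ∑ (allFin n) f ≡ sum f
  ∑-allFin {zero}  f = ≡.refl
  ∑-allFin {suc n} f = ≡.cong (f zero +_) (≡.trans
    (≡.cong (λ xs → ∑ xs f) (≡.sym (map-tabulate id suc)))
    (≡.trans (∑-map suc (allFin n) f) (∑-allFin (f ∘ suc))))

  sum-at : ∀ {n} (f : Fin n → Series k) w →
           Sum.sum (Ring.semiring (seriesRing k)) f w ≡ sum (λ i → f i w)
  sum-at {n = zero}  f w = ≡.refl
  sum-at {n = suc n} f w = ≡.cong (f zero w +_) (sum-at (f ∘ suc) w)

  module _ (σ : Vec (Series l) k) (σ₀ : ∀ i → Proper (lookup σ i)) where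

    private
      -- `_⟪_⟫` bounds the words by the length of the coefficient being read, so it is the limit of
      -- these truncations with a fixed bound. The fixed bound is what the recursion on the first
      -- letter needs.
      substTo : ℕ → Series k → Series l
      substTo n Φ w = ∑ (tuples≤ (allFin k) n) λ v → Φ v * monomial σ v w

      step : (Fin k → Series l) → Carrier → Series l
      step G x w = (const x) w + ∑ (allFin k) (λ i → (lookup σ i *ˢ G i) w)

      substTo-suc : ∀ n Φ → substTo (suc n) Φ ≈ˢ step (λ i → substTo n (∂ i Φ)) (Φ [])
      substTo-suc n Φ w = trans (∑-tuples≤-suc (allFin k) n _)
        (+-congˡ (∑-cong (allFin k) λ i →
          ∑-*ˢ (tuples≤ (allFin k) n) (lookup σ i) (∂ i Φ) (monomial σ) w))

      step-cong : ∀ n G H x → (∀ i → G i ≈[ n ] H i) → step G x ≈[ suc n ] step H x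
      step-cong n G H x G≈H w w< = +-congˡ (∑-cong (allFin k) λ i →
        contract n (lookup σ i) (G i) (H i) (σ₀ i) (G≈H i) w w<)

      stable : ∀ n Φ → substTo n Φ ≈[ suc n ] substTo (suc n) Φ
      stable zero    Φ w w< = begin
        substTo 0 Φ w                       ≈⟨ ∑-tuples≤-zero (allFin k) (λ v → Φ v * monomial σ v w) ⟩
        Φ [] * 1ˢ w                         ≈⟨ +-identityʳ _ ⟨
        Φ [] * 1ˢ w + 0#                    ≈⟨ +-congˡ (∑-zero (allFin k) (λ i → *ˢ-zeroʳ (lookup σ i) w)) ⟨
        step (λ _ → 0ˢ) (Φ []) w            ≈⟨ step-cong 0 (λ _ → 0ˢ) _ (Φ []) (λ i w ()) w w< ⟩
        step (λ i → substTo 0 (∂ i Φ)) (Φ []) w ≈⟨ substTo-suc 0 Φ w ⟨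
        substTo 1 Φ w                       ∎
        where
        *ˢ-zeroʳ : ∀ f → f *ˢ 0ˢ ≈ˢ 0ˢ
        *ˢ-zeroʳ f w = ∑-zero (splits w) λ _ → zeroʳ _
      stable (suc n) Φ w w< = begin
        substTo (suc n) Φ w                             ≈⟨ substTo-suc n Φ w ⟩
        step (λ i → substTo n (∂ i Φ)) (Φ []) w
          ≈⟨ step-cong (suc n) _ _ (Φ []) (λ i → stable n (∂ i Φ)) w w< ⟩
        step (λ i → substTo (suc n) (∂ i Φ)) (Φ []) w   ≈⟨ substTo-suc (suc n) Φ w ⟨
        substTo (suc (suc n)) Φ w                       ∎

    -- The sum over words is sorted by first letter. As every `lookup σ i` is proper, this recursion
    -- determines the substitution, and multiplicativity is derived from it.
    ⟪⟫-unfold : ∀ Φ → Φ ⟪ σ ⟫ ≈ˢ const (Φ []) +ˢ ∑ˢ (allFin k) (λ i → lookup σ i *ˢ ∂ i Φ ⟪ σ ⟫)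
    ⟪⟫-unfold Φ w = begin
      substTo (length w) Φ w         ≈⟨ stable (length w) Φ w ℕ.≤-refl ⟩
      substTo (suc (length w)) Φ w   ≈⟨ substTo-suc (length w) Φ w ⟩
      step (λ i → substTo (length w) (∂ i Φ)) (Φ []) w
        ≈⟨ step-cong (suc (length w)) _ _ (Φ []) (λ i v v< →
             sym (limit-stable (λ n → substTo n (∂ i Φ)) (λ n → stable n (∂ i Φ)) (length w) v v<))
             w (ℕ.m≤n⇒m≤1+n ℕ.≤-refl) ⟩
      step (λ i → ∂ i Φ ⟪ σ ⟫) (Φ []) w ∎

    ⟪⟫-cong : ∀ {Φ Φ′} → Φ ≈ˢ Φ′ → Φ ⟪ σ ⟫ ≈ˢ Φ′ ⟪ σ ⟫
    ⟪⟫-cong Φ≈ w = ∑-cong (tuples≤ (allFin k) (length w)) λ v → *-congʳ (Φ≈ v)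

    ⟪⟫-+ : ∀ Φ Φ′ → (Φ +ˢ Φ′) ⟪ σ ⟫ ≈ˢ Φ ⟪ σ ⟫ +ˢ Φ′ ⟪ σ ⟫
    ⟪⟫-+ Φ Φ′ w = trans (∑-cong (tuples≤ (allFin k) (length w)) λ v → distribʳ _ _ _)
      (∑-+ (tuples≤ (allFin k) (length w)) _ _)

    ⟪⟫-· : ∀ x Φ → (x · Φ) ⟪ σ ⟫ ≈ˢ x · Φ ⟪ σ ⟫
    ⟪⟫-· x Φ w = trans (∑-cong (tuples≤ (allFin k) (length w)) λ v → *-assoc _ _ _)
      (∑-*ˡ (tuples≤ (allFin k) (length w)) x _)

    ⟪⟫-1 : 1ˢ ⟪ σ ⟫ ≈ˢ 1ˢ
    ⟪⟫-1 w = begin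
      (1ˢ ⟪ σ ⟫) w          ≈⟨ ⟪⟫-unfold 1ˢ w ⟩
      1# * 1ˢ w + ∑ (allFin k) (λ i → (lookup σ i *ˢ 0ˢ ⟪ σ ⟫) w)
        ≈⟨ +-cong (*-identityˡ _) (∑-zero (allFin k) λ i →
             ∑-zero (splits w) λ (u , v) → trans (*-congˡ
               (∑-zero (tuples≤ (allFin k) (length v)) λ _ → zeroˡ _)) (zeroʳ _)) ⟩
      1ˢ w + 0#             ≈⟨ +-identityʳ _ ⟩
      1ˢ w                  ∎

    private
      rest : Series k → Series l
      rest Φ = ∑ˢ (allFin k) (λ i → lookup σ i *ˢ ∂ i Φ ⟪ σ ⟫)

      ∑ˢ-*ˢ : ∀ {A : Set} (xs : List A) (f : A → Series l) g → ∑ˢ xs f *ˢ g ≈ˢ ∑ˢ xs (λ x → f x *ˢ g)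
      ∑ˢ-*ˢ []       f g = *ˢ-zeroˡ g
      ∑ˢ-*ˢ (x ∷ xs) f g w = trans (*ˢ-distribʳ g (f x) (∑ˢ xs f) w) (+-congˡ (∑ˢ-*ˢ xs f g w))

    -- Both sides are determined by their left quotients, up to a contraction.
    ⟪⟫-* : ∀ Φ Φ′ → (Φ *ˢ Φ′) ⟪ σ ⟫ ≈ˢ Φ ⟪ σ ⟫ *ˢ Φ′ ⟪ σ ⟫
    ⟪⟫-* Φ Φ′ = ≈[]⇒≈ {f = (Φ *ˢ Φ′) ⟪ σ ⟫} {Φ ⟪ σ ⟫ *ˢ Φ′ ⟪ σ ⟫} (λ n → go n Φ)
      where
      go : ∀ n Φ → (Φ *ˢ Φ′) ⟪ σ ⟫ ≈[ n ] Φ ⟪ σ ⟫ *ˢ Φ′ ⟪ σ ⟫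
      go (suc n) Φ w w< = begin
        ((Φ *ˢ Φ′) ⟪ σ ⟫) w
          ≈⟨ ⟪⟫-unfold (Φ *ˢ Φ′) w ⟩
        (Φ *ˢ Φ′) [] * 1ˢ w + rest (Φ *ˢ Φ′) w
          ≈⟨ +-cong (trans (*-congʳ (*ˢ-[] Φ Φ′)) (*-assoc _ _ _)) (begin
            rest (Φ *ˢ Φ′) w
              ≈⟨ (∑-cong (allFin k) λ i → contract n (lookup σ i) _ _ (σ₀ i) (quotient i) w w<) ⟩
            ∑ (allFin k) (λ i → (lookup σ i *ˢ (Φ [] · ∂ i Φ′ ⟪ σ ⟫ +ˢ ∂ i Φ ⟪ σ ⟫ *ˢ Φ′ ⟪ σ ⟫)) w)
              ≈⟨ (∑-cong (allFin k) λ i → trans (*ˢ-distribˡ (lookup σ i) (Φ [] · ∂ i Φ′ ⟪ σ ⟫) _ w)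
                   (+-cong (*ˢ-· (Φ []) (lookup σ i) (∂ i Φ′ ⟪ σ ⟫) w)
                     (sym (*ˢ-assoc (lookup σ i) (∂ i Φ ⟪ σ ⟫) (Φ′ ⟪ σ ⟫) w)))) ⟩
            ∑ (allFin k) (λ i → Φ [] * (lookup σ i *ˢ ∂ i Φ′ ⟪ σ ⟫) w
              + ((lookup σ i *ˢ ∂ i Φ ⟪ σ ⟫) *ˢ Φ′ ⟪ σ ⟫) w)
              ≈⟨ ∑-+ (allFin k) _ _ ⟩
            _ ≈⟨ +-cong (∑-*ˡ (allFin k) (Φ []) _) (sym (∑ˢ-*ˢ (allFin k) _ (Φ′ ⟪ σ ⟫) w)) ⟩
            Φ [] * rest Φ′ w + (rest Φ *ˢ Φ′ ⟪ σ ⟫) w ∎) ⟩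
        Φ [] * (Φ′ [] * 1ˢ w) + (Φ [] * rest Φ′ w + (rest Φ *ˢ Φ′ ⟪ σ ⟫) w)
          ≈⟨ +-assoc _ _ _ ⟨
        Φ [] * (Φ′ [] * 1ˢ w) + Φ [] * rest Φ′ w + (rest Φ *ˢ Φ′ ⟪ σ ⟫) w
          ≈⟨ +-congʳ (trans (sym (distribˡ _ _ _)) (*-congˡ (sym (⟪⟫-unfold Φ′ w)))) ⟩
        Φ [] * (Φ′ ⟪ σ ⟫) w + (rest Φ *ˢ Φ′ ⟪ σ ⟫) w
          ≈⟨ +-congʳ (trans (·-*ˢ (Φ []) 1ˢ (Φ′ ⟪ σ ⟫) w) (*-congˡ (*ˢ-identityˡ (Φ′ ⟪ σ ⟫) w))) ⟨
        (const (Φ []) *ˢ Φ′ ⟪ σ ⟫) w + (rest Φ *ˢ Φ′ ⟪ σ ⟫) w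
          ≈⟨ *ˢ-distribʳ (Φ′ ⟪ σ ⟫) (const (Φ [])) (rest Φ) w ⟨
        ((const (Φ []) +ˢ rest Φ) *ˢ Φ′ ⟪ σ ⟫) w
          ≈⟨ *ˢ-cong (⟪⟫-unfold Φ) (≈ˢ-refl {f = Φ′ ⟪ σ ⟫}) w ⟨
        (Φ ⟪ σ ⟫ *ˢ Φ′ ⟪ σ ⟫) w ∎
        where
        quotient : ∀ i → ∂ i (Φ *ˢ Φ′) ⟪ σ ⟫ ≈[ n ] Φ [] · ∂ i Φ′ ⟪ σ ⟫ +ˢ ∂ i Φ ⟪ σ ⟫ *ˢ Φ′ ⟪ σ ⟫
        quotient i v v< = begin
          (∂ i (Φ *ˢ Φ′) ⟪ σ ⟫) v                   ≈⟨ ⟪⟫-cong (∂-* i Φ Φ′) v ⟩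
          ((Φ [] · ∂ i Φ′ +ˢ ∂ i Φ *ˢ Φ′) ⟪ σ ⟫) v   ≈⟨ ⟪⟫-+ (Φ [] · ∂ i Φ′) (∂ i Φ *ˢ Φ′) v ⟩
          _ ≈⟨ +-cong (⟪⟫-· (Φ []) (∂ i Φ′) v) (go n (∂ i Φ) v v<) ⟩
          _ ∎

    ⟪⟫-var : ∀ i → var i ⟪ σ ⟫ ≈ˢ lookup σ i
    ⟪⟫-var i w = begin
      (var i ⟪ σ ⟫) w
        ≈⟨ ⟪⟫-unfold (var i) w ⟩
      0# * 1ˢ w + ∑ (allFin k) (λ j → (lookup σ j *ˢ ∂ j (var i) ⟪ σ ⟫) w)
        ≈⟨ +-cong (zeroˡ _) (∑-cong (allFin k) λ j → begin
          (lookup σ j *ˢ ∂ j (var i) ⟪ σ ⟫) w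
            ≈⟨ *ˢ-cong (≈ˢ-refl {f = lookup σ j}) (quotient j) w ⟩
          (lookup σ j *ˢ (δ i j · 1ˢ)) w
            ≈⟨ trans (*ˢ-· (δ i j) (lookup σ j) 1ˢ w) (*-congˡ (*ˢ-identityʳ (lookup σ j) w)) ⟩
          δ i j * lookup σ j w ∎) ⟩
      0# + ∑ (allFin k) (λ j → δ i j * lookup σ j w)
        ≈⟨ +-identityˡ _ ⟩
      ∑ (allFin k) (λ j → δ i j * lookup σ j w)
        ≡⟨ ∑-allFin (λ j → δ i j * lookup σ j w) ⟩
      sum (λ j → δ i j * lookup σ j w)
        ≈⟨ sum-δˡ i (λ j → lookup σ j w) ⟩
      lookup σ i w ∎
      where
      quotient : ∀ j → ∂ j (var i) ⟪ σ ⟫ ≈ˢ δ i j · 1ˢ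
      quotient j w = trans (⟪⟫-cong {∂ j (var i)} {δ i j · 1ˢ}
          (λ { [] → sym (*-identityʳ _) ; (_ ∷ _) → sym (zeroʳ _) }) w)
        (trans (⟪⟫-· (δ i j) 1ˢ w) (*-congˡ (⟪⟫-1 w)))

-- Rational solutions of linear systems

module LinearSystems {c ℓ} (R : CommutativeRing c ℓ)
  (1≉0 : ¬ (CommutativeRing._≈_ R (CommutativeRing.1# R) (CommutativeRing.0# R))) (k : ℕ) where

  private module R = CommutativeRing R
  open PowerSeries R
  open Series R
  open Limits R
  open Ring (seriesRing k) hiding (zero)
  open RingProperties (seriesRing k)
  open Sum semiring
  open Kronecker semiring
  open import Relation.Binary.Reasoning.Setoid setoid
  open import Algebra.Solver.CommutativeMonoid R.+-commutativeMonoid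
    using (solve; _⊕_; _⊜_)

  rational-const : ∀ x → Rational (const {k} x)
  rational-const x = polynomial (0 , λ { (_ ∷ _) _ → R.zeroʳ x })

  rational-0 : Rational (0ˢ {k})
  rational-0 = polynomial (0 , λ _ _ → R.refl)

  rational-1 : Rational (1ˢ {k})
  rational-1 = polynomial (0 , λ { (_ ∷ _) _ → R.refl })

  rational-var : ∀ i → Rational (var {k} i)
  rational-var i = polynomial (1 , λ { (_ ∷ []) (s≤s ()) ; (_ ∷ _ ∷ _) _ → R.refl })

  rational-neg : ∀ {f} → Rational f → Rational (- f)
  rational-neg {f} rf = resp eq (times (rational-const (R.- R.1#)) rf)
    where
    eq : const (R.- R.1#) * f ≈ - f
    eq w = R.trans (·-*ˢ (R.- R.1#) 1ˢ f w) (R.trans (R.*-congˡ (*ˢ-identityˡ f w))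
      (RingProperties.-1*x≈-x R.ring (f w)))

  rational-δ : ∀ {n} i j → Rational (δ {n} i j)
  rational-δ i j with i Fin.≟ j
  ... | yes _ = rational-1
  ... | no  _ = rational-0

  rational-sum : ∀ {n} (f : Fin n → Series k) → (∀ i → Rational (f i)) → Rational (sum f)
  rational-sum {zero}  f rf = rational-0
  rational-sum {suc n} f rf = plus (rf zero) (rational-sum (f ∘ suc) (rf ∘ suc))

  module _ (f : Series k) (f₀ : Proper f) where

    open Star f f₀

    -- Each use of the equation pushes `g` one degree higher, so no term survives.
    cancel-proper : ∀ g → g ≈ f * g → g ≈ 0#
    cancel-proper g g≈fg = ≈[]⇒≈ {f = g} {0#} go
      where
      go : ∀ n → g ≈[ n ] 0#
      go (suc n) w w< = R.trans (g≈fg w) (R.trans (contract n f g 0# f₀ (go n) w w<) (zeroʳ f w))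

    private
      [1-f]* : ∀ g → (1# - f) * g ≈ g - f * g
      [1-f]* g = trans (distribʳ g 1# (- f)) (+-cong (*-identityˡ g) (sym (-‿distribˡ-* f g)))

      inverseʳ′ : (1# - f) * star ≈ 1#
      inverseʳ′ = begin
        (1# - f) * star                    ≈⟨ [1-f]* star ⟩
        star - f * star                    ≈⟨ +-congʳ star-unfold ⟩
        1# + f * star - f * star           ≈⟨ +-assoc 1# (f * star) (- (f * star)) ⟩
        1# + (f * star - f * star)         ≈⟨ +-congˡ (-‿inverseʳ (f * star)) ⟩
        1# + 0#                            ≈⟨ +-identityʳ 1# ⟩
        1#                                 ∎

      -- The defect `h = star (1 - f) - 1` satisfies `(1 - f) h = 0` by the right inverse law, so
      -- `h = f h`, and a proper `f` forces `h` to vanish.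
      inverseˡ′ : star * (1# - f) ≈ 1#
      inverseˡ′ = x-y≈0⇒x≈y (star * (1# - f)) 1# (cancel-proper h h≈fh)
        where
        h : Series k
        h = star * (1# - f) - 1#

        x-y≈0⇒x≈y : ∀ x y → x - y ≈ 0# → x ≈ y
        x-y≈0⇒x≈y x y x-y≈0 = begin
          x              ≈⟨ +-identityʳ x ⟨
          x + 0#         ≈⟨ +-congˡ (-‿inverseˡ y) ⟨
          x + (- y + y)  ≈⟨ +-assoc x (- y) y ⟨
          x - y + y      ≈⟨ +-congʳ x-y≈0 ⟩
          0# + y         ≈⟨ +-identityˡ y ⟩
          y              ∎

        h≈fh : h ≈ f * h
        h≈fh = x-y≈0⇒x≈y h (f * h) (begin
          h - f * h                                        ≈⟨ [1-f]* h ⟨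
          (1# - f) * h                                     ≈⟨ distribˡ (1# - f) (star * (1# - f)) (- 1#) ⟩
          (1# - f) * (star * (1# - f)) + (1# - f) * - 1#
            ≈⟨ +-cong (trans (sym (*-assoc (1# - f) star (1# - f)))
                 (trans (*-congʳ inverseʳ′) (*-identityˡ (1# - f))))
                 (trans (sym (-‿distribʳ-* (1# - f) 1#)) (-‿cong (*-identityʳ (1# - f)))) ⟩
          (1# - f) - (1# - f)                              ≈⟨ -‿inverseʳ (1# - f) ⟩
          0#                                               ∎)

    rational-star : Rational f → Rational star
    rational-star rf = inverse (plus rational-1 (rational-neg rf)) nonzero inverseʳ′ inverseˡ′
      where
      nonzero : ¬ ((1# - f) [] R.≈ R.0#)
      nonzero 1-f₀≈0 = 1≉0 (R.trans (R.sym (R.+-identityʳ R.1#)) (R.trans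
        (R.+-congˡ (R.sym (R.trans (R.-‿cong f₀) (RingProperties.-0#≈0# R.ring)))) 1-f₀≈0))

  Solution : ∀ {N} → (Fin N → Series k) → (Fin N → Fin N → Series k) → Set _
  Solution {N} A B = ∃ λ (X : Fin N → Series k) →
    (∀ i → Rational (X i)) × (∀ i → X i ≈ A i + sum (λ j → B i j * X j))

  -- Gaussian elimination of the first unknown.
  solve-proper : ∀ {N} (A : Fin N → Series k) (B : Fin N → Fin N → Series k) →
                 (∀ i → Rational (A i)) → (∀ i j → Rational (B i j)) →
                 (∀ i j → Proper (B i j)) → Solution A B
  solve-proper {zero}  A B rA rB B₀ = (λ ()) , (λ ()) , λ ()
  solve-proper {suc N} A B rA rB B₀ = X , rX , X≈
    where
    open Star (B zero zero) (B₀ zero zero) using (star; star-unfold)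

    rstar : Rational star
    rstar = rational-star (B zero zero) (B₀ zero zero) (rB zero zero)

    -- The first equation gives `X zero = star * rhs`. Substituting it into the others leaves this
    -- smaller system, whose matrix is again proper because each added product begins with
    -- `B (suc i) zero`.
    A′ : Fin N → Series k
    A′ i = A (suc i) + B (suc i) zero * (star * A zero)

    B′ : Fin N → Fin N → Series k
    B′ i j = B (suc i) (suc j) + B (suc i) zero * (star * B zero (suc j))

    reduced : Solution A′ B′
    reduced = solve-proper A′ B′
      (λ i → plus (rA (suc i)) (times (rB (suc i) zero) (times rstar (rA zero))))
      (λ i j → plus (rB (suc i) (suc j)) (times (rB (suc i) zero) (times rstar (rB zero (suc j)))))
      (λ i j → Proper-+ (B (suc i) (suc j)) (B (suc i) zero * (star * B zero (suc j)))
        (B₀ (suc i) (suc j))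
        (Proper-* (B (suc i) zero) (star * B zero (suc j)) (B₀ (suc i) zero)))

    X′ : Fin N → Series k
    X′ = proj₁ reduced

    rX′ : ∀ i → Rational (X′ i)
    rX′ = proj₁ (proj₂ reduced)

    rhs : Series k
    rhs = A zero + sum (λ j → B zero (suc j) * X′ j)

    X : Fin (suc N) → Series k
    X zero    = star * rhs
    X (suc i) = X′ i

    rX : ∀ i → Rational (X i)
    rX zero    = times rstar (plus (rA zero)
      (rational-sum _ λ j → times (rB zero (suc j)) (rX′ j)))
    rX (suc i) = rX′ i

    X≈ : ∀ i → X i ≈ A i + sum (λ j → B i j * X j)
    X≈ zero    = begin
      star * rhs
        ≈⟨ *-congʳ star-unfold ⟩
      (1# + B zero zero * star) * rhs
        ≈⟨ distribʳ rhs 1# (B zero zero * star) ⟩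
      1# * rhs + B zero zero * star * rhs
        ≈⟨ +-cong (*-identityˡ rhs) (*-assoc (B zero zero) star rhs) ⟩
      A zero + sum (λ j → B zero (suc j) * X′ j) + B zero zero * (star * rhs)
        ≈⟨ (λ w → solve 3 (λ a x y → (a ⊕ x) ⊕ y ⊜ a ⊕ (y ⊕ x)) R.refl
             (A zero w) (sum (λ j → B zero (suc j) * X′ j) w) ((B zero zero * (star * rhs)) w)) ⟩
      A zero + (B zero zero * (star * rhs) + sum (λ j → B zero (suc j) * X′ j)) ∎
    X≈ (suc i) = begin
      X′ i
        ≈⟨ proj₂ (proj₂ reduced) i ⟩
      A′ i + sum (λ j → B′ i j * X′ j)
        ≈⟨ +-congˡ {A′ i} (begin
          sum (λ j → B′ i j * X′ j)
            ≈⟨ sum-cong-≋ {N} (λ j → distribʳ (X′ j) (B (suc i) (suc j))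
                 (B (suc i) zero * (star * B zero (suc j)))) ⟩
          sum (λ j → S j + b * (star * B zero (suc j)) * X′ j)
            ≈⟨ ∑-distrib-+ S (λ j → b * (star * B zero (suc j)) * X′ j) ⟩
          sum S + sum (λ j → b * (star * B zero (suc j)) * X′ j)
            ≈⟨ +-congˡ {sum S} (begin
              sum (λ j → b * (star * B zero (suc j)) * X′ j)
                ≈⟨ sum-cong-≋ {N} (λ j → trans (*-assoc b (star * B zero (suc j)) (X′ j))
                     (*-congˡ (*-assoc star (B zero (suc j)) (X′ j)))) ⟩
              sum (λ j → b * (star * T j))
                ≈⟨ *-distribˡ-sum b (λ j → star * T j) ⟨
              b * sum (λ j → star * T j)
                ≈⟨ *-congˡ {b} (*-distribˡ-sum star T) ⟨
              b * (star * sum T) ∎) ⟩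
          sum S + b * (star * sum T) ∎) ⟩
      A (suc i) + b * (star * A zero) + (sum S + b * (star * sum T))
        ≈⟨ (λ w → solve 4 (λ a x y z → (a ⊕ x) ⊕ (y ⊕ z) ⊜ a ⊕ ((x ⊕ z) ⊕ y)) R.refl
             (A (suc i) w) ((b * (star * A zero)) w) (sum S w) ((b * (star * sum T)) w)) ⟩
      A (suc i) + (b * (star * A zero) + b * (star * sum T) + sum S)
        ≈⟨ +-congˡ {A (suc i)} (+-congʳ {sum S} (trans (sym (distribˡ b (star * A zero) (star * sum T)))
             (*-congˡ {b} (sym (distribˡ star (A zero) (sum T)))))) ⟩
      A (suc i) + (b * (star * rhs) + sum S) ∎
      where
      b : Series k
      b = B (suc i) zero

      S T : Fin N → Series k
      S j = B (suc i) (suc j) * X′ j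
      T j = B zero (suc j) * X′ j

  -- The generating series of the outputs of a finite deterministic automaton.
  automaton : ∀ {N} (next : Fin N → Fin N) (out : Fin N → R.Carrier) s → Rational s → Proper s →
    ∃ λ (F : Fin N → Series k) → (∀ i → Rational (F i)) × (∀ i → F i ≈ const (out i) + s * F (next i))
  automaton {N} next out s rs s₀ with solve-proper
      (λ i → const (out i)) (λ i j → s * δ (next i) j)
      (λ i → rational-const (out i)) (λ i j → times rs (rational-δ (next i) j))
      (λ i j → Proper-* s (δ (next i) j) s₀)
  ... | F , rF , F≈ = F , rF , λ i → trans (F≈ i) (+-congˡ {const (out i)} (begin
    sum (λ j → s * δ (next i) j * F j)    ≈⟨ sum-cong-≋ {N} (λ j → *-assoc s (δ (next i) j) (F j)) ⟩
    sum (λ j → s * (δ (next i) j * F j))  ≈⟨ *-distribˡ-sum s (λ j → δ (next i) j * F j) ⟨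
    s * sum (λ j → δ (next i) j * F j)    ≈⟨ *-congˡ {s} (sum-δˡ (next i) F) ⟩
    s * F (next i)                        ∎))

-- Matrices

module Matrices {c ℓ} (S : Ring c ℓ) (n : ℕ) where

  open Ring S hiding (zero)
  open Sum semiring
  open Kronecker semiring
  open import Relation.Binary.Reasoning.Setoid setoid

  Mat : Set c
  Mat = Fin n → Fin n → Carrier

  infix  4 _≈ᵐ_
  infixl 7 _*ᵐ_

  _≈ᵐ_ : Mat → Mat → Set ℓ
  A ≈ᵐ B = ∀ i j → A i j ≈ B i j

  _*ᵐ_ : Mat → Mat → Mat
  (A *ᵐ B) i j = sum λ k → A i k * B k j

  *ᵐ-assoc : ∀ A B C → (A *ᵐ B) *ᵐ C ≈ᵐ A *ᵐ (B *ᵐ C)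
  *ᵐ-assoc A B C i j = begin
    sum (λ k → sum (λ l → A i l * B l k) * C k j)
      ≈⟨ sum-cong-≋ {n} (λ k → trans (*-distribʳ-sum (C k j) (λ l → A i l * B l k))
           (sum-cong-≋ {n} λ l → *-assoc (A i l) (B l k) (C k j))) ⟩
    sum (λ k → sum (λ l → A i l * (B l k * C k j)))
      ≈⟨ ∑-comm (λ k l → A i l * (B l k * C k j)) ⟩
    sum (λ l → sum (λ k → A i l * (B l k * C k j)))
      ≈⟨ sum-cong-≋ {n} (λ l → *-distribˡ-sum (A i l) (λ k → B l k * C k j)) ⟨
    sum (λ l → A i l * sum (λ k → B l k * C k j)) ∎

  *ᵐ-distribˡ : ∀ A B C → A *ᵐ (λ i j → B i j + C i j) ≈ᵐ λ i j → (A *ᵐ B) i j + (A *ᵐ C) i j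
  *ᵐ-distribˡ A B C i j = trans (sum-cong-≋ {n} λ k → distribˡ (A i k) (B k j) (C k j))
    (∑-distrib-+ (λ k → A i k * B k j) (λ k → A i k * C k j))

  *ᵐ-distribʳ : ∀ A B C → (λ i j → B i j + C i j) *ᵐ A ≈ᵐ λ i j → (B *ᵐ A) i j + (C *ᵐ A) i j
  *ᵐ-distribʳ A B C i j = trans (sum-cong-≋ {n} λ k → distribʳ (A k j) (B i k) (C i k))
    (∑-distrib-+ (λ k → B i k * A k j) (λ k → C i k * A k j))

  matrixRing : Ring c ℓ
  matrixRing = record
    { Carrier = Mat
    ; _≈_ = _≈ᵐ_
    ; _+_ = λ A B i j → A i j + B i j
    ; _*_ = _*ᵐ_
    ; -_ = λ A i j → - A i j
    ; 0# = λ _ _ → 0#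
    ; 1# = δ
    ; isRing = record
      { +-isAbelianGroup = record
        { isGroup = record
          { isMonoid = record
            { isSemigroup = record
              { isMagma = record
                { isEquivalence = record
                  { refl = λ _ _ → refl
                  ; sym = λ A≈B i j → sym (A≈B i j)
                  ; trans = λ A≈B B≈C i j → trans (A≈B i j) (B≈C i j) }
                ; ∙-cong = λ A≈ B≈ i j → +-cong (A≈ i j) (B≈ i j) }
              ; assoc = λ A B C i j → +-assoc (A i j) (B i j) (C i j) }
            ; identity = (λ A i j → +-identityˡ (A i j)) , (λ A i j → +-identityʳ (A i j)) }
          ; inverse = (λ A i j → -‿inverseˡ (A i j)) , (λ A i j → -‿inverseʳ (A i j))
          ; ⁻¹-cong = λ A≈ i j → -‿cong (A≈ i j) }
        ; comm = λ A B i j → +-comm (A i j) (B i j) }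
      ; *-cong = λ A≈ B≈ i j → sum-cong-≋ {n} λ k → *-cong (A≈ i k) (B≈ k j)
      ; *-assoc = *ᵐ-assoc
      ; *-identity = (λ A i j → sum-δˡ i (λ k → A k j)) , (λ A i j → sum-δʳ j (A i))
      ; distrib = *ᵐ-distribˡ , *ᵐ-distribʳ } }

  -- Letters become elements of the matrix ring, so that the matrix identities can be proved in an
  -- arbitrary ring. The entries do not commute, hence separate rules for left and right
  -- multiplication.
  diag : Carrier → Mat
  diag x i j = x * δ i j

  diag-* : ∀ x A i j → (diag x *ᵐ A) i j ≈ x * A i j
  diag-* x A i j = begin
    sum (λ k → x * δ i k * A k j)    ≈⟨ sum-cong-≋ {n} (λ k → *-assoc x (δ i k) (A k j)) ⟩
    sum (λ k → x * (δ i k * A k j))  ≈⟨ *-distribˡ-sum x (λ k → δ i k * A k j) ⟨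
    x * sum (λ k → δ i k * A k j)    ≈⟨ *-congˡ (sum-δˡ i (λ k → A k j)) ⟩
    x * A i j                        ∎

  *-diag : ∀ x A i j → (A *ᵐ diag x) i j ≈ A i j * x
  *-diag x A i j = begin
    sum (λ k → A i k * (x * δ k j))  ≈⟨ sum-cong-≋ {n} (λ k → *-assoc (A i k) x (δ k j)) ⟨
    sum (λ k → A i k * x * δ k j)    ≈⟨ sum-δʳ j (λ k → A i k * x) ⟩
    A i j * x                        ∎

-- Non-commutative ring identities behind the elimination of odd powers of `t`

module RingIdentities {c ℓ} (S : Ring c ℓ) where

  open Ring S
  open RingProperties S using (+-cancelʳ)
  open import Relation.Binary.Reasoning.Setoid setoid
  open import Algebra.Solver.CommutativeMonoid +-commutativeMonoid
    using (solve; _⊕_; _⊜_)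

  -- (1 + q(-t)) (q(t) - 1) = q(t) - q(-t), divided by t.
  [1+q⁻]K : ∀ {T K E q q⁻} → q ≈ 1# + T * K → q ≈ q⁻ + (T * E + T * E) → q⁻ * q ≈ 1# →
            q⁻ * T ≈ T * q⁻ → T * (K + q⁻ * K) ≈ T * (E + E)
  [1+q⁻]K {T} {K} {E} {q} {q⁻} q≈1+TK q≈q⁻+2TE q⁻q≈1 q⁻T≈Tq⁻ =
    +-cancelʳ q⁻ _ _ (begin
      T * (K + q⁻ * K) + q⁻        ≈⟨ +-congʳ (distribˡ T K (q⁻ * K)) ⟩
      T * K + T * (q⁻ * K) + q⁻    ≈⟨ +-assoc (T * K) (T * (q⁻ * K)) q⁻ ⟩
      T * K + (T * (q⁻ * K) + q⁻)  ≈⟨ +-congˡ (+-cong (begin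
        T * (q⁻ * K)  ≈⟨ *-assoc T q⁻ K ⟨
        T * q⁻ * K    ≈⟨ *-congʳ q⁻T≈Tq⁻ ⟨
        q⁻ * T * K    ≈⟨ *-assoc q⁻ T K ⟩
        q⁻ * (T * K)  ∎) (sym (*-identityʳ q⁻))) ⟩
      T * K + (q⁻ * (T * K) + q⁻ * 1#)  ≈⟨ +-congˡ (begin
        q⁻ * (T * K) + q⁻ * 1#  ≈⟨ distribˡ q⁻ (T * K) 1# ⟨
        q⁻ * (T * K + 1#)       ≈⟨ *-congˡ (trans (+-comm (T * K) 1#) (sym q≈1+TK)) ⟩
        q⁻ * q                  ≈⟨ q⁻q≈1 ⟩
        1#                      ∎) ⟩
      T * K + 1#                   ≈⟨ trans (+-comm (T * K) 1#) (sym q≈1+TK) ⟩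
      q                            ≈⟨ q≈q⁻+2TE ⟩
      q⁻ + (T * E + T * E)         ≈⟨ +-comm q⁻ (T * E + T * E) ⟩
      T * E + T * E + q⁻           ≈⟨ +-congʳ (distribˡ T E E) ⟨
      T * (E + E) + q⁻             ∎)

  -- Add `T * E * X` to both sides. On the left it completes `q⁻` to `1 + P`; on the right it is the
  -- part of `E * C * X` that comes from the summand `T` of `C`.
  [1+q⁻]X : ∀ {T B C P E q⁻ X} → q⁻ + T * E ≈ 1# + P → C ≈ T + (B + B) → E * T ≈ T * E →
            X + X + P * X ≈ E + E + E * C * X → X + q⁻ * X ≈ E + E + (E + E) * (B * X)
  [1+q⁻]X {T} {B} {C} {P} {E} {q⁻} {X} q⁻+TE≈1+P C≈T+2B ET≈TE X≈ =
    +-cancelʳ (T * E * X) _ _ (begin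
      X + q⁻ * X + T * E * X          ≈⟨ +-assoc X (q⁻ * X) (T * E * X) ⟩
      X + (q⁻ * X + T * E * X)        ≈⟨ +-congˡ (distribʳ X q⁻ (T * E)) ⟨
      X + (q⁻ + T * E) * X            ≈⟨ +-congˡ (*-congʳ q⁻+TE≈1+P) ⟩
      X + (1# + P) * X                ≈⟨ +-congˡ (distribʳ X 1# P) ⟩
      X + (1# * X + P * X)            ≈⟨ +-congˡ (+-congʳ (*-identityˡ X)) ⟩
      X + (X + P * X)                 ≈⟨ +-assoc X X (P * X) ⟨
      X + X + P * X                   ≈⟨ X≈ ⟩
      E + E + E * C * X               ≈⟨ +-congˡ (begin
        E * C * X                               ≈⟨ *-congʳ (*-congˡ C≈T+2B) ⟩
        E * (T + (B + B)) * X                   ≈⟨ *-congʳ (distribˡ E T (B + B)) ⟩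
        (E * T + E * (B + B)) * X               ≈⟨ distribʳ X (E * T) (E * (B + B)) ⟩
        E * T * X + E * (B + B) * X             ≈⟨ +-cong (*-congʳ ET≈TE) (begin
          E * (B + B) * X        ≈⟨ *-congʳ (trans (distribˡ E B B) (sym (distribʳ B E E))) ⟩
          (E + E) * B * X        ≈⟨ *-assoc (E + E) B X ⟩
          (E + E) * (B * X)      ∎) ⟩
        T * E * X + (E + E) * (B * X)           ≈⟨ +-comm (T * E * X) ((E + E) * (B * X)) ⟩
        (E + E) * (B * X) + T * E * X           ∎) ⟩
      E + E + ((E + E) * (B * X) + T * E * X)   ≈⟨ +-assoc (E + E) ((E + E) * (B * X)) (T * E * X) ⟨
      E + E + (E + E) * (B * X) + T * E * X     ∎)

  -- Both occurrences of `2E` are replaced by `(1 + q⁻) K`, which exposes `1 + q⁻` as a common left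
  -- factor. It is applied with `Y = B * X`.
  [1+q⁻]X≈[1+q⁻]KY : ∀ {K E q⁻ X Y} → K + q⁻ * K ≈ E + E → X + q⁻ * X ≈ E + E + (E + E) * Y →
                     X + q⁻ * X ≈ K + K * Y + q⁻ * (K + K * Y)
  [1+q⁻]X≈[1+q⁻]KY {K} {E} {q⁻} {X} {Y} K+q⁻K≈2E X≈ = begin
    X + q⁻ * X                                 ≈⟨ X≈ ⟩
    E + E + (E + E) * Y                        ≈⟨ +-cong K+q⁻K≈2E (*-congʳ K+q⁻K≈2E) ⟨
    K + q⁻ * K + (K + q⁻ * K) * Y              ≈⟨ +-congˡ (distribʳ Y K (q⁻ * K)) ⟩
    K + q⁻ * K + (K * Y + q⁻ * K * Y)          ≈⟨ solve 4 (λ x y z w → (x ⊕ y) ⊕ (z ⊕ w) ⊜ (x ⊕ z) ⊕ (y ⊕ w))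
                                                    refl K (q⁻ * K) (K * Y) (q⁻ * K * Y) ⟩
    K + K * Y + (q⁻ * K + q⁻ * K * Y)          ≈⟨ +-congˡ (+-congˡ (*-assoc q⁻ K Y)) ⟩
    K + K * Y + (q⁻ * K + q⁻ * (K * Y))        ≈⟨ +-congˡ (distribˡ q⁻ K (K * Y)) ⟨
    K + K * Y + q⁻ * (K + K * Y)               ∎

  -- With t = a - b this is c² - 2d = t².
  square : ∀ t b → t * t + (((t + b) * b + b * (t + b)) + ((t + b) * b + b * (t + b)))
                   ≈ ((t + b) + b) * ((t + b) + b)
  square t b = begin
    t * t + (((t + b) * b + b * (t + b)) + ((t + b) * b + b * (t + b)))
      ≈⟨ +-congˡ (+-cong expand expand) ⟩
    t * t + (((t * b + b * b) + (b * t + b * b)) + ((t * b + b * b) + (b * t + b * b)))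
      ≈⟨ solve 4 (λ tt tb bt bb →
           tt ⊕ (((tb ⊕ bb) ⊕ (bt ⊕ bb)) ⊕ ((tb ⊕ bb) ⊕ (bt ⊕ bb)))
           ⊜ (((tt ⊕ bt) ⊕ bt) ⊕ ((tb ⊕ bb) ⊕ bb)) ⊕ ((tb ⊕ bb) ⊕ bb))
           refl (t * t) (t * b) (b * t) (b * b) ⟩
    ((t * t + b * t + b * t) + (t * b + b * b + b * b)) + (t * b + b * b + b * b)
      ≈⟨ +-cong (+-cong (x+b+b t) (x+b+b b)) (x+b+b b) ⟨
    ((t + b) + b) * t + ((t + b) + b) * b + ((t + b) + b) * b
      ≈⟨ trans (distribˡ _ (t + b) b) (+-congʳ (distribˡ _ t b)) ⟨
    ((t + b) + b) * ((t + b) + b) ∎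
    where
    expand : (t + b) * b + b * (t + b) ≈ (t * b + b * b) + (b * t + b * b)
    expand = +-cong (distribʳ b t b) (distribˡ b t b)

    x+b+b : ∀ y → ((t + b) + b) * y ≈ t * y + b * y + b * y
    x+b+b y = trans (distribʳ y (t + b) b) (+-congʳ (distribʳ y t b))

-- Power series in a - b

module TwoVariables {ρ ℓ} (R : CommutativeRing ρ ℓ) where

  open CommutativeRing R hiding (zero)
  open PowerSeries R
  open Series R
  open Limits R
  open Substitution R
  open RawSemiring (Semiring.rawSemiring semiring) using (_^_)
  open import Relation.Binary.Reasoning.Setoid setoid
  private module S {k} = Ring (seriesRing k)

  a b c d t : Series 2
  a = var 0F
  b = var 1F
  c = a +ˢ b
  d = a *ˢ b +ˢ b *ˢ a
  t = a -ˢ b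

  a≈t+b : a ≈ˢ t +ˢ b
  a≈t+b w = sym (trans (+-assoc (a w) (- b w) (b w))
    (trans (+-congˡ (-‿inverseˡ (b w))) (+-identityʳ (a w))))

  t₀ : Proper t
  t₀ = Proper-minus a b refl refl

  τ₀ : ∀ i → Proper (lookup (t ∷ []) i)
  τ₀ 0F = t₀

  -- The left quotient of `t = a - b` by the letter a is 1, so the coefficient of `f` at `w` is that
  -- of `t *ˢ f` at `0F ∷ w`.
  t-cancelˡ : ∀ f g → t *ˢ f ≈ˢ t *ˢ g → f ≈ˢ g
  t-cancelˡ f g tf≈tg w = trans (sym (t* f)) (trans (tf≈tg (0F ∷ w)) (t* g))
    where
    ∂t≈1 : ∂ 0F t ≈ˢ 1ˢ
    ∂t≈1 []      = trans (+-congˡ (RingProperties.-0#≈0# ring)) (+-identityʳ 1#)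
    ∂t≈1 (_ ∷ _) = -‿inverseʳ 0#

    t* : ∀ f → (t *ˢ f) (0F ∷ w) ≈ f w
    t* f = begin
      (t *ˢ f) (0F ∷ w)                    ≡⟨ *ˢ-∷ t f 0F w ⟩
      t [] * f (0F ∷ w) + (∂ 0F t *ˢ f) w  ≈⟨ +-cong (trans (*-congʳ t₀) (zeroˡ _))
                                                (trans (*ˢ-cong ∂t≈1 (≈ˢ-refl {f = f}) w) (*ˢ-identityˡ f w)) ⟩
      0# + f w                             ≈⟨ +-identityˡ _ ⟩
      f w                                  ∎

  -- The series `Σ x k t^k`. Words over `Fin 1` are natural numbers, so it is a substitution into a
  -- one-variable series, and linearity and multiplicativity come from the laws of substitution.
  pow : (ℕ → Carrier) → Series 2
  pow x = (x ∘ length) ⟪ t ∷ [] ⟫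

  pow-cong : ∀ {x y} → (∀ k → x k ≈ y k) → pow x ≈ˢ pow y
  pow-cong {x} {y} x≈y = ⟪⟫-cong (t ∷ []) τ₀ {x ∘ length} {y ∘ length} (λ w → x≈y (length w))

  pow-unfold : ∀ x → pow x ≈ˢ const (x 0) +ˢ t *ˢ pow (x ∘ suc)
  pow-unfold x w = trans (⟪⟫-unfold (t ∷ []) τ₀ (x ∘ length) w) (+-congˡ (+-identityʳ _))

  pow-· : ∀ z x → pow (λ k → z * x k) ≈ˢ z · pow x
  pow-· z x = ⟪⟫-· (t ∷ []) τ₀ z (x ∘ length)

  conv : (ℕ → Carrier) → (ℕ → Carrier) → ℕ → Carrier
  conv x y m = ∑ (upTo (suc m)) λ k → x k * y (m ℕ.∸ k)

  conv-* : ∀ x y → (x ∘ length) *ˢ (y ∘ length) ≈ˢ conv x y ∘ length {A = Fin 1}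
  conv-* x y []      = refl
  conv-* x y (i ∷ w) = begin
    ((x ∘ length) *ˢ (y ∘ length)) (i ∷ w)
      ≡⟨ *ˢ-∷ (x ∘ length) (y ∘ length) i w ⟩
    x 0 * y (suc (length w)) + ((x ∘ suc ∘ length) *ˢ (y ∘ length)) w
      ≈⟨ +-congˡ (conv-* (x ∘ suc) y w) ⟩
    x 0 * y (suc (length w)) + conv (x ∘ suc) y (length w)
      ≡⟨ ∑-upTo-suc (suc (length w)) (λ k → x k * y (suc (length w) ℕ.∸ k)) ⟨
    conv x y (suc (length w)) ∎

  pow-* : ∀ x y → pow x *ˢ pow y ≈ˢ pow (conv x y)
  pow-* x y = S.trans (S.sym {x = ((x ∘ length) *ˢ (y ∘ length)) ⟪ t ∷ [] ⟫} {pow x *ˢ pow y}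
    (⟪⟫-* (t ∷ []) τ₀ (x ∘ length) (y ∘ length)))
    (⟪⟫-cong (t ∷ []) τ₀ {(x ∘ length) *ˢ (y ∘ length)} {conv x y ∘ length} (conv-* x y))

  pow-t : ∀ x → pow x *ˢ t ≈ˢ t *ˢ pow x
  pow-t x = ≈[]⇒≈ {f = pow x *ˢ t} {t *ˢ pow x} (λ n → go n x)
    where
    go : ∀ n x → pow x *ˢ t ≈[ n ] t *ˢ pow x
    go (suc n) x w w< = begin
      (pow x *ˢ t) w
        ≈⟨ *ˢ-cong (pow-unfold x) (≈ˢ-refl {f = t}) w ⟩
      ((const (x 0) +ˢ t *ˢ pow (x ∘ suc)) *ˢ t) w
        ≈⟨ *ˢ-distribʳ t (const (x 0)) (t *ˢ pow (x ∘ suc)) w ⟩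
      (const (x 0) *ˢ t) w + ((t *ˢ pow (x ∘ suc)) *ˢ t) w
        ≈⟨ +-cong (const-comm (x 0) t w) (trans (*ˢ-assoc t (pow (x ∘ suc)) t w)
             (contract n t _ _ t₀ (go n (x ∘ suc)) w w<)) ⟩
      (t *ˢ const (x 0)) w + (t *ˢ (t *ˢ pow (x ∘ suc))) w
        ≈⟨ *ˢ-distribˡ t (const (x 0)) (t *ˢ pow (x ∘ suc)) w ⟨
      (t *ˢ (const (x 0) +ˢ t *ˢ pow (x ∘ suc))) w
        ≈⟨ *ˢ-cong (≈ˢ-refl {f = t}) (pow-unfold x) w ⟨
      (t *ˢ pow x) w ∎

  -- The series of a sequence splits into an even and an odd part; ε = ±1.
  pow-parity : ∀ ε → ε * ε ≈ 1# → (x : ℕ → Carrier) (H : ℕ → Series 2) →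
    (∀ r → H r ≈ˢ const (x r) +ˢ (t *ˢ t) *ˢ H (2 ℕ.+ r)) →
    ∀ r → pow (λ k → ε ^ k * x (k ℕ.+ r)) ≈ˢ H r +ˢ ε · (t *ˢ H (suc r))
  pow-parity ε ε²≈1 x H H≈ r = ≈[]⇒≈ {f = G r} {H r +ˢ ε · (t *ˢ H (suc r))} (λ n → go n r)
    where
    G : ℕ → Series 2
    G r = pow (λ k → ε ^ k * x (k ℕ.+ r))

    shift : ∀ r → pow (λ k → ε ^ suc k * x (suc k ℕ.+ r)) ≈ˢ ε · G (suc r)
    shift r w = trans (pow-cong {λ k → ε ^ suc k * x (suc k ℕ.+ r)} {λ k → ε * (ε ^ k * x (k ℕ.+ suc r))}
        (λ k → trans (*-assoc _ _ _) (*-congˡ (*-congˡ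
          (reflexive (≡.cong x (≡.sym (ℕ.+-suc k r))))))) w)
      (pow-· ε (λ k → ε ^ k * x (k ℕ.+ suc r)) w)

    -- All shifts `r` are treated together: `H r` is `Σ x (r + 2k) t^(2k)`, and multiplying the
    -- claim at `suc r` by `ε t` exchanges the two parts. The square of `ε t` is `t²`, which the
    -- recursion of `H` folds back into `H r`.
    go : ∀ n r → G r ≈[ n ] H r +ˢ ε · (t *ˢ H (suc r))
    go (suc n) r w w< = begin
      G r w
        ≈⟨ pow-unfold (λ k → ε ^ k * x (k ℕ.+ r)) w ⟩
      1# * x r * 1ˢ w + (t *ˢ pow (λ k → ε ^ suc k * x (suc k ℕ.+ r))) w
        ≈⟨ +-cong (*-congʳ (*-identityˡ _)) (begin
          (t *ˢ pow (λ k → ε ^ suc k * x (suc k ℕ.+ r))) w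
            ≈⟨ *ˢ-cong (≈ˢ-refl {f = t}) (shift r) w ⟩
          (t *ˢ (ε · G (suc r))) w
            ≈⟨ *ˢ-· ε t (G (suc r)) w ⟩
          ε * (t *ˢ G (suc r)) w
            ≈⟨ *-congˡ (contract n t (G (suc r)) _ t₀ (go n (suc r)) w w<) ⟩
          ε * (t *ˢ (H (suc r) +ˢ ε · (t *ˢ H (2 ℕ.+ r)))) w
            ≈⟨ *-congˡ (trans (*ˢ-distribˡ t (H (suc r)) (ε · (t *ˢ H (2 ℕ.+ r))) w)
                 (+-congˡ (*ˢ-· ε t (t *ˢ H (2 ℕ.+ r)) w))) ⟩
          ε * ((t *ˢ H (suc r)) w + ε * (t *ˢ (t *ˢ H (2 ℕ.+ r))) w)
            ≈⟨ trans (distribˡ ε _ _) (+-congˡ (trans (sym (*-assoc ε ε _))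
                 (trans (*-congʳ ε²≈1) (*-identityˡ _)))) ⟩
          ε * (t *ˢ H (suc r)) w + (t *ˢ (t *ˢ H (2 ℕ.+ r))) w
            ≈⟨ +-comm _ _ ⟩
          (t *ˢ (t *ˢ H (2 ℕ.+ r))) w + ε * (t *ˢ H (suc r)) w ∎) ⟩
      const (x r) w + ((t *ˢ (t *ˢ H (2 ℕ.+ r))) w + ε * (t *ˢ H (suc r)) w)
        ≈⟨ +-assoc _ _ _ ⟨
      const (x r) w + (t *ˢ (t *ˢ H (2 ℕ.+ r))) w + ε * (t *ˢ H (suc r)) w
        ≈⟨ +-congʳ (trans (H≈ r w) (+-congˡ (*ˢ-assoc t t (H (2 ℕ.+ r)) w))) ⟨
      H r w + ε * (t *ˢ H (suc r)) w ∎

-- The linear system in c and d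

module CDSeries {ρ ℓ} (R : CommutativeRing ρ ℓ)
  (1≉0 : ¬ (CommutativeRing._≈_ R (CommutativeRing.1# R) (CommutativeRing.0# R)))
  (½ : CommutativeRing.Carrier R)
  (½+½≈1 : CommutativeRing._≈_ R (CommutativeRing._+_ R ½ ½) (CommutativeRing.1# R))
  (n : ℕ) where

  private
    module R where
      open CommutativeRing R public
      open SetoidReasoning setoid public
  open PowerSeries R
  open Series R
  open Limits R
  open Substitution R
  open TwoVariables R
  open LinearSystems R 1≉0 2
  open RawSemiring (Semiring.rawSemiring R.semiring) using (_^_)
  open Ring (seriesRing 2) hiding (zero)
  open Sum semiring
  open Kronecker semiring
  open Matrices (seriesRing 2) n
  open RingIdentities matrixRing
  private
    module M = Ring matrixRing
    module Rδ = Kronecker R.semiring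
    module RS = Sum R.semiring
  open import Relation.Binary.Reasoning.Setoid setoid

  halves : ∀ f → const ½ * f + const ½ * f ≈ f
  halves f w = R.trans (R.+-cong (half w) (half w)) (R.trans (R.sym (R.distribʳ (f w) ½ ½))
    (R.trans (R.*-congʳ ½+½≈1) (R.*-identityˡ (f w))))
    where
    half : const ½ * f ≈ ½ · f
    half w = R.trans (·-*ˢ ½ 1ˢ f w) (R.*-congˡ (*ˢ-identityˡ f w))

  -- Here `1 + q⁻` is `2 + N` with `N` proper. If `A` and `B` agree below degree `m`, then `N A` and
  -- `N B` agree one degree further, hence so do `2A` and `2B`, and `½` removes the factor 2.
  cancel-1+q⁻ : ∀ (q⁻ A B : Mat) N → (∀ i j → Proper (N i j)) → q⁻ M.≈ M.1# M.+ N →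
                A M.+ q⁻ M.* A M.≈ B M.+ q⁻ M.* B → A M.≈ B
  cancel-1+q⁻ q⁻ A B N N₀ q⁻≈1+N eq i j = ≈[]⇒≈ {f = A i j} {B i j} (λ m → go m i j)
    where
    twice : ∀ X → X M.+ q⁻ M.* X M.≈ (X M.+ X) M.+ N M.* X
    twice X = M.trans (M.+-congˡ {X} (M.trans (M.*-congʳ {X} q⁻≈1+N)
      (M.trans (M.distribʳ X M.1# N) (M.+-congʳ {N M.* X} (M.*-identityˡ X)))))
      (M.sym {_} {X M.+ (X M.+ N M.* X)} (M.+-assoc X X (N M.* X)))

    eq′ : (A M.+ A) M.+ N M.* A M.≈ (B M.+ B) M.+ N M.* B
    eq′ = M.trans (M.sym {A M.+ q⁻ M.* A} (twice A)) (M.trans eq (twice B))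

    go : ∀ m i j → A i j ≈[ m ] B i j
    go (suc m) i j w w< = R.begin
      A i j w                                    R.≈⟨ double (A i j w) ⟨
      ½ R.* (A i j w R.+ A i j w)                R.≈⟨ R.*-congˡ (+-cancelʳ ((N M.* B) i j w) _ _ (
        R.trans (R.+-congˡ (R.sym NA≈NB)) (eq′ i j w))) ⟩
      ½ R.* (B i j w R.+ B i j w)                R.≈⟨ double (B i j w) ⟩
      B i j w                                    R.∎
      where
      open RingProperties R.ring using (+-cancelʳ)

      double : ∀ x → ½ R.* (x R.+ x) R.≈ x
      double x = R.trans (R.distribˡ ½ x x) (R.trans (R.sym (R.distribʳ x ½ ½))
        (R.trans (R.*-congʳ ½+½≈1) (R.*-identityˡ x)))

      NA≈NB : (N M.* A) i j w R.≈ (N M.* B) i j w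
      NA≈NB = R.trans (R.reflexive (sum-at (λ k → N i k * A k j) w)) (R.trans
        (RS.sum-cong-≋ {n} λ k → contract m (N i k) (A k j) (B k j) (N₀ i k) (go m k j) w w<)
        (R.reflexive (≡.sym (sum-at (λ k → N i k * B k j) w))))

  module _ (Q : ℕ → Fin n → Fin n → R.Carrier) (Q₀ : ∀ i j → Q 0 i j R.≈ Rδ.δ i j) where

    -- The coefficient of degree `suc m` in `Q(-t) Q(t)` vanishes. Degree 0 is settled by `Q₀`.
    Euler : Set ℓ
    Euler = ∀ m i j → RS.sum (λ k →
      ∑ (upTo (2 ℕ.+ m)) (λ r → (R.- R.1#) ^ r R.* Q r i k R.* Q (suc m ℕ.∸ r) k j)) R.≈ R.0#

    K : Mat
    K i j = pow (λ r → Q (suc r) i j)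

    private
      q q⁻ : Mat
      q i j = pow (λ r → Q r i j)
      q⁻ i j = pow (λ r → (R.- R.1#) ^ r R.* Q r i j)

      const-Q₀ : ∀ i j → const (Q 0 i j) ≈ δ i j
      const-Q₀ i j w with i Fin.≟ j | Q₀ i j
      ... | yes _ | eq = R.trans (R.*-congʳ eq) (R.*-identityˡ _)
      ... | no  _ | eq = R.trans (R.*-congʳ eq) (R.zeroˡ _)

    pow-sum : ∀ {m} (x : Fin m → ℕ → R.Carrier) → sum (λ k → pow (x k)) ≈ pow (λ r → RS.sum (λ k → x k r))
    pow-sum {zero}  x w = R.sym (∑-zero (tuples≤ (allFin 1) (length w)) λ _ → R.zeroˡ _)
    pow-sum {suc m} x = trans (+-congˡ {pow (x zero)} (pow-sum (x ∘ suc)))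
      (λ w → R.sym (⟪⟫-+ (t ∷ []) τ₀ (x zero ∘ length) (λ v → RS.sum (λ k → x (suc k) (length v))) w))

    q⁻*q≈1 : Euler → q⁻ M.* q M.≈ M.1#
    q⁻*q≈1 euler i j = begin
      sum (λ k → q⁻ i k * q k j)
        ≈⟨ sum-cong-≋ {n} (λ k → pow-* (λ r → (R.- R.1#) ^ r R.* Q r i k) (λ r → Q r k j)) ⟩
      sum (λ k → pow (z k))
        ≈⟨ pow-sum z ⟩
      pow (λ r → RS.sum (λ k → z k r))
        ≈⟨ ⟪⟫-cong (t ∷ []) τ₀ {λ w → RS.sum (λ k → z k (length w))} {const (Q 0 i j)}
             (λ { [] → R.trans z₀ (R.sym (R.*-identityʳ _))
                ; (_ ∷ w) → R.trans (euler (length w) i j) (R.sym (R.zeroʳ _)) }) ⟩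
      const (Q 0 i j) ⟪ t ∷ [] ⟫
        ≈⟨ (λ w → R.trans (⟪⟫-· (t ∷ []) τ₀ (Q 0 i j) 1ˢ w) (R.*-congˡ (⟪⟫-1 (t ∷ []) τ₀ w))) ⟩
      const (Q 0 i j)
        ≈⟨ const-Q₀ i j ⟩
      δ i j ∎
      where
      z : Fin n → ℕ → R.Carrier
      z k = conv (λ r → (R.- R.1#) ^ r R.* Q r i k) (λ r → Q r k j)

      z₀ : RS.sum (λ k → z k 0) R.≈ Q 0 i j
      z₀ = R.trans (RS.sum-cong-≋ {n} λ k → R.trans (R.+-identityʳ _) (R.*-congʳ
        (R.trans (R.*-identityˡ _) (Q₀ i k)))) (Rδ.sum-δˡ i (λ k → Q 0 k j))

    -- E(t²) and O(t²) are the even and odd parts of K(t); the system below is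
    -- (2 + t²O) X = 2E + E c X.
    module _ (H : ℕ → Mat)
             (H≈ : ∀ r i j → H r i j ≈ const (Q r i j) + t * t * H (2 ℕ.+ r) i j)
             (euler : Euler) (X : Mat)
             (X≈ : ∀ i j → X i j + X i j + sum (λ k → t * t * H 2 i k * X k j)
                           ≈ H 1 i j + H 1 i j + sum (λ k → H 1 i k * c * X k j)) where

      private
        E T B C P : Mat
        E = H 1
        T = diag t
        B = diag b
        C = diag c
        P i j = t * t * H 2 i j

        q≈′ : ∀ i j → q i j ≈ H 0 i j + t * H 1 i j
        q≈′ i j = begin
          q i j
            ≈⟨ pow-cong (λ k → R.trans (R.sym (R.trans (R.*-congʳ (1^ k)) (R.*-identityˡ _)))
                 (R.*-congˡ (R.reflexive (≡.cong (λ r → Q r i j) (≡.sym (ℕ.+-identityʳ k)))))) ⟩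
          pow (λ k → R.1# ^ k R.* Q (k ℕ.+ 0) i j)
            ≈⟨ pow-parity R.1# (R.*-identityˡ R.1#) (λ r → Q r i j) (λ r → H r i j) (λ r → H≈ r i j) 0 ⟩
          H 0 i j + R.1# · (t * H 1 i j)
            ≈⟨ +-congˡ {H 0 i j} (λ w → R.*-identityˡ _) ⟩
          H 0 i j + t * H 1 i j ∎
          where
          1^ : ∀ k → R.1# ^ k R.≈ R.1#
          1^ zero    = R.refl
          1^ (suc k) = R.trans (R.*-identityˡ _) (1^ k)

        q⁻≈′ : ∀ i j → q⁻ i j ≈ H 0 i j - t * H 1 i j
        q⁻≈′ i j = begin
          q⁻ i j
            ≈⟨ pow-cong (λ k → R.*-congˡ {(R.- R.1#) ^ k} (R.reflexive (≡.cong (λ r → Q r i j) (≡.sym (ℕ.+-identityʳ k))))) ⟩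
          pow (λ k → (R.- R.1#) ^ k R.* Q (k ℕ.+ 0) i j)
            ≈⟨ pow-parity (R.- R.1#) (R.trans (-1*x≈-x (R.- R.1#)) (-‿involutive R.1#))
                 (λ r → Q r i j) (λ r → H r i j) (λ r → H≈ r i j) 0 ⟩
          H 0 i j + (R.- R.1#) · (t * H 1 i j)
            ≈⟨ +-congˡ {H 0 i j} (λ w → -1*x≈-x _) ⟩
          H 0 i j - t * H 1 i j ∎
          where
          open RingProperties R.ring using (-1*x≈-x; -‿involutive)

        H₀≈ : ∀ i j → H 0 i j ≈ δ i j + P i j
        H₀≈ i j = trans (H≈ 0 i j) (+-congʳ {P i j} (const-Q₀ i j))

        q⁻+TE≈1+P : q⁻ M.+ T M.* E M.≈ M.1# M.+ P
        q⁻+TE≈1+P i j = begin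
          q⁻ i j + (T M.* E) i j                 ≈⟨ +-cong (q⁻≈′ i j) (diag-* t E i j) ⟩
          H 0 i j - t * E i j + t * E i j        ≈⟨ +-assoc (H 0 i j) (- (t * E i j)) (t * E i j) ⟩
          H 0 i j + (- (t * E i j) + t * E i j)  ≈⟨ +-congˡ {H 0 i j} (-‿inverseˡ (t * E i j)) ⟩
          H 0 i j + 0#                           ≈⟨ +-identityʳ (H 0 i j) ⟩
          H 0 i j                                ≈⟨ H₀≈ i j ⟩
          δ i j + P i j                          ∎

        q≈q⁻+2TE : q M.≈ q⁻ M.+ (T M.* E M.+ T M.* E)
        q≈q⁻+2TE i j = begin
          q i j                                   ≈⟨ q≈′ i j ⟩
          H 0 i j + t * E i j                     ≈⟨ +-cong (H₀≈ i j) (sym {(T M.* E) i j} (diag-* t E i j)) ⟩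
          δ i j + P i j + (T M.* E) i j           ≈⟨ +-congʳ {(T M.* E) i j} (q⁻+TE≈1+P i j) ⟨
          q⁻ i j + (T M.* E) i j + (T M.* E) i j  ≈⟨ +-assoc (q⁻ i j) ((T M.* E) i j) ((T M.* E) i j) ⟩
          q⁻ i j + ((T M.* E) i j + (T M.* E) i j) ∎

        q≈1+TK : q M.≈ M.1# M.+ T M.* K
        q≈1+TK i j = trans (pow-unfold (λ r → Q r i j))
          (+-cong (const-Q₀ i j) (sym {(T M.* K) i j} (diag-* t K i j)))

        q⁻T≈Tq⁻ : q⁻ M.* T M.≈ T M.* q⁻
        q⁻T≈Tq⁻ i j = begin
          (q⁻ M.* T) i j  ≈⟨ *-diag t q⁻ i j ⟩
          q⁻ i j * t      ≈⟨ pow-t (λ r → (R.- R.1#) ^ r R.* Q r i j) ⟩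
          t * q⁻ i j      ≈⟨ diag-* t q⁻ i j ⟨
          (T M.* q⁻) i j  ∎

        -- `H` is known only through its recursion, which expresses it by constants and powers of
        -- `t²`; the commutation with `t` is therefore proved to increasing precision, for all
        -- shifts `r` at once.
        H-t : ∀ m r i j → H r i j * t ≈[ m ] t * H r i j
        H-t (suc m) r i j w w< = R.begin
          (H r i j * t) w
            R.≈⟨ *-congʳ {t} (H≈ r i j) w ⟩
          ((const x + t * t * H′) * t) w
            R.≈⟨ distribʳ t (const x) (t * t * H′) w ⟩
          (const x * t) w R.+ (t * t * H′ * t) w
            R.≈⟨ R.+-cong (const-comm x t w) (R.trans (*-congʳ {t} (*-assoc t t H′) w) (R.trans (*-assoc t (t * H′) t w)
                  (contract m t (t * H′ * t) (t * (t * H′)) t₀ (λ v v< → R.trans (*-assoc t H′ t v)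
                    (*-congˡ[] m t (H′ * t) (t * H′) (H-t m (2 ℕ.+ r) i j) v v<)) w w<))) ⟩
          (t * const x) w R.+ (t * (t * (t * H′))) w
            R.≈⟨ distribˡ t (const x) (t * (t * H′)) w ⟨
          (t * (const x + t * (t * H′))) w
            R.≈⟨ *-congˡ {t} (trans (H≈ r i j) (+-congˡ {const x} (*-assoc t t H′))) w ⟨
          (t * H r i j) w R.∎
          where
          x : R.Carrier
          x = Q r i j

          H′ : Series 2
          H′ = H (2 ℕ.+ r) i j

        ET≈TE : E M.* T M.≈ T M.* E
        ET≈TE i j = begin
          (E M.* T) i j  ≈⟨ *-diag t E i j ⟩
          E i j * t      ≈⟨ ≈[]⇒≈ {f = E i j * t} {t * E i j} (λ m → H-t m 1 i j) ⟩
          t * E i j      ≈⟨ diag-* t E i j ⟨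
          (T M.* E) i j  ∎

        c≈t+2b : c ≈ t + (b + b)
        c≈t+2b = begin
          a + b        ≈⟨ +-congʳ {b} a≈t+b ⟩
          t + b + b    ≈⟨ +-assoc t b b ⟩
          t + (b + b)  ∎

        C≈T+2B : C M.≈ T M.+ (B M.+ B)
        C≈T+2B i j = begin
          c * δ i j                        ≈⟨ *-congʳ {δ i j} c≈t+2b ⟩
          (t + (b + b)) * δ i j            ≈⟨ distribʳ (δ i j) t (b + b) ⟩
          t * δ i j + (b + b) * δ i j      ≈⟨ +-congˡ {t * δ i j} (distribʳ (δ i j) b b) ⟩
          t * δ i j + (b * δ i j + b * δ i j) ∎

        X≈′ : X M.+ X M.+ P M.* X M.≈ E M.+ E M.+ E M.* C M.* X
        X≈′ i j = trans (X≈ i j) (+-congˡ {E i j + E i j}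
          (sum-cong-≋ {n} λ k → *-congʳ {X k j} (sym {(E M.* C) i k} (*-diag c E i k))))

        -- Since `T K = q - 1` and `q - q⁻ = 2 T E`, the identity `q⁻ q = 1` gives this equation
        -- multiplied by `t` on the left, and `t` cancels entry by entry.
        [1+q⁻]K≈2E : K M.+ q⁻ M.* K M.≈ E M.+ E
        [1+q⁻]K≈2E i j = t-cancelˡ ((K M.+ q⁻ M.* K) i j) (E i j + E i j) (begin
          t * (K M.+ q⁻ M.* K) i j      ≈⟨ diag-* t (K M.+ q⁻ M.* K) i j ⟨
          (T M.* (K M.+ q⁻ M.* K)) i j  ≈⟨ [1+q⁻]K {T} {K} {E} {q} {q⁻} q≈1+TK q≈q⁻+2TE (q⁻*q≈1 euler) q⁻T≈Tq⁻ i j ⟩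
          (T M.* (E M.+ E)) i j         ≈⟨ diag-* t (E M.+ E) i j ⟩
          t * (E i j + E i j)           ∎)

        N : Mat
        N i j = P i j - t * E i j

        q⁻≈1+N : q⁻ M.≈ M.1# M.+ N
        q⁻≈1+N i j = begin
          q⁻ i j                             ≈⟨ q⁻≈′ i j ⟩
          H 0 i j - t * E i j                ≈⟨ +-congʳ { - (t * E i j)} (H₀≈ i j) ⟩
          δ i j + P i j - t * E i j          ≈⟨ +-assoc (δ i j) (P i j) (- (t * E i j)) ⟩
          δ i j + (P i j - t * E i j)        ∎

        N₀ : ∀ i j → Proper (N i j)
        N₀ i j = Proper-minus (P i j) (t * E i j)
          (Proper-* (t * t) (H 2 i j) (Proper-* t t t₀)) (Proper-* t (E i j) t₀)

      X≈K+KbX : ∀ i j → X i j ≈ K i j + sum (λ k → K i k * (b * X k j))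
      X≈K+KbX i j = trans (cancel-1+q⁻ q⁻ X (K M.+ K M.* (B M.* X)) N N₀ q⁻≈1+N
        ([1+q⁻]X≈[1+q⁻]KY {K} {E} {q⁻} {X} {B M.* X} [1+q⁻]K≈2E
          ([1+q⁻]X {T} {B} {C} {P} {E} {q⁻} {X} q⁻+TE≈1+P C≈T+2B ET≈TE X≈′)) i j)
        (+-congˡ {K i j} (sum-cong-≋ {n} λ k → *-congˡ {K i k} (diag-* b X k j)))

-- Rational solution in free variables and its value at c and d

module CDRational {ρ ℓ} (R : CommutativeRing ρ ℓ)
  (1≉0 : ¬ (CommutativeRing._≈_ R (CommutativeRing.1# R) (CommutativeRing.0# R)))
  (½ : CommutativeRing.Carrier R)
  (½+½≈1 : CommutativeRing._≈_ R (CommutativeRing._+_ R ½ ½) (CommutativeRing.1# R))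
  (n : ℕ) where

  private module R = CommutativeRing R
  open PowerSeries R
  open Series R
  open Limits R
  open Substitution R
  open TwoVariables R
  open LinearSystems R 1≉0 2
  open CDSeries R 1≉0 ½ ½+½≈1 n
  open Ring (seriesRing 2) hiding (zero)
  open Sum semiring
  open Matrices (seriesRing 2) n using (Mat)
  open RingIdentities (seriesRing 2) using (square)
  open import Relation.Binary.Reasoning.Setoid setoid
  private module Rδ = Kronecker R.semiring

  σ : Vec (Series 2) 2
  σ = c ∷ d ∷ []

  σ₀ : ∀ i → Proper (lookup σ i)
  σ₀ 0F = R.+-identityˡ _
  σ₀ 1F = Proper-+ (a * b) (b * a) (Proper-* a b R.refl) (Proper-* b a R.refl)

  ⟪⟫-neg : ∀ Φ → (- Φ) ⟪ σ ⟫ ≈ - Φ ⟪ σ ⟫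
  ⟪⟫-neg Φ w = R.trans (⟪⟫-cong σ σ₀ { - Φ} {(R.- R.1#) · Φ} (λ v → R.sym (-1*x≈-x (Φ v))) w)
    (R.trans (⟪⟫-· σ σ₀ (R.- R.1#) Φ w) (-1*x≈-x _))
    where open RingProperties R.ring using (-1*x≈-x)

  ⟪⟫-sum : ∀ {m} (f : Fin m → Series 2) → sum f ⟪ σ ⟫ ≈ sum (λ i → f i ⟪ σ ⟫)
  ⟪⟫-sum {zero}  f w = ∑-zero (tuples≤ (allFin 2) (length w)) λ _ → R.zeroˡ _
  ⟪⟫-sum {suc m} f   = trans (⟪⟫-+ σ σ₀ (f zero) (sum (f ∘ suc)))
    (+-congˡ {f zero ⟪ σ ⟫} (⟪⟫-sum (f ∘ suc)))

  private
    C D s : Series 2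
    C = var 0F
    D = var 1F
    s = C * C - (D + D)

    s₀ : Proper s
    s₀ = Proper-minus (C * C) (D + D) (Proper-* C C R.refl) (R.+-identityˡ _)

    rational-s : Rational s
    rational-s = plus (times (rational-var 0F) (rational-var 0F))
      (rational-neg (plus (rational-var 1F) (rational-var 1F)))

    ⟪s⟫ : s ⟪ σ ⟫ ≈ t * t
    ⟪s⟫ = begin
      s ⟪ σ ⟫                                      ≈⟨ ⟪⟫-+ σ σ₀ (C * C) (- (D + D)) ⟩
      (C * C) ⟪ σ ⟫ + (- (D + D)) ⟪ σ ⟫            ≈⟨ +-cong (⟪⟫-* σ σ₀ C C)
                                                        (trans (⟪⟫-neg (D + D)) (-‿cong (⟪⟫-+ σ σ₀ D D))) ⟩
      C ⟪ σ ⟫ * C ⟪ σ ⟫ - (D ⟪ σ ⟫ + D ⟪ σ ⟫)      ≈⟨ +-cong (*-cong (⟪⟫-var σ σ₀ 0F) (⟪⟫-var σ σ₀ 0F))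
                                                        (-‿cong (+-cong (⟪⟫-var σ σ₀ 1F) (⟪⟫-var σ σ₀ 1F))) ⟩
      c * c - (d + d)                              ≈⟨ +-congʳ { - (d + d)} c*c≈ ⟩
      t * t + (d + d) - (d + d)                    ≈⟨ +-assoc (t * t) (d + d) (- (d + d)) ⟩
      t * t + (d + d - (d + d))                    ≈⟨ +-congˡ {t * t} (-‿inverseʳ (d + d)) ⟩
      t * t + 0#                                   ≈⟨ +-identityʳ (t * t) ⟩
      t * t                                        ∎
      where
      c≈ : c ≈ t + b + b
      c≈ = +-congʳ {b} a≈t+b

      d≈ : d ≈ (t + b) * b + b * (t + b)
      d≈ = +-cong (*-congʳ {b} a≈t+b) (*-congˡ {b} a≈t+b)

      c*c≈ : c * c ≈ t * t + (d + d)
      c*c≈ = begin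
        c * c                          ≈⟨ *-cong c≈ c≈ ⟩
        (t + b + b) * (t + b + b)      ≈⟨ square t b ⟨
        t * t + (((t + b) * b + b * (t + b)) + ((t + b) * b + b * (t + b)))
                                       ≈⟨ +-congˡ {t * t} (+-cong d≈ d≈) ⟨
        t * t + (d + d)                ∎

  -- The output of a finite automaton over a one-letter alphabet, that is, an eventually periodic
  -- sequence.
  record Automatic (x : ℕ → R.Carrier) : Set (ρ Level.⊔ ℓ) where
    field
      {size}     : ℕ
      next       : Fin size → Fin size
      out        : Fin size → R.Carrier
      state      : ℕ → Fin size
      state-next : ∀ r → state (suc r) ≡ next (state r)
      state-out  : ∀ r → out (state r) R.≈ x r

  module _ (Q : ℕ → Fin n → Fin n → R.Carrier) (Q₀ : ∀ i j → Q 0 i j R.≈ Rδ.δ i j)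
           (automatic : ∀ i j → Automatic (λ r → Q r i j)) (euler : Euler Q Q₀) where

    private
      module A i j = Automatic (automatic i j)

      run : ∀ i j → ∃ λ (F : Fin (A.size i j) → Series 2) → (∀ q → Rational (F q)) ×
            (∀ q → F q ≈ const (A.out i j q) + s * F (A.next i j (A.next i j q)))
      -- One factor `s` stands for `t²`, so it accounts for two steps of the automaton.
      run i j = automaton (A.next i j ∘ A.next i j) (A.out i j) s rational-s s₀

      H : ℕ → Mat
      H r i j = proj₁ (run i j) (A.state i j r)

      rational-H : ∀ r i j → Rational (H r i j)
      rational-H r i j = proj₁ (proj₂ (run i j)) (A.state i j r)

      H≈ : ∀ r i j → H r i j ≈ const (Q r i j) + s * H (2 ℕ.+ r) i j
      H≈ r i j = begin
        H r i j
          ≈⟨ proj₂ (proj₂ (run i j)) (A.state i j r) ⟩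
        const (A.out i j (A.state i j r)) + s * proj₁ (run i j) (A.next i j (A.next i j (A.state i j r)))
          ≈⟨ +-cong (λ w → R.*-congʳ (A.state-out i j r)) (*-congˡ {s} (reflexive
               (≡.cong (proj₁ (run i j)) (≡.sym (≡.trans (A.state-next i j (suc r))
                 (≡.cong (A.next i j) (A.state-next i j r))))))) ⟩
        const (Q r i j) + s * H (2 ℕ.+ r) i j ∎

      E N : Mat
      E = H 1
      N i k = E i k * C - s * H 2 i k

      -- Halving `(2 + s O) Φ = 2E + E C Φ` and moving `O`, which is `H 2`, to the right gives
      -- `Φ = E + ½ N Φ`, one system for each column `j`. Its matrix is proper because `C` and `s`
      -- are.
      solution : ∀ j → Solution (λ i → E i j) (λ i k → const ½ * N i k)
      solution j = solve-proper (λ i → E i j) (λ i k → const ½ * N i k)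
        (λ i → rational-H 1 i j)
        (λ i k → times (rational-const ½) (plus (times (rational-H 1 i k) (rational-var 0F))
          (rational-neg (times rational-s (rational-H 2 i k)))))
        (λ i k → R.trans (*ˢ-[] (const ½) (N i k)) (R.trans (R.*-congˡ
          (Proper-minus (E i k * C) (s * H 2 i k)
            (R.trans (*ˢ-[] (E i k) C) (R.zeroʳ _)) (Proper-* s (H 2 i k) s₀))) (R.zeroʳ _)))

    Φ : Mat
    Φ i j = proj₁ (solution j) i

    rational-Φ : ∀ i j → Rational (Φ i j)
    rational-Φ i j = proj₁ (proj₂ (solution j)) i

    private
      Φ≈ : ∀ i j → Φ i j + Φ i j + sum (λ k → s * H 2 i k * Φ k j)
                   ≈ E i j + E i j + sum (λ k → E i k * C * Φ k j)
      Φ≈ i j = begin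
        Φ i j + Φ i j + U                        ≈⟨ +-congʳ {U} (+-cong half half) ⟩
        E i j + const ½ * V + (E i j + const ½ * V) + U
                                                 ≈⟨ +-congʳ {U} (λ w → +-interchange _ _ _ _) ⟩
        E i j + E i j + (const ½ * V + const ½ * V) + U
                                                 ≈⟨ +-congʳ {U} (+-congˡ {E i j + E i j} (halves V)) ⟩
        E i j + E i j + V + U                    ≈⟨ +-assoc (E i j + E i j) V U ⟩
        E i j + E i j + (V + U)                  ≈⟨ +-congˡ {E i j + E i j} (∑-distrib-+ (λ k → N i k * Φ k j) (λ k → s * H 2 i k * Φ k j)) ⟨
        E i j + E i j + sum (λ k → N i k * Φ k j + s * H 2 i k * Φ k j)
          ≈⟨ +-congˡ {E i j + E i j} (sum-cong-≋ {n} λ k → begin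
            N i k * Φ k j + s * H 2 i k * Φ k j
              ≈⟨ distribʳ (Φ k j) (N i k) (s * H 2 i k) ⟨
            (E i k * C - s * H 2 i k + s * H 2 i k) * Φ k j
              ≈⟨ *-congʳ {Φ k j} (trans (+-assoc (E i k * C) (- (s * H 2 i k)) (s * H 2 i k))
                   (trans (+-congˡ {E i k * C} (-‿inverseˡ (s * H 2 i k))) (+-identityʳ (E i k * C)))) ⟩
            E i k * C * Φ k j ∎) ⟩
        E i j + E i j + sum (λ k → E i k * C * Φ k j) ∎
        where
        U V : Series 2
        U = sum λ k → s * H 2 i k * Φ k j
        V = sum λ k → N i k * Φ k j

        half : Φ i j ≈ E i j + const ½ * V
        half = begin
          Φ i j
            ≈⟨ proj₂ (proj₂ (solution j)) i ⟩
          E i j + sum (λ k → const ½ * N i k * Φ k j)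
            ≈⟨ +-congˡ {E i j} (trans (sum-cong-≋ {n} λ k → *-assoc (const ½) (N i k) (Φ k j))
                 (sym {const ½ * V} (*-distribˡ-sum (const ½) (λ k → N i k * Φ k j)))) ⟩
          E i j + const ½ * V ∎

      X : Mat
      X i j = Φ i j ⟪ σ ⟫

      H′ : ℕ → Mat
      H′ r i j = H r i j ⟪ σ ⟫

      H′≈ : ∀ r i j → H′ r i j ≈ const (Q r i j) + t * t * H′ (2 ℕ.+ r) i j
      H′≈ r i j = begin
        H r i j ⟪ σ ⟫
          ≈⟨ ⟪⟫-cong σ σ₀ (H≈ r i j) ⟩
        (const (Q r i j) + s * H (2 ℕ.+ r) i j) ⟪ σ ⟫
          ≈⟨ ⟪⟫-+ σ σ₀ (const (Q r i j)) (s * H (2 ℕ.+ r) i j) ⟩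
        const (Q r i j) ⟪ σ ⟫ + (s * H (2 ℕ.+ r) i j) ⟪ σ ⟫
          ≈⟨ +-cong (λ w → R.trans (⟪⟫-· σ σ₀ (Q r i j) 1# w) (R.*-congˡ (⟪⟫-1 σ σ₀ w)))
               (trans (⟪⟫-* σ σ₀ s (H (2 ℕ.+ r) i j)) (*-congʳ {H′ (2 ℕ.+ r) i j} ⟪s⟫)) ⟩
        const (Q r i j) + t * t * H′ (2 ℕ.+ r) i j ∎

      -- The two sides of the linear system have the same shape, so one rule carries both through
      -- the substitution.
      ⟪⟫-rhs : ∀ f A (B Y : Fin n → Series 2) (B′ : Fin n → Series 2) →
               (∀ k → B k ⟪ σ ⟫ ≈ B′ k) →
               (f + A + sum (λ k → B k * Y k)) ⟪ σ ⟫ ≈ f ⟪ σ ⟫ + A ⟪ σ ⟫ + sum (λ k → B′ k * Y k ⟪ σ ⟫)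
      ⟪⟫-rhs f A B Y B′ B≈ = begin
        (f + A + sum (λ k → B k * Y k)) ⟪ σ ⟫
          ≈⟨ ⟪⟫-+ σ σ₀ (f + A) (sum (λ k → B k * Y k)) ⟩
        (f + A) ⟪ σ ⟫ + sum (λ k → B k * Y k) ⟪ σ ⟫
          ≈⟨ +-cong (⟪⟫-+ σ σ₀ f A) (trans (⟪⟫-sum (λ k → B k * Y k))
               (sum-cong-≋ {n} λ k → trans (⟪⟫-* σ σ₀ (B k) (Y k)) (*-congʳ {Y k ⟪ σ ⟫} (B≈ k)))) ⟩
        f ⟪ σ ⟫ + A ⟪ σ ⟫ + sum (λ k → B′ k * Y k ⟪ σ ⟫) ∎

      X≈ : ∀ i j → X i j + X i j + sum (λ k → t * t * H′ 2 i k * X k j)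
                   ≈ H′ 1 i j + H′ 1 i j + sum (λ k → H′ 1 i k * c * X k j)
      X≈ i j = begin
        X i j + X i j + sum (λ k → t * t * H′ 2 i k * X k j)
          ≈⟨ ⟪⟫-rhs (Φ i j) (Φ i j) (λ k → s * H 2 i k) (λ k → Φ k j) (λ k → t * t * H′ 2 i k)
               (λ k → trans (⟪⟫-* σ σ₀ s (H 2 i k)) (*-congʳ {H′ 2 i k} ⟪s⟫)) ⟨
        (Φ i j + Φ i j + sum (λ k → s * H 2 i k * Φ k j)) ⟪ σ ⟫
          ≈⟨ ⟪⟫-cong σ σ₀ (Φ≈ i j) ⟩
        (E i j + E i j + sum (λ k → E i k * C * Φ k j)) ⟪ σ ⟫
          ≈⟨ ⟪⟫-rhs (E i j) (E i j) (λ k → E i k * C) (λ k → Φ k j) (λ k → H′ 1 i k * c)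
               (λ k → trans (⟪⟫-* σ σ₀ (E i k) C) (*-congˡ {H′ 1 i k} (⟪⟫-var σ σ₀ 0F))) ⟩
        H′ 1 i j + H′ 1 i j + sum (λ k → H′ 1 i k * c * X k j) ∎

    Φ⟪c,d⟫≈ : ∀ i j → Φ i j ⟪ σ ⟫ ≈ K Q Q₀ i j + sum (λ k → K Q Q₀ i k * (b * Φ k j ⟪ σ ⟫))
    Φ⟪c,d⟫≈ = X≈K+KbX Q Q₀ H′ H′≈ euler X X≈

-- Sums over chains

module Indicator {ρ ℓ} (R : CommutativeRing ρ ℓ) where

  open CommutativeRing R hiding (zero)
  open PowerSeries R
  open Series R

  𝟙 : Bool → Carrier
  𝟙 true  = 1#
  𝟙 false = 0#

  𝟙-∧ : ∀ x y → 𝟙 (x ∧ y) ≈ 𝟙 x * 𝟙 y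
  𝟙-∧ true  y = sym (*-identityˡ _)
  𝟙-∧ false y = sym (zeroˡ _)

  ∑-filter : ∀ {A : Set} {P : A → Set} (P? : Decidable P) xs f →
             ∑ (filter P? xs) f ≈ ∑ xs λ x → 𝟙 (does (P? x)) * f x
  ∑-filter P? []       f = refl
  ∑-filter P? (x ∷ xs) f with does (P? x)
  ... | true  = +-cong (sym (*-identityˡ _)) (∑-filter P? xs f)
  ... | false = trans (∑-filter P? xs f) (sym (trans (+-congʳ (zeroˡ _)) (+-identityˡ _)))

  -- This lets a sum over an interval be taken over the full grid of levels and vertices, where it
  -- splits level by level.
  ∑-filter-support : ∀ {A : Set} {P : A → Set} (P? : Decidable P) xs f →
                     (∀ x → ¬ P x → f x ≈ 0#) → ∑ (filter P? xs) f ≈ ∑ xs f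
  ∑-filter-support P? xs f f≈0 = trans (∑-filter P? xs f) (∑-cong xs go)
    where
    go : ∀ x → 𝟙 (does (P? x)) * f x ≈ f x
    go x with P? x
    ... | yes _ = *-identityˡ _
    ... | no ¬p = trans (zeroˡ _) (sym (f≈0 x ¬p))

  ∑-upTo-cong : ∀ n {f g : ℕ → Carrier} → (∀ k → k ℕ.< n → f k ≈ g k) → ∑ (upTo n) f ≈ ∑ (upTo n) g
  ∑-upTo-cong zero    f≈g = refl
  ∑-upTo-cong (suc n) {f} {g} f≈g = begin
    ∑ (upTo (suc n)) f         ≡⟨ ∑-upTo-suc n f ⟩
    f 0 + ∑ (upTo n) (f ∘ suc) ≈⟨ +-cong (f≈g 0 ℕ.z<s) (∑-upTo-cong n λ k k<n → f≈g (suc k) (s≤s k<n)) ⟩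
    g 0 + ∑ (upTo n) (g ∘ suc) ≡⟨ ∑-upTo-suc n g ⟨
    ∑ (upTo (suc n)) g         ∎
    where open import Relation.Binary.Reasoning.Setoid setoid

  ∑-upTo-drop : ∀ m n (f : ℕ → Carrier) → (∀ k → k ℕ.< m → f k ≈ 0#) →
                ∑ (upTo (m ℕ.+ n)) f ≈ ∑ (upTo n) (λ k → f (m ℕ.+ k))
  ∑-upTo-drop zero    n f f≈0 = refl
  ∑-upTo-drop (suc m) n f f≈0 = trans (reflexive (∑-upTo-suc (m ℕ.+ n) f))
    (trans (+-cong (f≈0 0 ℕ.z<s) (∑-upTo-drop m n (f ∘ suc) (λ k k<m → f≈0 (suc k) (s≤s k<m))))
      (+-identityˡ _))

-- Coefficients of products with homogeneous series

module Homogeneous {ρ ℓ} (R : CommutativeRing ρ ℓ) where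

  open CommutativeRing R hiding (zero)
  open PowerSeries R
  open Series R
  open TwoVariables R
  open import Relation.Binary.Reasoning.Setoid setoid

  -- Homogeneity of degree one, stated by left quotients: each of them is a constant.
  Linear : Series 2 → Set ℓ
  Linear u = u [] ≈ 0# × (∀ i → ∂ i u ≈ˢ const (u (i ∷ [])))

  linear-var : ∀ i → Linear (var i)
  linear-var i = refl , λ { j [] → sym (*-identityʳ _) ; j (_ ∷ _) → sym (zeroʳ _) }

  linear-t : Linear t
  linear-t = t₀ , λ { j [] → sym (*-identityʳ _) ; j (_ ∷ _) → trans (-‿inverseʳ 0#) (sym (zeroʳ _)) }

  module _ (u : Series 2) (linear : Linear u) where

    private
      u₀ : u [] ≈ 0#
      u₀ = proj₁ linear

      ∂u≈ : ∀ i → ∂ i u ≈ˢ const (u (i ∷ []))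
      ∂u≈ = proj₂ linear

    linear-[] : ∀ f → (u *ˢ f) [] ≈ 0#
    linear-[] f = trans (*ˢ-[] u f) (trans (*-congʳ u₀) (zeroˡ _))

    linear-∷ : ∀ f i w → (u *ˢ f) (i ∷ w) ≈ u (i ∷ []) * f w
    linear-∷ f i w = begin
      (u *ˢ f) (i ∷ w)                     ≡⟨ *ˢ-∷ u f i w ⟩
      u [] * f (i ∷ w) + (∂ i u *ˢ f) w    ≈⟨ +-cong (trans (*-congʳ u₀) (zeroˡ _))
                                                (*ˢ-cong (∂u≈ i) (≈ˢ-refl {f = f}) w) ⟩
      0# + (const (u (i ∷ [])) *ˢ f) w     ≈⟨ +-identityˡ _ ⟩
      (const (u (i ∷ [])) *ˢ f) w          ≈⟨ ·-*ˢ (u (i ∷ [])) 1ˢ f w ⟩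
      u (i ∷ []) * (1ˢ *ˢ f) w             ≈⟨ *-congˡ (*ˢ-identityˡ f w) ⟩
      u (i ∷ []) * f w                     ∎

    -- `u ^ˢ j` is homogeneous of degree `j`, so only the coefficients of the right factor in degree
    -- `length w - j` are read. The induction on chains relies on this, as it compares two series in
    -- a single degree.
    linear-^-local : ∀ j f g w → (∀ v → j ℕ.+ length v ≡ length w → f v ≈ g v) →
                     (u ^ˢ j *ˢ f) w ≈ (u ^ˢ j *ˢ g) w
    linear-^-local zero    f g w       f≈g = trans (*ˢ-identityˡ f w)
      (trans (f≈g w ≡.refl) (sym (*ˢ-identityˡ g w)))
    linear-^-local (suc j) f g []      f≈g = trans (*ˢ-assoc u (u ^ˢ j) f [])
      (trans (trans (linear-[] (u ^ˢ j *ˢ f)) (sym (linear-[] (u ^ˢ j *ˢ g))))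
        (sym (*ˢ-assoc u (u ^ˢ j) g [])))
    linear-^-local (suc j) f g (i ∷ w) f≈g = begin
      (u *ˢ u ^ˢ j *ˢ f) (i ∷ w)        ≈⟨ *ˢ-assoc u (u ^ˢ j) f (i ∷ w) ⟩
      (u *ˢ (u ^ˢ j *ˢ f)) (i ∷ w)      ≈⟨ linear-∷ (u ^ˢ j *ˢ f) i w ⟩
      u (i ∷ []) * (u ^ˢ j *ˢ f) w      ≈⟨ *-congˡ (linear-^-local j f g w (λ v eq → f≈g v (≡.cong suc eq))) ⟩
      u (i ∷ []) * (u ^ˢ j *ˢ g) w      ≈⟨ linear-∷ (u ^ˢ j *ˢ g) i w ⟨
      (u *ˢ (u ^ˢ j *ˢ g)) (i ∷ w)      ≈⟨ *ˢ-assoc u (u ^ˢ j) g (i ∷ w) ⟨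
      (u *ˢ u ^ˢ j *ˢ g) (i ∷ w)        ∎

  pow-[] : ∀ x → pow x [] ≈ x 0
  pow-[] x = trans (pow-unfold x []) (trans (+-cong (*-identityʳ _) (linear-[] t linear-t (pow (x ∘ suc))))
    (+-identityʳ _))

  pow-∷ : ∀ x i w → pow x (i ∷ w) ≈ t (i ∷ []) * pow (x ∘ suc) w
  pow-∷ x i w = trans (pow-unfold x (i ∷ w)) (trans
    (+-cong (zeroʳ _) (linear-∷ t linear-t (pow (x ∘ suc)) i w)) (+-identityˡ _))

  pow-at : ∀ x w → pow x w ≈ x (length w) * (t ^ˢ length w) w
  pow-at x []      = trans (pow-[] x) (sym (*-identityʳ _))
  pow-at x (i ∷ w) = begin
    pow x (i ∷ w)
      ≈⟨ pow-∷ x i w ⟩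
    t (i ∷ []) * pow (x ∘ suc) w
      ≈⟨ *-congˡ (pow-at (x ∘ suc) w) ⟩
    t (i ∷ []) * (x (suc (length w)) * (t ^ˢ length w) w)
      ≈⟨ trans (sym (*-assoc _ _ _)) (trans (*-congʳ (*-comm _ _)) (*-assoc _ _ _)) ⟩
    x (suc (length w)) * (t (i ∷ []) * (t ^ˢ length w) w)
      ≈⟨ *-congˡ (linear-∷ t linear-t (t ^ˢ length w) i w) ⟨
    x (suc (length w)) * (t ^ˢ suc (length w)) (i ∷ w) ∎

  -- `t ^ˢ j *ˢ f` has no terms of degree less than `j`, which makes the sum over `j` finite.
  pow-*-at : ∀ x f w → (pow x *ˢ f) w ≈ ∑ (upTo (suc (length w))) λ j → x j * (t ^ˢ j *ˢ f) w
  pow-*-at x f []      = begin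
    (pow x *ˢ f) []               ≈⟨ *ˢ-[] (pow x) f ⟩
    pow x [] * f []               ≈⟨ *-cong (pow-[] x) (sym (*ˢ-identityˡ f [])) ⟩
    x 0 * (1ˢ *ˢ f) []            ≈⟨ +-identityʳ _ ⟨
    x 0 * (1ˢ *ˢ f) [] + 0#       ∎
  pow-*-at x f (i ∷ w) = begin
    (pow x *ˢ f) (i ∷ w)
      ≈⟨ *ˢ-cong (pow-unfold x) (≈ˢ-refl {f = f}) (i ∷ w) ⟩
    ((const (x 0) +ˢ t *ˢ pow (x ∘ suc)) *ˢ f) (i ∷ w)
      ≈⟨ *ˢ-distribʳ f (const (x 0)) (t *ˢ pow (x ∘ suc)) (i ∷ w) ⟩
    (const (x 0) *ˢ f) (i ∷ w) + ((t *ˢ pow (x ∘ suc)) *ˢ f) (i ∷ w)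
      ≈⟨ +-cong (·-*ˢ (x 0) 1ˢ f (i ∷ w)) (begin
        ((t *ˢ pow (x ∘ suc)) *ˢ f) (i ∷ w)
          ≈⟨ *ˢ-assoc t (pow (x ∘ suc)) f (i ∷ w) ⟩
        (t *ˢ (pow (x ∘ suc) *ˢ f)) (i ∷ w)
          ≈⟨ linear-∷ t linear-t (pow (x ∘ suc) *ˢ f) i w ⟩
        t (i ∷ []) * (pow (x ∘ suc) *ˢ f) w
          ≈⟨ *-congˡ (pow-*-at (x ∘ suc) f w) ⟩
        t (i ∷ []) * ∑ (upTo (suc (length w))) (λ j → x (suc j) * (t ^ˢ j *ˢ f) w)
          ≈⟨ ∑-*ˡ (upTo (suc (length w))) (t (i ∷ [])) _ ⟨
        ∑ (upTo (suc (length w))) (λ j → t (i ∷ []) * (x (suc j) * (t ^ˢ j *ˢ f) w))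
          ≈⟨ ∑-cong (upTo (suc (length w))) (λ j → begin
            t (i ∷ []) * (x (suc j) * (t ^ˢ j *ˢ f) w)
              ≈⟨ trans (sym (*-assoc _ _ _)) (trans (*-congʳ (*-comm _ _)) (*-assoc _ _ _)) ⟩
            x (suc j) * (t (i ∷ []) * (t ^ˢ j *ˢ f) w)
              ≈⟨ *-congˡ (trans (*ˢ-assoc t (t ^ˢ j) f (i ∷ w)) (linear-∷ t linear-t (t ^ˢ j *ˢ f) i w)) ⟨
            x (suc j) * (t ^ˢ suc j *ˢ f) (i ∷ w) ∎) ⟩
        ∑ (upTo (suc (length w))) (λ j → x (suc j) * (t ^ˢ suc j *ˢ f) (i ∷ w)) ∎) ⟩
    x 0 * (1ˢ *ˢ f) (i ∷ w) + ∑ (upTo (suc (length w))) (λ j → x (suc j) * (t ^ˢ suc j *ˢ f) (i ∷ w))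
      ≡⟨ ∑-upTo-suc (suc (length w)) (λ j → x j * (t ^ˢ j *ˢ f) (i ∷ w)) ⟨
    ∑ (upTo (suc (suc (length w)))) (λ j → x j * (t ^ˢ j *ˢ f) (i ∷ w)) ∎

module ChainSums {ρ ℓ} (R : CommutativeRing ρ ℓ) (P : DecStrictPartialOrder 0ℓ 0ℓ 0ℓ)
                 (rank : DecStrictPartialOrder.Carrier P → ℤ) where

  open CommutativeRing R hiding (zero)
  open PowerSeries R
  open Series R
  open Indicator R
  open TwoVariables R
  open import Relation.Binary.Reasoning.Setoid setoid
  open Graded P rank using (ρ[_,_])
  private module P = DecStrictPartialOrder P

  -- `Graded.wt` over an arbitrary coefficient ring.
  wt : P.Carrier → List P.Carrier → P.Carrier → Series 2
  wt x []      y = t ^ˢ (ρ[ x , y ] ℕ.∸ 1)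
  wt x (z ∷ c) y = t ^ˢ (ρ[ x , z ] ℕ.∸ 1) *ˢ b *ˢ wt z c y

  chain? : ∀ x y c → Dec (Linked P._<_ (x ∷ c ∷ʳ y))
  chain? x y c = linked? P._<?_ (x ∷ c ∷ʳ y)

  -- The bound `N` and the lower endpoint are separate from the list `Q`, so that removing the first
  -- element of a chain changes only these two.
  chainSum : List P.Carrier → ℕ → P.Carrier → P.Carrier → Series 2
  chainSum Q N x y w = ∑ (tuples≤ Q N) λ c → 𝟙 (does (chain? x y c)) * wt x c y w

  chain⇒< : ∀ x c y → Linked P._<_ (x ∷ c ∷ʳ y) → x P.< y
  chain⇒< x []      y (x<y ∷ [-]) = x<y
  chain⇒< x (z ∷ c) y (x<z ∷ l)   = P.trans x<z (chain⇒< z c y l)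

  chainSum-zero : ∀ Q N {x y} → ¬ (x P.< y) → chainSum Q N x y ≈ˢ 0ˢ
  chainSum-zero Q N {x} {y} x≮y w = ∑-zero (tuples≤ Q N) λ c → trans
    (*-congʳ (reflexive (≡.cong 𝟙 (dec-false (chain? x y c) (x≮y ∘ chain⇒< x c y))))) (zeroˡ _)

  𝟙-< : ∀ x y → 𝟙 (does (chain? x y [])) ≈ 𝟙 (does (x P.<? y))
  𝟙-< x y = trans (𝟙-∧ (does (x P.<? y)) true) (*-identityʳ _)

  chainSum-base : ∀ Q x y → chainSum Q 0 x y ≈ˢ 𝟙 (does (x P.<? y)) · t ^ˢ (ρ[ x , y ] ℕ.∸ 1)
  chainSum-base Q x y w = trans
    (∑-tuples≤-zero Q (λ c → 𝟙 (does (chain? x y c)) * wt x c y w)) (*-congʳ (𝟙-< x y))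

  chainSum-suc : ∀ Q N x y → chainSum Q (suc N) x y ≈ˢ
    𝟙 (does (x P.<? y)) · t ^ˢ (ρ[ x , y ] ℕ.∸ 1) +ˢ
    ∑ˢ Q (λ z → 𝟙 (does (x P.<? z)) · (t ^ˢ (ρ[ x , z ] ℕ.∸ 1) *ˢ (b *ˢ chainSum Q N z y)))
  chainSum-suc Q N x y w = begin
    chainSum Q (suc N) x y w
      ≈⟨ ∑-tuples≤-suc Q N (λ c → 𝟙 (does (chain? x y c)) * wt x c y w) ⟩
    𝟙 (does (chain? x y [])) * (t ^ˢ (ρ[ x , y ] ℕ.∸ 1)) w +
      ∑ Q (λ z → ∑ (tuples≤ Q N) λ c → 𝟙 (does (chain? x y (z ∷ c))) * wt x (z ∷ c) y w)
      ≈⟨ +-cong (*-congʳ (𝟙-< x y)) (∑-cong Q λ z → begin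
        ∑ (tuples≤ Q N) (λ c → 𝟙 (does (chain? x y (z ∷ c))) * wt x (z ∷ c) y w)
          ≈⟨ ∑-cong (tuples≤ Q N) (λ c → trans (*-congʳ (𝟙-∧ (does (x P.<? z)) (does (chain? z y c))))
               (*-assoc _ _ _)) ⟩
        ∑ (tuples≤ Q N) (λ c → 𝟙 (does (x P.<? z)) * (𝟙 (does (chain? z y c)) * (U z *ˢ b *ˢ wt z c y) w))
          ≈⟨ ∑-*ˡ (tuples≤ Q N) (𝟙 (does (x P.<? z))) _ ⟩
        𝟙 (does (x P.<? z)) * ∑ (tuples≤ Q N) (λ c → 𝟙 (does (chain? z y c)) * (U z *ˢ b *ˢ wt z c y) w)
          ≈⟨ *-congˡ (∑-*ˢ (tuples≤ Q N) (U z *ˢ b) (λ c → 𝟙 (does (chain? z y c))) (λ c → wt z c y) w) ⟩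
        𝟙 (does (x P.<? z)) * (U z *ˢ b *ˢ chainSum Q N z y) w
          ≈⟨ *-congˡ (*ˢ-assoc (U z) b (chainSum Q N z y) w) ⟩
        𝟙 (does (x P.<? z)) * (U z *ˢ (b *ˢ chainSum Q N z y)) w ∎) ⟩
    _ ∎
    where
    U : P.Carrier → Series 2
    U z = t ^ˢ (ρ[ x , z ] ℕ.∸ 1)

-- Level posets

open import Data.Integer.Base as ℤ using (+_; -[1+_]; 0ℤ; 1ℤ; -1ℤ)

length-filter-product : ∀ {A B C : Set} {P : C → Set} (P? : Decidable P) (h : A → B → C) xs ys →
  (∀ x → x ∈ xs → ∃ λ y → y ∈ ys × P (h x y)) →
  length xs ℕ.≤ length (filter P? (cartesianProductWith h xs ys))
length-filter-product P? h []       ys f = z≤n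
length-filter-product P? h (x ∷ xs) ys f = let y , y∈ys , Phxy = f x (here ≡.refl) in
  ≡.subst (suc (length xs) ℕ.≤_)
    (≡.sym (≡.trans (≡.cong length (filter-++ P? (map (h x) ys) (cartesianProductWith h xs ys)))
      (length-++ (filter P? (map (h x) ys)))))
    (ℕ.+-mono-≤ (∈-length (∈-filter⁺ P? (∈-map⁺ (h x) y∈ys) Phxy))
      (length-filter-product P? h xs ys (λ x′ x′∈xs → f x′ (there x′∈xs))))

∣i+k-i∣≡k : ∀ i k → ℤ.∣ + (i ℕ.+ k) ℤ.- + i ∣ ≡ k
∣i+k-i∣≡k i k = ≡.trans (≡.cong ℤ.∣_∣ (≡.trans (ℤ.m-n≡m⊖n (i ℕ.+ k) i) (ℤ.⊖-≥ (ℕ.m≤m+n i k))))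
  (ℕ.m+n∸m≡n i k)

module _ {n} (M : Matrix n) where

  open LevelPoset M

  private
    module N = Sum ℕ.+-*-semiring

  positive : ℕ → Fin n → Fin n → Bool
  positive r u v = does (0 ℕ.<? (M ^ᴹ r) u v)

  -- Writing the upper level as `suc i + j` makes the exponent visible: the integer difference of
  -- levels is `suc j`.
  ≺⇔ : ∀ {u v} i j → ((u , + i) ≺ (v , + (suc i ℕ.+ j))) ⇔ (0 ℕ.< (M ^ᴹ suc j) u v)
  ≺⇔ {u} {v} i j = mk⇔
    (λ (_ , p) → ≡.subst (λ r → 0 ℕ.< (M ^ᴹ r) u v) eq p)
    (λ p → ℤ.+<+ (s≤s (ℕ.m≤m+n i j)) , ≡.subst (λ r → 0 ℕ.< (M ^ᴹ r) u v) (≡.sym eq) p)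
    where
    eq : ℤ.∣ + (suc i ℕ.+ j) ℤ.- + i ∣ ≡ suc j
    eq = ≡.trans (≡.cong (λ k → ℤ.∣ + k ℤ.- + i ∣) (≡.sym (ℕ.+-suc i j))) (∣i+k-i∣≡k i (suc j))

  diagonal : ∀ u → 0 ℕ.< (M ^ᴹ 0) u u
  diagonal u with u Fin.≟ u
  ... | yes _  = ℕ.z<s
  ... | no u≢u = contradiction ≡.refl u≢u

  ≤⇔ : ∀ {u v} i k → ((u , + i) ≤ (v , + (i ℕ.+ k))) ⇔ (0 ℕ.< (M ^ᴹ k) u v)
  ≤⇔ {u} {v} i k = mk⇔ (λ p → to k ≡.refl p) (from k)
    where
    -- The upper level is a variable `j` so that the equality case of `≤` can be matched with
    -- `refl`.
    to : ∀ k {j} → j ≡ i ℕ.+ k → (u , + i) ≤ (v , + j) → 0 ℕ.< (M ^ᴹ k) u v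
    to zero    j≡ (inj₁ (ℤ.+<+ i<j , _)) =
      contradiction (≡.trans j≡ (ℕ.+-identityʳ i)) (ℕ.>⇒≢ i<j)
    to zero    j≡ (inj₂ ≡.refl) = diagonal u
    to (suc k) j≡ (inj₁ p) = Equivalence.to (≺⇔ i k)
      (≡.subst (λ j → (u , + i) ≺ (v , + j)) (≡.trans j≡ (ℕ.+-suc i k)) p)
    to (suc k) j≡ (inj₂ ≡.refl) = contradiction j≡ (ℕ.m≢1+m+n i ∘ λ eq → ≡.trans eq (ℕ.+-suc i k))

    from : ∀ k → 0 ℕ.< (M ^ᴹ k) u v → (u , + i) ≤ (v , + (i ℕ.+ k))
    from zero    p with u Fin.≟ v
    from zero    p | yes ≡.refl = inj₂ (≡.cong (λ j → u , + j) (≡.sym (ℕ.+-identityʳ i)))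
    from (suc k) p = inj₁ (≡.subst (λ j → (u , + i) ≺ (v , + j)) (≡.sym (ℕ.+-suc i k))
      (Equivalence.from (≺⇔ i k) p))

  ≺-trans : ∀ {p q r} → p ≺ q → q ≺ r → p ≺ r
  ≺-trans = DecStrictPartialOrder.trans levelPoset

  ≤-≺-trans : ∀ {p q r} → p ≤ q → q ≺ r → p ≺ r
  ≤-≺-trans (inj₁ p<q)    q<r = ≺-trans p<q q<r
  ≤-≺-trans (inj₂ ≡.refl) q<r = q<r

  ≤-trans : ∀ {p q r} → p ≤ q → q ≤ r → p ≤ r
  ≤-trans p≤q (inj₁ q<r)    = inj₁ (≤-≺-trans p≤q q<r)
  ≤-trans p≤q (inj₂ ≡.refl) = p≤q

  ^ᴹ-step : ∀ r u v → 0 ℕ.< (M ^ᴹ suc r) u v → ∃ λ w → 0 ℕ.< (M ^ᴹ 1) u w × 0 ℕ.< (M ^ᴹ r) w v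
  ^ᴹ-step r u v p =
    let w , 0<Mp = sum⁺⁻¹ (λ w → M u w ℕ.* (M ^ᴹ r) w v) p
        0<M , 0<p = *⁺⁻¹ (M u w) ((M ^ᴹ r) w v) 0<Mp
    in w , sum⁺ (λ t → M u t ℕ.* (M ^ᴹ 0) t w) w (*⁺ 0<M (diagonal w)) , 0<p
    where
    sum⁺⁻¹ : ∀ {n} (f : Fin n → ℕ) → 0 ℕ.< N.sum f → ∃ λ t → 0 ℕ.< f t
    sum⁺⁻¹ {suc n} f 0<Σ with f zero in eq
    ... | suc _ = zero , ≡.subst (0 ℕ.<_) (≡.sym eq) ℕ.z<s
    ... | zero  = let t , 0<f = sum⁺⁻¹ (f ∘ suc) 0<Σ in suc t , 0<f

    sum⁺ : ∀ {n} (f : Fin n → ℕ) t → 0 ℕ.< f t → 0 ℕ.< N.sum f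
    sum⁺ f zero    0<f = ℕ.<-≤-trans 0<f (ℕ.m≤m+n _ _)
    sum⁺ f (suc t) 0<f = ℕ.<-≤-trans (sum⁺ (f ∘ suc) t 0<f) (ℕ.m≤n+m _ (f zero))

    *⁺ : ∀ {k l} → 0 ℕ.< k → 0 ℕ.< l → 0 ℕ.< k ℕ.* l
    *⁺ {suc k} {suc l} _ _ = ℕ.z<s

    *⁺⁻¹ : ∀ k l → 0 ℕ.< k ℕ.* l → 0 ℕ.< k × 0 ℕ.< l
    *⁺⁻¹ (suc k) zero    p = contradiction (≡.subst (0 ℕ.<_) (ℕ.*-zeroʳ k) p) (λ ())
    *⁺⁻¹ (suc k) (suc l) _ = ℕ.z<s , ℕ.z<s

  -- A positive entry of a matrix power comes from a walk, and the walk visits every level in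
  -- between; it is followed one edge at a time.
  level-inhabited : ∀ x y m → (x , 0ℤ) ≤ (y , + m) → ∀ k → k ℕ.≤ m →
                    ∃ λ z → (x , 0ℤ) ≤ (z , + k) × (z , + k) ≤ (y , + m)
  level-inhabited x y m p≤q zero    k≤m = x , inj₂ ≡.refl , p≤q
  level-inhabited x y m p≤q (suc k) k<m =
    let z , p≤z , z≤q = level-inhabited x y m p≤q k (ℕ.<⇒≤ k<m)
        r , eq = ℕ.m≤n⇒∃[o]m+o≡n k<m
        z≤q′ = ≡.subst (λ j → (z , + k) ≤ (y , + j)) (≡.trans (≡.sym eq) (≡.sym (ℕ.+-suc k r))) z≤q
        z′ , zz′ , z′y = ^ᴹ-step r z y (Equivalence.to (≤⇔ k (suc r)) z≤q′)
    in z′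
     , ≤-trans p≤z (≡.subst (λ j → (z , + k) ≤ (z′ , + j)) (ℕ.+-comm k 1)
         (Equivalence.from (≤⇔ k 1) zz′))
     , ≡.subst (λ j → (z′ , + suc k) ≤ (y , + j)) eq (Equivalence.from (≤⇔ (suc k) r) z′y)

  -- Every level contributes at least one element. Hence the bound `length Q` in `chains` is large
  -- enough for the recursion on chains, which needs it to be at least the number of levels strictly
  -- between the endpoints.
  length-interval : ∀ x y m → (x , 0ℤ) ≤ (y , + m) → m ℕ.≤ length (interval (x , 0ℤ) (y , + m))
  length-interval x y m p≤q = ℕ.≤-trans (ℕ.n≤1+n m) (≡.subst (ℕ._≤ length (interval (x , 0ℤ) (y , + m)))
    -- The difference `∣ + m - 0ℤ ∣` in `interval` computes to `m + 0`.
    (≡.trans (length-applyUpTo id (suc (m ℕ.+ 0))) (≡.cong suc (ℕ.+-identityʳ m)))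
    (length-filter-product _ _ (upTo (suc (m ℕ.+ 0))) (allFin n) λ k k∈ →
      let z , p≤z , z≤q = level-inhabited x y m p≤q k
            (ℕ.≤-pred (≡.subst (k ℕ.<_) (≡.cong suc (ℕ.+-identityʳ m)) (∈-upTo⁻ k∈)))
      in z , ∈-allFin z , p≤z , z≤q))

-- Automata, alternating sums and chains of a level poset

module LevelSeries {ρ ℓ} (R : CommutativeRing ρ ℓ) {n} (M : Matrix n) where

  open CommutativeRing R hiding (zero)
  open PowerSeries R
  open Series R
  open Indicator R
  open TwoVariables R
  open Homogeneous R
  open Substitution R using (∑-allFin; sum-at)
  open LevelPoset M hiding (wt; Ψ)
  open ChainSums R levelPoset proj₂
  open RawSemiring (Semiring.rawSemiring semiring) using (_^_)
  open Kronecker semiring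
  open RingProperties ring using (-1*x≈-x)
  open import Relation.Binary.Reasoning.Setoid setoid
  private
    module S {k} = Sum (Ring.semiring (seriesRing k))
    module RS = Sum semiring
    module N = Sum ℕ.+-*-semiring

  Q : ℕ → Fin n → Fin n → Carrier
  Q r u v = 𝟙 (positive M r u v)

  Q₀ : ∀ u v → Q 0 u v ≈ δ u v
  Q₀ u v with u Fin.≟ v
  ... | yes _ = refl
  ... | no  _ = refl

  -- The column of M^r at v, reduced to whether its entries vanish, determines
  -- that of M^(r+1), and it takes at most 2^n values.
  module _ (u v : Fin n) where

    private
      clamp : ℕ → Fin 2
      clamp zero    = 0F
      clamp (suc _) = 1F

      value : Fin 2 → Carrier
      value 0F = 0#
      value 1F = 1#

      -- Natural numbers do not cancel, so whether a sum vanishes depends only on which of its terms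
      -- do. This is why supports of columns suffice as states.
      clamp-+ : ∀ k k′ {l l′} → clamp k ≡ clamp k′ → clamp l ≡ clamp l′ →
                clamp (k ℕ.+ l) ≡ clamp (k′ ℕ.+ l′)
      clamp-+ zero    zero     _ eq = eq
      clamp-+ (suc _) (suc _)  _ _  = ≡.refl

      clamp-* : ∀ k {l} {i} → i ≡ clamp l → clamp (k ℕ.* toℕ i) ≡ clamp (k ℕ.* l)
      clamp-* zero              _      = ≡.refl
      clamp-* (suc k) {zero}    ≡.refl = ≡.refl
      clamp-* (suc k) {suc l}   ≡.refl = ≡.refl

      clamp-sum : ∀ {m} (f g : Fin m → ℕ) → (∀ i → clamp (f i) ≡ clamp (g i)) →
                  clamp (N.sum f) ≡ clamp (N.sum g)
      clamp-sum {zero}  f g eq = ≡.refl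
      clamp-sum {suc m} f g eq = clamp-+ (f zero) (g zero) (eq zero)
        (clamp-sum (f ∘ suc) (g ∘ suc) (eq ∘ suc))

    next : Fin (2 ℕ.^ n) → Fin (2 ℕ.^ n)
    next S = funToFin λ w → clamp (N.sum λ w′ → M w w′ ℕ.* toℕ (finToFun S w′))

    out : Fin (2 ℕ.^ n) → Carrier
    out S = value (finToFun {2} {n} S u)

    state : ℕ → Fin (2 ℕ.^ n)
    state zero    = funToFin λ w → clamp ((M ^ᴹ 0) w v)
    state (suc r) = next (state r)

    state-clamp : ∀ r w → finToFun (state r) w ≡ clamp ((M ^ᴹ r) w v)
    state-clamp zero    w = Fin.finToFun-funToFin (λ w → clamp ((M ^ᴹ 0) w v)) w
    state-clamp (suc r) w = ≡.trans
      (Fin.finToFun-funToFin (λ w → clamp (N.sum λ w′ → M w w′ ℕ.* toℕ (finToFun (state r) w′))) w)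
      (clamp-sum (λ w′ → M w w′ ℕ.* toℕ (finToFun (state r) w′)) (λ w′ → M w w′ ℕ.* (M ^ᴹ r) w′ v)
        (λ w′ → clamp-* (M w w′) {(M ^ᴹ r) w′ v} (state-clamp r w′)))

    state-out : ∀ r → out (state r) ≈ Q r u v
    state-out r = trans (reflexive (≡.cong value (state-clamp r u))) (value-clamp ((M ^ᴹ r) u v))
      where
      value-clamp : ∀ k → value (clamp k) ≈ 𝟙 (does (0 ℕ.<? k))
      value-clamp zero    = refl
      value-clamp (suc _) = refl

  -- The Eulerian condition is an equation in the integers; this carries it to the coefficient ring.
  fromℤ : ℤ → Carrier
  fromℤ (+ zero)       = 0#
  fromℤ (+ suc k)      = 1# + fromℤ (+ k)
  fromℤ -[1+ zero ]    = - 1#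
  fromℤ -[1+ suc k ]   = - 1# + fromℤ -[1+ k ]

  private
    fromℤ-suc : ∀ i → fromℤ (1ℤ ℤ.+ i) ≈ 1# + fromℤ i
    fromℤ-suc (+ k)          = refl
    fromℤ-suc -[1+ zero ]    = sym (-‿inverseʳ 1#)
    fromℤ-suc -[1+ suc k ]   = sym (trans (sym (+-assoc 1# (- 1#) _))
      (trans (+-congʳ (-‿inverseʳ 1#)) (+-identityˡ _)))

    fromℤ-pred : ∀ i → fromℤ (-1ℤ ℤ.+ i) ≈ - 1# + fromℤ i
    fromℤ-pred i = begin
      fromℤ (-1ℤ ℤ.+ i)                    ≈⟨ +-identityˡ _ ⟨
      0# + fromℤ (-1ℤ ℤ.+ i)               ≈⟨ +-congʳ (-‿inverseˡ 1#) ⟨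
      - 1# + 1# + fromℤ (-1ℤ ℤ.+ i)        ≈⟨ +-assoc _ _ _ ⟩
      - 1# + (1# + fromℤ (-1ℤ ℤ.+ i))      ≈⟨ +-congˡ (fromℤ-suc (-1ℤ ℤ.+ i)) ⟨
      - 1# + fromℤ (1ℤ ℤ.+ (-1ℤ ℤ.+ i))    ≡⟨ ≡.cong (λ j → - 1# + fromℤ j)
                                               (≡.trans (≡.sym (ℤ.+-assoc 1ℤ -1ℤ i)) (ℤ.+-identityˡ i)) ⟩
      - 1# + fromℤ i                       ∎

    -- The recursion goes down by two, where the sign is unchanged on both sides; only adding 1 and
    -- adding -1 remain.
    fromℤ-sign : ∀ k i → fromℤ (-1ℤ ℤ.^ k ℤ.+ i) ≈ (- 1#) ^ k + fromℤ i
    fromℤ-sign zero          i = fromℤ-suc i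
    fromℤ-sign (suc zero)    i = trans (fromℤ-pred i) (+-congʳ (sym (*-identityʳ (- 1#))))
    fromℤ-sign (suc (suc k)) i = begin
      fromℤ (-1ℤ ℤ.* (-1ℤ ℤ.* -1ℤ ℤ.^ k) ℤ.+ i)
        ≡⟨ ≡.cong (λ j → fromℤ (j ℤ.+ i)) (≡.trans (≡.sym (ℤ.*-assoc -1ℤ -1ℤ (-1ℤ ℤ.^ k))) (ℤ.*-identityˡ _)) ⟩
      fromℤ (-1ℤ ℤ.^ k ℤ.+ i)
        ≈⟨ fromℤ-sign k i ⟩
      (- 1#) ^ k + fromℤ i
        ≈⟨ +-congʳ (trans (sym (*-identityˡ _)) (trans (*-congʳ (sym -1*-1≈1)) (*-assoc _ _ _))) ⟩
      - 1# * (- 1# * (- 1#) ^ k) + fromℤ i ∎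
      where
      -1*-1≈1 : - 1# * - 1# ≈ 1#
      -1*-1≈1 = trans (-1*x≈-x (- 1#)) (RingProperties.-‿involutive ring 1#)

  fromℤ-alternatingSum : ∀ zs → fromℤ (alternatingSum zs) ≈ ∑ zs λ z → (- 1#) ^ ℤ.∣ proj₂ z ∣
  fromℤ-alternatingSum []       = refl
  fromℤ-alternatingSum (z ∷ zs) = trans (fromℤ-sign ℤ.∣ proj₂ z ∣ (alternatingSum zs))
    (+-congˡ (fromℤ-alternatingSum zs))

  𝟙-⇔ : ∀ {A B : Set} → A ⇔ B → (A? : Dec A) (B? : Dec B) → 𝟙 (does A?) ≈ 𝟙 (does B?)
  𝟙-⇔ A⇔B A? B? = reflexive (≡.cong 𝟙 (does-⇔ A⇔B A? B?))

  𝟙-idem : ∀ x → 𝟙 x * 𝟙 x ≈ 𝟙 x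
  𝟙-idem true  = *-identityˡ _
  𝟙-idem false = zeroˡ _

  module _ (m : ℕ) (x y : Fin n) where

    private
      p q : Element
      p = x , 0ℤ
      q = y , + suc m

      inside? : ∀ z → Dec (p ≤ z × z ≤ q)
      inside? z = (p ≤? z) ×-dec (z ≤? q)

      levels : suc (suc m ℕ.+ 0) ≡ 2 ℕ.+ m
      levels = ≡.cong suc (ℕ.+-identityʳ (suc m))

      grid : List Element
      grid = cartesianProductWith (λ k z → z , 0ℤ ℤ.+ + k) (upTo (suc (suc m ℕ.+ 0))) (allFin n)

      term : ℕ → Fin n → Carrier
      term r z = (- 1#) ^ r * Q r x z * Q (suc m ℕ.∸ r) z y

      𝟙-inside : ∀ r z → r ℕ.≤ suc m →
                 Q r x z * Q (suc m ℕ.∸ r) z y ≈ 𝟙 (does (p ≤? (z , + r))) * 𝟙 (does ((z , + r) ≤? q))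
      𝟙-inside r z r≤ = *-cong
        (sym (𝟙-⇔ (≤⇔ M 0 r) (p ≤? (z , + r)) (0 ℕ.<? (M ^ᴹ r) x z)))
        (sym (upper (suc m ℕ.∸ r) (suc m) (ℕ.m+[n∸m]≡n r≤)))
        where
        upper : ∀ s k → r ℕ.+ s ≡ k → 𝟙 (does ((z , + r) ≤? (y , + k))) ≈ Q s z y
        upper s k ≡.refl = 𝟙-⇔ (≤⇔ M r s) ((z , + r) ≤? (y , + k)) (0 ℕ.<? (M ^ᴹ s) z y)

      Vanishes : Set ℓ
      Vanishes = ∑ (upTo (2 ℕ.+ m)) (λ r → ∑ (allFin n) (term r)) ≈ 0#

      related : LevelEulerian → p ≺ q → Vanishes
      related eulerian p<q = begin
        ∑ (upTo (2 ℕ.+ m)) (λ r → ∑ (allFin n) (term r))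
          ≈⟨ ∑-upTo-cong (2 ℕ.+ m) (λ r r< → ∑-cong (allFin n) λ z → inside r z (ℕ.≤-pred r<)) ⟩
        ∑ (upTo (2 ℕ.+ m)) (λ r → ∑ (allFin n) λ z → f (z , + r))
          ≡⟨ ≡.cong (λ e → ∑ (upTo e) (λ r → ∑ (allFin n) λ z → f (z , + r))) levels ⟨
        ∑ (upTo (suc (suc m ℕ.+ 0))) (λ r → ∑ (allFin n) λ z → f (z , + r))
          ≈⟨ ∑-product (λ k z → z , 0ℤ ℤ.+ + k) (upTo (suc (suc m ℕ.+ 0))) (allFin n) f ⟨
        ∑ grid f
          ≈⟨ ∑-filter inside? grid (λ z → 𝟙 (does (inside? z)) * sign z) ⟨
        ∑ (interval p q) (λ z → 𝟙 (does (inside? z)) * sign z)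
          ≈⟨ ∑-filter inside? (interval p q) sign ⟨
        ∑ (between p q (interval p q)) sign
          ≈⟨ fromℤ-alternatingSum (between p q (interval p q)) ⟨
        fromℤ (alternatingSum (between p q (interval p q)))
          ≡⟨ ≡.cong fromℤ (eulerian p q (inj₁ p<q) p∈ q∈ p<q) ⟩
        0# ∎
        where
        sign f : Element → Carrier
        sign z = (- 1#) ^ ℤ.∣ proj₂ z ∣
        -- The indicator occurs twice because `interval` and `between` filter the grid by the same
        -- condition.
        f z = 𝟙 (does (inside? z)) * (𝟙 (does (inside? z)) * sign z)

        inside : ∀ r z → r ℕ.≤ suc m → term r z ≈ f (z , + r)
        inside r z r≤ = begin
          (- 1#) ^ r * Q r x z * Q (suc m ℕ.∸ r) z y    ≈⟨ *-assoc _ _ _ ⟩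
          (- 1#) ^ r * (Q r x z * Q (suc m ℕ.∸ r) z y)  ≈⟨ *-congˡ (trans (𝟙-inside r z r≤)
                                                            (sym (𝟙-∧ (does (p ≤? (z , + r))) (does ((z , + r) ≤? q))))) ⟩
          (- 1#) ^ r * 𝟙 (does (inside? (z , + r)))     ≈⟨ *-comm _ _ ⟩
          𝟙 (does (inside? (z , + r))) * (- 1#) ^ r     ≈⟨ *-congʳ (𝟙-idem (does (inside? (z , + r)))) ⟨
          _                                             ≈⟨ *-assoc _ _ _ ⟩
          f (z , + r)                                   ∎

        p∈ : p ∈ interval p q
        p∈ = ∈-filter⁺ inside? (∈-cartesianProductWith⁺ (λ k z → z , 0ℤ ℤ.+ + k)
          (∈-upTo⁺ {suc (suc m ℕ.+ 0)} ℕ.z<s) (∈-allFin x)) (inj₂ ≡.refl , inj₁ p<q)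

        q∈ : q ∈ interval p q
        q∈ = ∈-filter⁺ inside? (∈-cartesianProductWith⁺ (λ k z → z , 0ℤ ℤ.+ + k)
          (∈-upTo⁺ {suc (suc m ℕ.+ 0)} (ℕ.≤-reflexive (≡.sym levels))) (∈-allFin y)) (inj₁ p<q , inj₂ ≡.refl)

      -- The equation is required for all pairs of vertices, while the Eulerian condition speaks
      -- only of related ones. For the other pairs every term is zero: a nonzero one would give
      -- `p ≤ z ≤ q`, and so `p ≺ q` since the levels differ.
      unrelated : ¬ (p ≺ q) → Vanishes
      unrelated p≮q = trans (∑-upTo-cong (2 ℕ.+ m) {g = λ _ → 0#} λ r r< → ∑-zero (allFin n) λ z →
          trans (*-assoc _ _ _) (trans (*-congˡ (trans (𝟙-inside r z (ℕ.≤-pred r<))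
            (outside z r (p ≤? (z , + r)) ((z , + r) ≤? q)))) (zeroʳ _)))
        (∑-zero (upTo (2 ℕ.+ m)) λ _ → refl)
        where
        outside : ∀ z r (p≤? : Dec (p ≤ (z , + r))) (≤q? : Dec ((z , + r) ≤ q)) →
                  𝟙 (does p≤?) * 𝟙 (does ≤q?) ≈ 0#
        outside z r (no _)    ≤q?       = zeroˡ _
        outside z r (yes _)   (no _)    = zeroʳ _
        outside z r (yes p≤z) (yes z≤q) = contradiction
          (Equivalence.from (≺⇔ M 0 m) (Equivalence.to (≤⇔ M 0 (suc m)) (≤-trans M p≤z z≤q))) p≮q

      vanishes : LevelEulerian → Vanishes
      vanishes eulerian with DecStrictPartialOrder._<?_ levelPoset p q
      ... | yes p<q = related eulerian p<q
      ... | no  p≮q = unrelated p≮q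

    euler : LevelEulerian → RS.sum (λ z → ∑ (upTo (2 ℕ.+ m)) (λ r → term r z)) ≈ 0#
    euler eulerian = begin
      RS.sum (λ z → ∑ (upTo (2 ℕ.+ m)) λ r → term r z)
        ≡⟨ ∑-allFin (λ z → ∑ (upTo (2 ℕ.+ m)) λ r → term r z) ⟨
      ∑ (allFin n) (λ z → ∑ (upTo (2 ℕ.+ m)) λ r → term r z)
        ≈⟨ ∑-swap (allFin n) (upTo (2 ℕ.+ m)) (λ z r → term r z) ⟩
      ∑ (upTo (2 ℕ.+ m)) (λ r → ∑ (allFin n) (term r))
        ≈⟨ vanishes eulerian ⟩
      0# ∎

  module Chains (X : Fin n → Fin n → Series 2)
    (X≈ : ∀ i j → X i j ≈ˢ pow (λ r → Q (suc r) i j) +ˢ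
                           S.sum (λ k → pow (λ r → Q (suc r) i k) *ˢ (b *ˢ X k j))) where

    X-at : ∀ x y w → X x y w ≈ Q (suc (length w)) x y * (t ^ˢ length w) w +
      ∑ (upTo (suc (length w))) λ j → ∑ (allFin n) λ z → Q (suc j) x z * (t ^ˢ j *ˢ (b *ˢ X z y)) w
    X-at x y w = trans (X≈ x y w) (+-cong (pow-at (λ r → Q (suc r) x y) w) (begin
      S.sum (λ z → pow (λ r → Q (suc r) x z) *ˢ (b *ˢ X z y)) w
        ≡⟨ sum-at (λ z → pow (λ r → Q (suc r) x z) *ˢ (b *ˢ X z y)) w ⟩
      RS.sum (λ z → (pow (λ r → Q (suc r) x z) *ˢ (b *ˢ X z y)) w)
        ≡⟨ ∑-allFin (λ z → (pow (λ r → Q (suc r) x z) *ˢ (b *ˢ X z y)) w) ⟨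
      ∑ (allFin n) (λ z → (pow (λ r → Q (suc r) x z) *ˢ (b *ˢ X z y)) w)
        ≈⟨ ∑-cong (allFin n) (λ z → pow-*-at (λ r → Q (suc r) x z) (b *ˢ X z y) w) ⟩
      ∑ (allFin n) (λ z → ∑ (upTo (suc (length w))) λ j → Q (suc j) x z * (t ^ˢ j *ˢ (b *ˢ X z y)) w)
        ≈⟨ ∑-swap (allFin n) (upTo (suc (length w))) _ ⟩
      _ ∎))

    module _ (x₀ y : Fin n) (m : ℕ) where

      private
        p₀ q₀ : Element
        p₀ = x₀ , 0ℤ
        q₀ = y , + suc m

        I : List Element
        I = interval p₀ q₀

      𝟙-≺ : ∀ u v i k j → k ≡ suc i ℕ.+ j →
            𝟙 (does (DecStrictPartialOrder._<?_ levelPoset (u , + i) (v , + k))) ≈ Q (suc j) u v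
      𝟙-≺ u v i k j ≡.refl = 𝟙-⇔ (≺⇔ M i j) (DecStrictPartialOrder._<?_ levelPoset (u , + i) (v , + k))
        (0 ℕ.<? (M ^ᴹ suc j) u v)

      ρ-1 : ∀ (u v : Fin n) i k j → k ≡ suc i ℕ.+ j → ρ[ (u , + i) , (v , + k) ] ℕ.∸ 1 ≡ j
      ρ-1 u v i k j ≡.refl = ≡.cong (ℕ._∸ 1) (≡.trans
        (≡.cong (λ k → ℤ.∣ + k ℤ.- + i ∣) (≡.sym (ℕ.+-suc i j))) (∣i+k-i∣≡k i (suc j)))

      direct : ∀ x i d → i ℕ.+ d ≡ m → ∀ w →
        𝟙 (does (DecStrictPartialOrder._<?_ levelPoset (x , + i) q₀)) *
          (t ^ˢ (ρ[ (x , + i) , q₀ ] ℕ.∸ 1)) w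
        ≈ Q (suc d) x y * (t ^ˢ d) w
      direct x i d i+d≡m w = *-cong (𝟙-≺ x y i (suc m) d (≡.cong suc (≡.sym i+d≡m)))
        (reflexive (≡.cong (λ e → (t ^ˢ e) w) (ρ-1 x y i (suc m) d (≡.cong suc (≡.sym i+d≡m)))))

      -- Induction on the bound `N`, splitting a chain at its first inner element. There are `d`
      -- levels strictly between `(x , + i)` and `q₀`, so weights have degree `d` and only words of
      -- that length are compared. The hypothesis `p₀ ≤ (x , + i)` keeps all later chain elements
      -- inside `I`, so the list `I` can stay fixed while the lower endpoint moves.
      chainSum≈X : ∀ N i d x → i ℕ.+ d ≡ m → d ℕ.≤ N → p₀ ≤ (x , + i) → ∀ w → length w ≡ d →
                   chainSum I N (x , + i) q₀ w ≈ X x y w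
      chainSum≈X zero i zero x i+d≡m z≤n p₀≤p [] ≡.refl = begin
        chainSum I 0 (x , + i) q₀ []
          ≈⟨ chainSum-base I (x , + i) q₀ [] ⟩
        _ ≈⟨ direct x i 0 i+d≡m [] ⟩
        Q 1 x y * 1#
          ≈⟨ +-identityʳ _ ⟨
        Q 1 x y * 1# + 0#
          ≈⟨ +-congˡ (trans (+-identityʳ _) (∑-zero (allFin n) λ z → trans (*-congˡ
               (trans (*ˢ-identityˡ (b *ˢ X z y) []) (linear-[] b (linear-var 1F) (X z y)))) (zeroʳ _))) ⟨
        _ ≈⟨ X-at x y [] ⟨
        X x y [] ∎
      chainSum≈X (suc N) i d x i+d≡m d≤N p₀≤p w ≡.refl = begin
        chainSum I (suc N) p q₀ w
          ≈⟨ chainSum-suc I N p q₀ w ⟩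
        _ ≈⟨ +-cong (direct x i d i+d≡m w) (begin
          ∑ I g
            ≈⟨ ∑-filter-support (λ z → (p₀ ≤? z) ×-dec (z ≤? q₀))
                 (cartesianProductWith (λ k z → z , 0ℤ ℤ.+ + k) (upTo (suc (suc (m ℕ.+ 0)))) (allFin n)) g outside ⟩
          ∑ (cartesianProductWith (λ k z → z , 0ℤ ℤ.+ + k) (upTo (suc (suc (m ℕ.+ 0)))) (allFin n)) g
            ≈⟨ ∑-product _ (upTo (suc (suc (m ℕ.+ 0)))) (allFin n) g ⟩
          ∑ (upTo (suc (suc (m ℕ.+ 0)))) (λ k → ∑ (allFin n) λ z → g (z , + k))
            ≡⟨ ≡.cong (λ e → ∑ (upTo e) (λ k → ∑ (allFin n) λ z → g (z , + k))) levels ⟩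
          ∑ (upTo (suc i ℕ.+ suc d)) (λ k → ∑ (allFin n) λ z → g (z , + k))
            ≈⟨ ∑-upTo-drop (suc i) (suc d) _ (λ k k≤i → ∑-zero (allFin n) λ z → below z k k≤i) ⟩
          ∑ (upTo (suc d)) (λ j → ∑ (allFin n) λ z → g (z , + (suc i ℕ.+ j)))
            ≈⟨ ∑-cong (upTo (suc d)) (λ j → ∑-cong (allFin n) λ z → term z j) ⟩
          ∑ (upTo (suc d)) (λ j → ∑ (allFin n) λ z → Q (suc j) x z * (t ^ˢ j *ˢ (b *ˢ X z y)) w) ∎) ⟩
        _ ≈⟨ X-at x y w ⟨
        X x y w ∎
        where
        open DecStrictPartialOrder levelPoset using (_<?_)

        p : Element
        p = x , + i

        g : Element → Carrier
        g z = 𝟙 (does (p <? z)) * (t ^ˢ (ρ[ p , z ] ℕ.∸ 1) *ˢ (b *ˢ chainSum I N z q₀)) w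

        outside : ∀ z → ¬ (p₀ ≤ z × z ≤ q₀) → g z ≈ 0#
        outside z ∉I = vanish (p <? z)
          where
          vanish : (p<z? : Dec (p ≺ z)) →
                   𝟙 (does p<z?) * (t ^ˢ (ρ[ p , z ] ℕ.∸ 1) *ˢ (b *ˢ chainSum I N z q₀)) w ≈ 0#
          vanish (no  _)   = zeroˡ _
          vanish (yes p<z) = trans (*-congˡ (trans
            (linear-^-local t linear-t (ρ[ p , z ] ℕ.∸ 1) (b *ˢ chainSum I N z q₀) 0ˢ w
              (λ v _ → ∑-zero (splits v) λ (u , u′) → trans (*-congˡ
                (chainSum-zero I N (λ z<q → ∉I (inj₁ (≤-≺-trans M p₀≤p p<z) , inj₁ z<q)) u′)) (zeroʳ _)))
            (∑-zero (splits w) λ _ → zeroʳ _))) (zeroʳ _)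

        -- Of the `m + 2` levels, the first `suc i` are not above `p`; the other `suc d` reach from
        -- `suc i` to the level `suc m` of `q₀`.
        levels : suc (suc (m ℕ.+ 0)) ≡ suc i ℕ.+ suc d
        levels = ≡.cong suc (≡.trans (≡.cong suc (≡.trans (ℕ.+-identityʳ m) (≡.sym i+d≡m)))
          (≡.sym (ℕ.+-suc i d)))

        below : ∀ z k → k ℕ.< suc i → g (z , + k) ≈ 0#
        below z k (s≤s k≤i) = trans (*-congʳ (reflexive (≡.cong 𝟙
          (dec-false (p <? (z , + k)) λ (i<k , _) → ℕ.<⇒≱ (ℤ.drop‿+<+ i<k) k≤i)))) (zeroˡ _)

        term : ∀ z j → g (z , + (suc i ℕ.+ j)) ≈ Q (suc j) x z * (t ^ˢ j *ˢ (b *ˢ X z y)) w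
        term z j = trans (*-congʳ (𝟙-≺ x z i (suc i ℕ.+ j) j ≡.refl)) (scaled (0 ℕ.<? (M ^ᴹ suc j) x z))
          where
          z′ : Element
          z′ = z , + (suc i ℕ.+ j)

          -- The induction hypothesis asks for `p₀ ≤ z′`, which is available only where the
          -- indicator is 1.
          scaled : (0<? : Dec (0 ℕ.< (M ^ᴹ suc j) x z)) →
                   𝟙 (does 0<?) * (t ^ˢ (ρ[ p , z′ ] ℕ.∸ 1) *ˢ (b *ˢ chainSum I N z′ q₀)) w
                   ≈ 𝟙 (does 0<?) * (t ^ˢ j *ˢ (b *ˢ X z y)) w
          scaled (no  _)  = trans (zeroˡ _) (sym (zeroˡ _))
          scaled (yes 0<) = *-congˡ (trans
            (reflexive (≡.cong (λ e → (t ^ˢ e *ˢ (b *ˢ chainSum I N z′ q₀)) w)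
              (ρ-1 x z i (suc i ℕ.+ j) j ≡.refl)))
            (linear-^-local t linear-t j (b *ˢ chainSum I N z′ q₀) (b *ˢ X z y) w local))
            where
            local : ∀ v → j ℕ.+ length v ≡ length w → (b *ˢ chainSum I N z′ q₀) v ≈ (b *ˢ X z y) v
            -- The empty word occurs when `z′` lies on the level of `q₀`, beyond the reach of the
            -- induction hypothesis; both sides vanish there because b has no constant term.
            local []      _  = trans (linear-[] b (linear-var 1F) (chainSum I N z′ q₀))
              (sym (linear-[] b (linear-var 1F) (X z y)))
            local (k ∷ v) eq = begin
              (b *ˢ chainSum I N z′ q₀) (k ∷ v)
                ≈⟨ linear-∷ b (linear-var 1F) (chainSum I N z′ q₀) k v ⟩
              b (k ∷ []) * chainSum I N z′ q₀ v
                ≈⟨ *-congˡ (chainSum≈X N (suc i ℕ.+ j) (length v) z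
                     (≡.trans (≡.sym (≡.trans (≡.cong (i ℕ.+_) eq′) (≡.trans (ℕ.+-suc i (j ℕ.+ length v))
                       (≡.cong suc (≡.sym (ℕ.+-assoc i j (length v))))))) i+d≡m)
                     (ℕ.≤-pred (ℕ.≤-trans (≡.subst (suc (length v) ℕ.≤_) (≡.sym eq′) (s≤s (ℕ.m≤n+m (length v) j))) d≤N))
                     (inj₁ (≤-≺-trans M p₀≤p (Equivalence.from (≺⇔ M i j) 0<))) v ≡.refl) ⟩
              b (k ∷ []) * X z y v
                ≈⟨ linear-∷ b (linear-var 1F) (X z y) k v ⟨
              (b *ˢ X z y) (k ∷ v) ∎
              where
              eq′ : length w ≡ suc (j ℕ.+ length v)
              eq′ = ≡.trans (≡.sym eq) (ℕ.+-suc j (length v))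

-- Rationality over a nonzero commutative ring in which 2 is invertible

module LevelTheorem {ρ ℓ} (R : CommutativeRing ρ ℓ)
  (1≉0 : ¬ (CommutativeRing._≈_ R (CommutativeRing.1# R) (CommutativeRing.0# R)))
  (½ : CommutativeRing.Carrier R)
  (½+½≈1 : CommutativeRing._≈_ R (CommutativeRing._+_ R ½ ½) (CommutativeRing.1# R))
  {n : ℕ} (M : Matrix n) (eulerian : LevelPoset.LevelEulerian M) where

  open CommutativeRing R hiding (zero)
  open PowerSeries R
  open Series R
  open TwoVariables R using (b; c; d; t)
  open LevelSeries R M
  open CDRational R 1≉0 ½ ½+½≈1 n
  open LevelPoset M using (Element; levelPoset; interval; _≤_; _≤?_; chains; ρ[_,_])
  open ChainSums R levelPoset proj₂
  open SetoidReasoning setoid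

  automatic : ∀ u v → Automatic (λ r → Q r u v)
  automatic u v = record
    { next       = next u v
    ; out        = out u v
    ; state      = state u v
    ; state-next = λ _ → ≡.refl
    ; state-out  = state-out u v
    }

  cd-series : Fin n → Fin n → Series 2
  cd-series = Φ Q Q₀ automatic (λ m x y → euler m x y eulerian)

  cd-series-rational : ∀ x y → Rational (cd-series x y)
  cd-series-rational = rational-Φ Q Q₀ automatic (λ m x y → euler m x y eulerian)

  ab-series : (Element → List Element → Element → Series 2) → Fin n → Fin n → Series 2
  ab-series weight x y w = let p = x , 0ℤ; q = y , + suc (length w) in
    (if does (p ≤? q) then ∑ˢ (chains (interval p q) p q) (λ c → weight p c q) else 0ˢ) w

  open Chains (λ x y → cd-series x y ⟪ c ∷ d ∷ [] ⟫)
    (Φ⟪c,d⟫≈ Q Q₀ automatic (λ m x y → euler m x y eulerian)) using (chainSum≈X)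

  -- The letters and the weights are abstracted, and their laws named, so that at
  -- R = ℝ they hold almost syntactically: comparing real-valued series by unfolding
  -- would compare their Cauchy proofs.
  Letters : (A B : Series 2) → Vec (Series 2) 2 → Set ρ
  Letters A B σ = A ≡ var 0F × B ≡ var 1F × σ ≡ (A +ˢ B) ∷ (A *ˢ B +ˢ B *ˢ A) ∷ []

  Weights : (A B : Series 2) → (Element → List Element → Element → Series 2) → Set ρ
  Weights A B weight =
    (∀ p q → weight p [] q ≡ (A -ˢ B) ^ˢ (Graded.ρ[_,_] levelPoset proj₂ p q ℕ.∸ 1)) ×
    (∀ p z c q → weight p (z ∷ c) q ≡
                 (A -ˢ B) ^ˢ (Graded.ρ[_,_] levelPoset proj₂ p z ℕ.∸ 1) *ˢ B *ˢ weight z c q)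

  CD-rational : Vec (Series 2) 2 → Series 2 → Set (ρ Level.⊔ ℓ)
  CD-rational σ Ψ = ∃ λ Φ → Rational Φ × Ψ ≈ˢ Φ ⟪ σ ⟫

  ab-series-rational : ∀ A B σ → Letters A B σ → ∀ weight → Weights A B weight →
                       ∀ x y → CD-rational σ (ab-series weight x y)
  ab-series-rational _ _ _ (≡.refl , ≡.refl , ≡.refl) weight (weight-[] , weight-∷) x y =
    cd-series x y , cd-series-rational x y , λ w → AtWord.result w
    where
    weight≡wt : ∀ p c q → weight p c q ≡ wt p c q
    weight≡wt p []      q = weight-[] p q
    weight≡wt p (z ∷ c) q = ≡.trans (weight-∷ p z c q)
      (≡.cong (λ f → t ^ˢ (ρ[ p , z ] ℕ.∸ 1) *ˢ b *ˢ f) (weight≡wt z c q))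

    module AtWord (w : Word 2) where

      m : ℕ
      m = length w

      p q : Element
      p = x , 0ℤ
      q = y , + suc m

      I : List Element
      I = interval p q

      chainSum≈ : ∀ N → m ℕ.≤ N → chainSum I N p q w ≈ (cd-series x y ⟪ c ∷ d ∷ [] ⟫) w
      chainSum≈ N m≤N = chainSum≈X x y m N 0 m x ≡.refl m≤N (inj₂ ≡.refl) w ≡.refl

      byCases : (p≤?q : Dec (p ≤ q)) →
                (if does p≤?q then ∑ˢ (chains I p q) (λ c → weight p c q) else 0ˢ) w
                ≈ (cd-series x y ⟪ c ∷ d ∷ [] ⟫) w
      byCases (yes p≤q) = begin
        ∑ (chains I p q) (λ c → weight p c q w)
          ≈⟨ ∑-cong (chains I p q) (λ c → reflexive (≡.cong (λ f → f w) (weight≡wt p c q))) ⟩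
        ∑ (chains I p q) (λ c → wt p c q w)
          ≈⟨ Indicator.∑-filter R (chain? p q) (tuples≤ I (length I)) (λ c → wt p c q w) ⟩
        chainSum I (length I) p q w
          ≈⟨ chainSum≈ (length I) (ℕ.≤-trans (ℕ.n≤1+n m) (length-interval M x y (suc m) p≤q)) ⟩
        (cd-series x y ⟪ c ∷ d ∷ [] ⟫) w ∎
      -- The chain sum agrees with the cd-series whether or not `p ≤ q`. Here there are no chains,
      -- so both are zero, in accordance with the convention for unrelated endpoints.
      byCases (no p≰q)  = trans (sym (chainSum-zero I m (p≰q ∘ inj₁) w)) (chainSum≈ m ℕ.≤-refl)

      result : ab-series weight x y w ≈ (cd-series x y ⟪ c ∷ d ∷ [] ⟫) w
      result = byCases (p ≤? q)

-- Specialisation to the real numbers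

open import Defs
open import Data.Nat.Base using (ℕ; NonZero)
open import Data.Fin.Base using (Fin)
open import Data.Product.Base using (∃; _×_)
open import Data.Vec.Base using ([]; _∷_)

module Reals = CommutativeRing ℝ-commutativeRing

1≉0 : ¬ (Reals.1# Reals.≈ Reals.0#)
1≉0 1≈0 with N , close ← Real.difference 1≈0 1ℚ (ℚ.positive⁻¹ 1ℚ) = ℚ.<-irrefl ≡.refl (close N ℕ.≤-refl)

half+half≈1 : Real.fromℚ ½ Reals.+ Real.fromℚ ½ Reals.≈ Reals.1#
half+half≈1 = Real.null λ ε 0<ε → 0 , λ _ _ → 0<ε

CD-rational : Vec (Series 2) 2 → Series 2 → Set
CD-rational σ Ψ = ∃ λ (Φ : Series 2) → Rational Φ × Ψ ≈ˢ Φ ⟪ σ ⟫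

CD-rational-resp : ∀ {σ Ψ Ψ′} → (∀ w → Ψ w ≡ Ψ′ w) → CD-rational σ Ψ → CD-rational σ Ψ′
CD-rational-resp {σ} Ψ≡Ψ′ (Φ , rational , Ψ≈) =
  Φ , rational , λ w → ≡.subst (Reals._≈ (Φ ⟪ σ ⟫) w) (Ψ≡Ψ′ w) (Ψ≈ w)

module _ {n} (M : Matrix n) (eulerian : LevelPoset.LevelEulerian M) where

  module L = LevelTheorem ℝ-commutativeRing 1≉0 (Real.fromℚ ½) half+half≈1 M eulerian

  letters : L.Letters 𝐚 𝐛 (𝐜 ∷ 𝐝 ∷ [])
  letters = ≡.refl , ≡.refl , ≡.refl

  weights : L.Weights 𝐚 𝐛 (Graded.wt (LevelPoset.levelPoset M) proj₂)
  weights = (λ p q → ≡.refl) , (λ p z c q → ≡.refl)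

  -- With σ and Ψ variables, the conversion does not unfold any real-valued series.
  generic⇒real : ∀ {σ Ψ} → L.CD-rational σ Ψ → CD-rational σ Ψ
  generic⇒real (Φ , rational , Ψ≈) = Φ , rational , Ψ≈

  Ψ ab-series : Fin n → Fin n → Series 2
  Ψ = LevelPoset.Ψ[_,_] M
  ab-series = L.ab-series (Graded.wt (LevelPoset.levelPoset M) proj₂)

  ab-series≡Ψ : ∀ x y w → ab-series x y w ≡ Ψ x y w
  ab-series≡Ψ x y w = ≡.refl

  ab-series-rational : ∀ x y → CD-rational (𝐜 ∷ 𝐝 ∷ []) (ab-series x y)
  ab-series-rational x y = generic⇒real {𝐜 ∷ 𝐝 ∷ []} {ab-series x y}
    (L.ab-series-rational 𝐚 𝐛 (𝐜 ∷ 𝐝 ∷ []) letters (Graded.wt (LevelPoset.levelPoset M) proj₂) weights x y)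

  Ψ-rational : ∀ x y → CD-rational (𝐜 ∷ 𝐝 ∷ []) (Ψ x y)
  Ψ-rational x y = CD-rational-resp {𝐜 ∷ 𝐝 ∷ []} {ab-series x y} {Ψ x y} (ab-series≡Ψ x y) (ab-series-rational x y)

theorem7p4 : ∀ (n : ℕ) .{{_ : NonZero n}} (M : Matrix n) → ZeroOne M →
    LevelPoset.LevelEulerian M → ∀ (x y : Fin n) →
    ∃ λ (Φ : Series 2) →
    Rational Φ × LevelPoset.Ψ[_,_] M x y ≈ˢ Φ ⟪ 𝐜 ∷ 𝐝 ∷ [] ⟫
theorem7p4 n M _ eulerian x y = Ψ-rational M eulerian x y
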